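{- Let $E/\mathbb{Q}$ be an elliptic curve and let $T$ be one of the fifteen groups $C_1,\dots,C_{10},C_{12}$, $C_2\times C_2$, $C_2\times C_4$, $C_2\times C_6$, $C_2\times C_8$ (the torsion groups allowed by Mazur's theorem), where $C_m$ is the cyclic group of order $m$. If $T$ embeds in $E(\mathbb{Q})_{\mathrm{tors}}$, then $\operatorname{rmm}(E)=R_i$ for some $i$ in the following set depending on $T$: $T=C_1$: $i\in\{1,\dots,12\}$; $T\in\{C_2,C_4,C_2\times C_2\}$: $i\in\{1,3,5,7,8,9,10,11,12\}$; $T=C_3$: $i\in\{1,2,5,6,7,8,9,10\}$; $T=C_5$: $i\in\{4,6,7,12\}$; $T=C_6$: $i\in\{1,5,7,8,9,10\}$; $T\in\{C_7,C_9\}$: $i\in\{7,10\}$; $T\in\{C_8,C_2\times C_4\}$: $i\in\{3,5,7,12\}$; $T\in\{C_{10},C_2\times C_8\}$: $i=7$; $T\in\{C_{12},C_2\times C_6\}$: $i\in\{7,8,9,10\}$.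
   Context: A global minimal model of an elliptic curve $E/\mathbb{Q}$ is a Weierstrass model $y^2+a_1xy+a_3y=x^3+a_2x^2+a_4x+a_6$ with all $a_j\in\mathbb{Z}$, $\mathbb{Q}$-isomorphic to $E$, whose discriminant has minimal absolute value among all such integral models. The reduced minimal model of $E$ is the (unique) global minimal model with $a_1,a_3\in\{0,1\}$ and $a_2\in\{ -1,0,1\}$; one writes $\operatorname{rmm}(E)=(a_1,a_2,a_3)$ for its coefficients. For $1\le i\le 12$, $R_i=(a_1,a_2,a_3)$ is defined by: $R_1=(0,0,0)$, $R_2=(0,0,1)$, $R_3=(0,-1,0)$, $R_4=(0,-1,1)$, $R_5=(0,1,0)$, $R_6=(0,1,1)$, $R_7=(1,0,0)$, $R_8=(1,0,1)$, $R_9=(1,-1,0)$, $R_{10}=(1,-1,1)$, $R_{11}=(1,1,0)$, $R_{12}=(1,1,1)$. -}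

module Defs where

open import Data.Nat as ℕ using (ℕ; zero; suc)
open import Data.Nat.DivMod using (_mod_)
open import Data.Integer as Z using (ℤ; +_)
open import Data.Rational as Q using (ℚ; 0ℚ; _/_; ≢-nonZero)
open import Data.Rational.Properties using (_≟_)
open import Data.Fin as Fin using (Fin; toℕ)
open import Data.Product using (_×_; _,_; Σ; ∃; ∃-syntax)
open import Data.List using (List; []; _∷_)
open import Data.Sum using (_⊎_)
open import Function.Definitions using (Injective)
open import Relation.Binary.PropositionalEquality using (_≡_; _≢_)
open import Relation.Nullary using (yes; no)
open import Data.Unit using (⊤)

-- Weierstrass models  y² + a₁xy + a₃y = x³ + a₂x² + a₄x + a₆

record WModel (A : Set) : Set where
  constructor wm
  field
    a1 a2 a3 a4 a6 : A

open WModel public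

q : ℕ → ℚ
q n = (+ n) / 1

-- discriminant (Silverman III.1) of a rational model
module _ where
  open Q using (_+_; _*_; _-_; -_)

  discQ : WModel ℚ → ℚ
  discQ (wm a₁ a₂ a₃ a₄ a₆) =
    let b2 = a₁ * a₁ + q 4 * a₂
        b4 = q 2 * a₄ + a₁ * a₃
        b6 = a₃ * a₃ + q 4 * a₆
        b8 = a₁ * a₁ * a₆ + q 4 * a₂ * a₆ - a₁ * a₃ * a₄ + a₂ * a₃ * a₃ - a₄ * a₄
    in  (- (b2 * b2 * b8)) - q 8 * b4 * b4 * b4 - q 27 * b6 * b6 + q 9 * b2 * b4 * b6

module _ where
  open Z using (_+_; _*_; _-_; -_)

  discZ : WModel ℤ → ℤ
  discZ (wm a₁ a₂ a₃ a₄ a₆) =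
    let b2 = a₁ * a₁ + + 4 * a₂
        b4 = + 2 * a₄ + a₁ * a₃
        b6 = a₃ * a₃ + + 4 * a₆
        b8 = a₁ * a₁ * a₆ + + 4 * a₂ * a₆ - a₁ * a₃ * a₄ + a₂ * a₃ * a₃ - a₄ * a₄
    in  (- (b2 * b2 * b8)) - + 8 * b4 * b4 * b4 - + 27 * b6 * b6 + + 9 * b2 * b4 * b6

toQ : WModel ℤ → WModel ℚ
toQ (wm a₁ a₂ a₃ a₄ a₆) = wm (a₁ / 1) (a₂ / 1) (a₃ / 1) (a₄ / 1) (a₆ / 1)

-- ℚ-isomorphism of Weierstrass models (Silverman III.1, Table 3.1):
-- E' is obtained from E by x = u²x' + r, y = u³y' + su²x' + t, u ≠ 0.

module _ where
  open Q using (_+_; _*_; _-_)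

  IsoQ : WModel ℚ → WModel ℚ → Set
  IsoQ (wm a₁ a₂ a₃ a₄ a₆) (wm b₁ b₂ b₃ b₄ b₆) =
    Σ ℚ λ u → Σ ℚ λ r → Σ ℚ λ s → Σ ℚ λ t →
      u ≢ 0ℚ
      × u * b₁ ≡ a₁ + q 2 * s
      × u * u * b₂ ≡ a₂ - s * a₁ + q 3 * r - s * s
      × u * u * u * b₃ ≡ a₃ + r * a₁ + q 2 * t
      × u * u * u * u * b₄ ≡ a₄ - s * a₃ + q 2 * r * a₂ - (t + r * s) * a₁ + q 3 * r * r - q 2 * s * t
      × u * u * u * u * u * u * b₆ ≡ a₆ + r * a₄ + r * r * a₂ + r * r * r - t * a₃ - t * t - r * t * a₁

IntegralModelOf : WModel ℚ → WModel ℤ → Set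
IntegralModelOf E M = IsoQ E (toQ M)

IsGlobalMinimal : WModel ℚ → WModel ℤ → Set
IsGlobalMinimal E M =
  IntegralModelOf E M ×
  (∀ (M' : WModel ℤ) → IntegralModelOf E M' → Z.∣ discZ M ∣ ℕ.≤ Z.∣ discZ M' ∣)

IsReduced : WModel ℤ → Set
IsReduced M =
  (a1 M ≡ + 0 ⊎ a1 M ≡ + 1) ×
  (a2 M ≡ Z.- (+ 1) ⊎ a2 M ≡ + 0 ⊎ a2 M ≡ + 1) ×
  (a3 M ≡ + 0 ⊎ a3 M ≡ + 1)

IsReducedMinimalModel : WModel ℚ → WModel ℤ → Set
IsReducedMinimalModel E M = IsGlobalMinimal E M × IsReduced M

R : ℕ → ℤ × ℤ × ℤ
R 1  = + 0 , + 0 , + 0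
R 2  = + 0 , + 0 , + 1
R 3  = + 0 , Z.- (+ 1) , + 0
R 4  = + 0 , Z.- (+ 1) , + 1
R 5  = + 0 , + 1 , + 0
R 6  = + 0 , + 1 , + 1
R 7  = + 1 , + 0 , + 0
R 8  = + 1 , + 0 , + 1
R 9  = + 1 , Z.- (+ 1) , + 0
R 10 = + 1 , Z.- (+ 1) , + 1
R 11 = + 1 , + 1 , + 0
R 12 = + 1 , + 1 , + 1
R _  = + 0 , + 0 , + 0   -- unused (indices outside 1..12 never occur)

coeffs : WModel ℤ → ℤ × ℤ × ℤ
coeffs M = a1 M , a2 M , a3 M

-- Rational points and the group law (Silverman III.2.3)

data Point : Set where
  O   : Point
  aff : ℚ → ℚ → Point

module _ where
  open Q using (_+_; _*_; _-_; -_; _÷_)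

  OnCurve : WModel ℚ → Point → Set
  OnCurve E O = ⊤
  OnCurve (wm a₁ a₂ a₃ a₄ a₆) (aff x y) =
    y * y + a₁ * x * y + a₃ * y ≡ x * x * x + a₂ * x * x + a₄ * x + a₆

  -- chord-and-tangent formulas; λ is the slope, ν the intercept
  third : WModel ℚ → ℚ → ℚ → ℚ → ℚ → Point
  third (wm a₁ a₂ a₃ a₄ a₆) x₁ y₁ x₂ l =
    let x₃ = l * l + a₁ * l - a₂ - x₁ - x₂
        ν  = y₁ - l * x₁
    in aff x₃ ((- ((l + a₁) * x₃)) - ν - a₃)

  addPt : WModel ℚ → Point → Point → Point
  addPt E O P = P
  addPt E (aff x₁ y₁) O = aff x₁ y₁
  addPt E@(wm a₁ a₂ a₃ a₄ a₆) (aff x₁ y₁) (aff x₂ y₂) with (x₂ - x₁) ≟ 0ℚ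
  ... | no d≢0 = third E x₁ y₁ x₂ (((y₂ - y₁) ÷ (x₂ - x₁)) {{≢-nonZero d≢0}})
  ... | yes _ with (y₁ + y₂ + a₁ * x₂ + a₃) ≟ 0ℚ
  ...   | yes _ = O
  ...   | no _ with (q 2 * y₁ + a₁ * x₁ + a₃) ≟ 0ℚ
  ...     | yes _ = O   -- unreachable for points on the curve
  ...     | no t≢0 = third E x₁ y₁ x₂
                ((((q 3 * x₁ * x₁ + q 2 * a₂ * x₁ + a₄) - a₁ * y₁) ÷ (q 2 * y₁ + a₁ * x₁ + a₃))
                  {{≢-nonZero t≢0}})

data TorsionGroup : Set where
  C1 C2 C3 C4 C5 C6 C7 C8 C9 C10 C12 C2×C2 C2×C4 C2×C6 C2×C8 : TorsionGroup

-- T ≅ C_(suc (fst T)) × C_(suc (snd T))   (C₁ × C_n = C_n)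
ord₁ ord₂ : TorsionGroup → ℕ   -- orders minus one
ord₁ C2×C2 = 1
ord₁ C2×C4 = 1
ord₁ C2×C6 = 1
ord₁ C2×C8 = 1
ord₁ _     = 0
ord₂ C1  = 0
ord₂ C2  = 1
ord₂ C3  = 2
ord₂ C4  = 3
ord₂ C5  = 4
ord₂ C6  = 5
ord₂ C7  = 6
ord₂ C8  = 7
ord₂ C9  = 8
ord₂ C10 = 9
ord₂ C12 = 11
ord₂ C2×C2 = 1
ord₂ C2×C4 = 3
ord₂ C2×C6 = 5
ord₂ C2×C8 = 7

Carrier : TorsionGroup → Set
Carrier T = Fin (suc (ord₁ T)) × Fin (suc (ord₂ T))

addC : (T : TorsionGroup) → Carrier T → Carrier T → Carrier T
addC T (a , b) (c , d) =
  ((toℕ a ℕ.+ toℕ c) mod suc (ord₁ T)) , ((toℕ b ℕ.+ toℕ d) mod suc (ord₂ T))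

-- T embeds in E(ℚ)_tors: an injective group homomorphism T → E(ℚ).
-- (Its image is automatically torsion since T is finite.)
Embeds : TorsionGroup → WModel ℚ → Set
Embeds T E =
  Σ (Carrier T → Point) λ f →
    (∀ g → OnCurve E (f g)) ×
    (∀ g h → f (addC T g h) ≡ addPt E (f g) (f h)) ×
    Injective _≡_ _≡_ f

allowed : TorsionGroup → List ℕ
allowed C1    = 1 ∷ 2 ∷ 3 ∷ 4 ∷ 5 ∷ 6 ∷ 7 ∷ 8 ∷ 9 ∷ 10 ∷ 11 ∷ 12 ∷ []
allowed C2    = 1 ∷ 3 ∷ 5 ∷ 7 ∷ 8 ∷ 9 ∷ 10 ∷ 11 ∷ 12 ∷ []
allowed C4    = 1 ∷ 3 ∷ 5 ∷ 7 ∷ 8 ∷ 9 ∷ 10 ∷ 11 ∷ 12 ∷ []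
allowed C2×C2 = 1 ∷ 3 ∷ 5 ∷ 7 ∷ 8 ∷ 9 ∷ 10 ∷ 11 ∷ 12 ∷ []
allowed C3    = 1 ∷ 2 ∷ 5 ∷ 6 ∷ 7 ∷ 8 ∷ 9 ∷ 10 ∷ []
allowed C5    = 4 ∷ 6 ∷ 7 ∷ 12 ∷ []
allowed C6    = 1 ∷ 5 ∷ 7 ∷ 8 ∷ 9 ∷ 10 ∷ []
allowed C7    = 7 ∷ 10 ∷ []
allowed C9    = 7 ∷ 10 ∷ []
allowed C8    = 3 ∷ 5 ∷ 7 ∷ 12 ∷ []
allowed C2×C4 = 3 ∷ 5 ∷ 7 ∷ 12 ∷ []
allowed C10   = 7 ∷ []
allowed C2×C8 = 7 ∷ []
allowed C12   = 7 ∷ 8 ∷ 9 ∷ 10 ∷ []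
allowed C2×C6 = 7 ∷ 8 ∷ 9 ∷ 10 ∷ []

{-# OPTIONS --safe #-}

-- Two of the twelve triples (a₁, a₂, a₃) are told apart by the residue of b₂ modulo 3 and by the shape of the
-- reduction modulo 2, and both are unchanged by x = x′ + r, y = y′ + s x′ + t with r, s, t integral at the prime.
-- At p = 2 and p = 3 the coordinates of the torsion points are p-integral (apart from points of order 2 at p = 2),
-- because 1/x(2P) is 1/x(P) times a number congruent to 4 when x(P) has a pole. Moving a torsion point P to the
-- origin with horizontal tangent is therefore an integral change of variables, and it gives the Tate normal form
-- y² + A₁xy + A₃y = x³ + A₂x². The slopes of the lines through P and 2P, 3P, 4P satisfy monic equations, so they
-- are integral parameters of weight one for the Aᵢ, linked by the relation that expresses the order of P. By
-- minimality p does not divide all of them, and the residues that are left give the assertion.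
-- When P has order 4 and 2P reduces to the identity, or order 8 and 4P does, the slope with a pole is treated by hand.

module Submission where

open import Defs
open import Data.Nat as ℕ using (ℕ; zero; suc)
import Data.Nat.Properties as ℕₚ
import Data.Nat.Divisibility as ℕᵈ
open import Data.Nat.Primality using (Prime; prime?; euclidsLemma; prime⇒irreducible; prime⇒nonZero; prime⇒nonTrivial)
open import Data.Nat.Coprimality using (Coprime; coprime-Bézout; recompute)
import Data.Nat.GCD as GCD
open import Data.Integer as Z using (ℤ; +_; -[1+_])
import Data.Integer.Properties as Zₚ
open import Data.Integer.DivMod using (_%ℕ_; _/ℕ_; a≡a%ℕn+[a/ℕn]*n; n%ℕd<d)
open import Data.Integer.Divisibility.Signed using (_∣_; divides; _∣?_; ∣⇒∣ᵤ; ∣ᵤ⇒∣)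
import Data.Integer.Tactic.RingSolver as ℤSolver
open import Data.Rational using (ℚ; mkℚ; 0ℚ; 1ℚ; _+_; _*_; _-_; -_; _÷_; 1/_; _/_; ≢-nonZero; ↥_; ↧_)
open import Data.Rational.Properties
  using (_≟_; +-*-commutativeRing; ↥p/↧p≡p; *-inverseʳ; fromℚᵘ-cong; *-zeroˡ; *-zeroʳ; *-comm; *-identityˡ; *-identityʳ; +-inverseʳ; +-identityˡ)
open import Data.Rational.Unnormalised using (mkℚᵘ; *≡*)
open import Data.Bool using (Bool; true; false; _∧_; _∨_; not; T)
open import Data.Bool.Properties using (T-∧)
open import Data.Fin using (Fin; zero; suc; #_)
open import Data.List using (List; []; _∷_)
open import Data.List.Membership.DecPropositional ℕ._≟_ using (_∈?_)
open import Data.List.Membership.Propositional using (_∈_)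
open import Data.List.Relation.Unary.Any using (Any; any?)
open import Data.List.Relation.Unary.All.Properties using (All¬⇒¬Any)
open import Data.List.Relation.Unary.All using (All; all?) renaming (lookup to lookupAll; [] to []ᵃ; _∷_ to infixr 5 _∷ᵃ_)
open import Data.Maybe using (Maybe; just; nothing)
open import Data.Product using (_×_; _,_; Σ; ∃-syntax; proj₁; proj₂)
open import Data.Sum using (_⊎_; inj₁; inj₂)
open import Data.Empty using (⊥; ⊥-elim)
open import Data.Unit using (tt)
open import Data.Vec as Vec using (Vec; lookup) renaming ([] to []ᵛ; _∷_ to infixr 5 _∷ᵛ_)
open import Relation.Binary.PropositionalEquality
open import Relation.Nullary using (¬_; yes; no; Dec)
open import Relation.Nullary.Decidable using (_⊎-dec_; ⌊_⌋; toWitness; fromWitness; from-yes)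
open import Data.Vec.Relation.Unary.All using () renaming (All to AllV; [] to []ᴵ; _∷_ to infixr 5 _∷ᴵ_)
open import Data.Vec.Properties using (lookup-map)
import Data.Vec.Relation.Unary.All.Properties as VecAllₚ
open import Tactic.RingSolver.Core.AlmostCommutativeRing using (AlmostCommutativeRing; fromCommutativeRing)
open import Function using (_∘_; Equivalence)

-- Minimality is a global statement about discriminants, while the normal forms are reached by
-- substitutions that are only p-integral. Density of ℤ in ℤ₍ₚ₎ closes the gap: r, s, t are replaced
-- by integers close to them at p, the model stays integral everywhere, and the discriminant drops
-- by the factor p¹². Integrality of the coordinates is what makes the rest finite. An implication
-- between polynomial congruences in p-integral numbers depends only on residues modulo a power of
-- p, so it is settled by enumeration; a number with a pole has no residue and must first be
-- replaced by its reciprocal. The moduli have arithmetic origins: 8 and 16 at the prime 2 express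
-- that certain numbers are not squares, or that 4 stays visible next to a deep pole; at the prime 3
-- the factor 4 of duplication is compared with 1 modulo 9, and for order 7 modulo 27, because 4³ ≡
-- 1 modulo 9. Three residues of b₂ and four shapes modulo 2 account for exactly twelve triples, so
-- each group is treated by excluding values of these two invariants.

-- Ring identities and cancellation in ℚ

ℚ-ring : AlmostCommutativeRing _ _
ℚ-ring = fromCommutativeRing +-*-commutativeRing zero?
  where
  zero? : ∀ x → Maybe (0ℚ ≡ x)
  zero? x with x ≟ 0ℚ
  ... | yes p = just (sym p)
  ... | no _  = nothing

open import Tactic.RingSolver.NonReflective ℚ-ring using (solve; _⊕_; _⊗_; ⊝_; Κ) renaming (Expr to Polynomial; _⊜_ to infix 4 _≋_)

infixl 6 _⊖_
_⊖_ : ∀ {n} → Polynomial ℚ n → Polynomial ℚ n → Polynomial ℚ n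
x ⊖ y = x ⊕ ⊝ y

x-y≡0⇒x≡y : ∀ {x y} → x - y ≡ 0ℚ → x ≡ y
x-y≡0⇒x≡y {x} {y} h = trans (expand x y) (trans (cong (_+ y) h) (+-identityˡ y))
  where
  expand = solve 2 (λ x y → x ≋ (x ⊖ y) ⊕ y) refl

x≡y⇒x-y≡0 : ∀ {x y} → x ≡ y → x - y ≡ 0ℚ
x≡y⇒x-y≡0 {x} refl = +-inverseʳ x

-- The last argument exhibits E − F as a linear combination of the hypotheses; it is a ring identity.
lin₁ : ∀ {A B E F} c → A ≡ B → E - F ≡ c * (A - B) → E ≡ F
lin₁ {A} c refl h = x-y≡0⇒x≡y (trans h (vanish c A))
  where
  vanish = solve 2 (λ c A → c ⊗ (A ⊖ A) ≋ Κ 0ℚ) refl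

lin₂ : ∀ {A B A′ B′ E F} c c′ → A ≡ B → A′ ≡ B′ → E - F ≡ c * (A - B) + c′ * (A′ - B′) → E ≡ F
lin₂ {A} {A′ = A′} c c′ refl refl h = x-y≡0⇒x≡y (trans h (vanish c c′ A A′))
  where
  vanish = solve 4 (λ c c′ A A′ → c ⊗ (A ⊖ A) ⊕ c′ ⊗ (A′ ⊖ A′) ≋ Κ 0ℚ) refl

lin₃ : ∀ {A B A′ B′ A″ B″ E F} c c′ c″ → A ≡ B → A′ ≡ B′ → A″ ≡ B″ →
       E - F ≡ c * (A - B) + c′ * (A′ - B′) + c″ * (A″ - B″) → E ≡ F
lin₃ {A} {A′ = A′} {A″ = A″} c c′ c″ refl refl refl h = x-y≡0⇒x≡y (trans h (vanish c c′ c″ A A′ A″))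
  where
  vanish = solve 6 (λ c c′ c″ A A′ A″ → c ⊗ (A ⊖ A) ⊕ c′ ⊗ (A′ ⊖ A′) ⊕ c″ ⊗ (A″ ⊖ A″) ≋ Κ 0ℚ) refl

abstract
  -- The reciprocal is sealed, so that later arguments see only the equation `x * y ≡ 1ℚ` and never
  -- unfold the normalisation of a fraction.
  inverse : ∀ {x} → x ≢ 0ℚ → ∃[ y ] x * y ≡ 1ℚ
  inverse {x} x≢0 = (1/ x) {{≢-nonZero x≢0}} , *-inverseʳ x {{≢-nonZero x≢0}}

zero-product : ∀ {x y} → x * y ≡ 0ℚ → x ≢ 0ℚ → y ≡ 0ℚ
zero-product {x} {y} xy≡0 x≢0 = by-inverse (inverse x≢0)
  where
  by-inverse : ∃[ i ] x * i ≡ 1ℚ → y ≡ 0ℚ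
  by-inverse (i , xi≡1) = lin₂ i (- y) xy≡0 xi≡1 (identity x y i)
    where
    identity = solve 3 (λ x y i → y ⊖ Κ 0ℚ ≋ i ⊗ (x ⊗ y ⊖ Κ 0ℚ) ⊕ ⊝ y ⊗ (x ⊗ i ⊖ Κ 1ℚ)) refl

*-≢0 : ∀ {x y} → x ≢ 0ℚ → y ≢ 0ℚ → x * y ≢ 0ℚ
*-≢0 x≢0 y≢0 xy≡0 = y≢0 (zero-product xy≡0 x≢0)

cancel : ∀ {x y z} → x ≢ 0ℚ → x * y ≡ x * z → y ≡ z
cancel {x} {y} {z} x≢0 h = x-y≡0⇒x≡y (zero-product {x} {y - z} (lin₁ 1ℚ h (identity x y z)) x≢0)
  where
  identity = solve 3 (λ x y z → x ⊗ (y ⊖ z) ⊖ Κ 0ℚ ≋ Κ 1ℚ ⊗ (x ⊗ y ⊖ x ⊗ z)) refl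

square≡0 : ∀ {x} → x * x ≡ 0ℚ → x ≡ 0ℚ
square≡0 {x} h with x ≟ 0ℚ
... | yes x≡0 = x≡0
... | no x≢0  = zero-product h x≢0

-- The integers inside ℚ

ι : ℤ → ℚ
ι z = z / 1

coprime-1 : ∀ n → Coprime n 1
coprime-1 n (_ , d∣1) = ℕᵈ.∣1⇒≡1 d∣1

-- `z / 1` goes through a gcd, which is stuck on an open `z`; on the explicit fraction the
-- operations of ℚ compute.
ι≡mkℚ : ∀ z → ι z ≡ mkℚ z 0 (coprime-1 Z.∣ z ∣)
ι≡mkℚ z = ↥p/↧p≡p (mkℚ z 0 (coprime-1 Z.∣ z ∣))

ι-+ : ∀ a b → ι (a Z.+ b) ≡ ι a + ι b
-- The sum of two fractions over 1 unfolds to the numerator `a * 1 + b * 1`, hence the two identity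
-- factors.
ι-+ a b = trans (cong ι (cong₂ Z._+_ (sym (Zₚ.*-identityʳ a)) (sym (Zₚ.*-identityʳ b))))
                (sym (cong₂ _+_ (ι≡mkℚ a) (ι≡mkℚ b)))

ι-* : ∀ a b → ι (a Z.* b) ≡ ι a * ι b
ι-* a b = sym (cong₂ _*_ (ι≡mkℚ a) (ι≡mkℚ b))

ι-neg : ∀ a → ι (Z.- a) ≡ - ι a
ι-neg a = lin₁ 1ℚ (trans (sym (ι-+ (Z.- a) a)) (cong ι (Zₚ.+-inverseˡ a))) (go (ι (Z.- a)) (ι a))
  where
  go = solve 2 (λ x y → x ⊖ (⊝ y) ≋ Κ 1ℚ ⊗ ((x ⊕ y) ⊖ Κ 0ℚ)) refl

ι-sub : ∀ a b → ι (a Z.- b) ≡ ι a - ι b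
ι-sub a b = trans (ι-+ a (Z.- b)) (cong (λ y → ι a + y) (ι-neg b))

ι-injective : ∀ {a b} → ι a ≡ ι b → a ≡ b
ι-injective {a} {b} h = cong ↥_ (trans (sym (ι≡mkℚ a)) (trans h (ι≡mkℚ b)))

-- The local rings ℤ₍ₚ₎

clear-denominator : ∀ x → ι (↧ x) * x ≡ ι (↥ x)
clear-denominator x@(mkℚ n d-1 _) =
  trans (cong (_* x) (ι≡mkℚ (↧ x)))
        (fromℚᵘ-cong {mkℚᵘ (↧ x Z.* n) (d-1 ℕ.+ 0)} {mkℚᵘ n 0} (*≡* cross))
  where
  cross : (↧ x Z.* n) Z.* + 1 ≡ n Z.* + suc (d-1 ℕ.+ 0)
  cross = trans (Zₚ.*-identityʳ _) (trans (Zₚ.*-comm (↧ x) n) (cong (λ k → n Z.* + suc k) (sym (ℕₚ.+-identityʳ d-1))))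

sign-abs : ∀ d → ∃[ s ] + Z.∣ d ∣ ≡ s Z.* d
sign-abs (+ n)    = + 1 , sym (Zₚ.*-identityˡ (+ n))
sign-abs -[1+ n ] = Z.-1ℤ , sym (Zₚ.-1*i≡-i -[1+ n ])

module At (p : ℕ) (p-prime : Prime p) where

  P : ℤ
  P = + p

  π : ℚ
  π = ι P

  private instance
    p-nonZero : ℕ.NonZero p
    p-nonZero = prime⇒nonZero p-prime

  euclid : ∀ {a b} → ¬ P ∣ a → ¬ P ∣ b → ¬ P ∣ a Z.* b
  euclid {a} {b} ∤a ∤b ∣ab with euclidsLemma Z.∣ a ∣ Z.∣ b ∣ p-prime (subst (p ℕᵈ.∣_) (Zₚ.abs-* a b) (∣⇒∣ᵤ ∣ab))
  ... | inj₁ h = ∤a (∣ᵤ⇒∣ h)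
  ... | inj₂ h = ∤b (∣ᵤ⇒∣ h)

  p≢1 : p ≢ 1
  p≢1 refl = contra p-prime
    where
    contra : ¬ Prime 1
    contra ()

  P∤1 : ¬ P ∣ + 1
  P∤1 h = p≢1 (ℕᵈ.∣1⇒≡1 (∣⇒∣ᵤ h))

  -- Inverts modulo `p` the denominator of a p-integral fraction. Bézout over ℕ comes in two
  -- orientations and concerns the absolute value of `d`, whence two cases and the sign `s`.
  bezout : ∀ d → ¬ P ∣ d → ∃[ f ] ∃[ g ] d Z.* f ≡ + 1 Z.+ P Z.* g
  bezout d ∤d = from-identity (coprime-Bézout coprime) (sign-abs d)
    where
    coprime : Coprime p Z.∣ d ∣
    coprime {i} (i∣p , i∣d) with prime⇒irreducible p-prime i∣p
    ... | inj₁ i≡1  = i≡1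
    ... | inj₂ refl = ⊥-elim (∤d (∣ᵤ⇒∣ i∣d))
    cast : ∀ {a b c} → 1 ℕ.+ a ℕ.* b ≡ c → + 1 Z.+ + a Z.* + b ≡ + c
    cast {a} {b} refl = cong (λ t → + 1 Z.+ t) (sym (Zₚ.pos-* a b))
    from-identity : GCD.Bézout.Identity 1 p Z.∣ d ∣ → ∃[ s ] + Z.∣ d ∣ ≡ s Z.* d → ∃[ f ] ∃[ g ] d Z.* f ≡ + 1 Z.+ P Z.* g
    from-identity (GCD.Bézout.+- x y eq) (s , ∣d∣≡sd) = s Z.* Z.- (+ y) , Z.- (+ x) , identity
      where
      bound : + 1 Z.+ + y Z.* (s Z.* d) ≡ + x Z.* P
      bound = trans (cong (λ t → + 1 Z.+ + y Z.* t) (sym ∣d∣≡sd)) (trans (cast {y} {Z.∣ d ∣} eq) (Zₚ.pos-* x p))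
      rearrange : ∀ d s y → d Z.* (s Z.* Z.- y) ≡ + 1 Z.- (+ 1 Z.+ y Z.* (s Z.* d))
      rearrange = ℤSolver.solve-∀
      neg-out : ∀ x p → + 1 Z.- x Z.* p ≡ + 1 Z.+ p Z.* Z.- x
      neg-out = ℤSolver.solve-∀
      identity : d Z.* (s Z.* Z.- (+ y)) ≡ + 1 Z.+ P Z.* Z.- (+ x)
      identity = trans (rearrange d s (+ y)) (trans (cong (λ t → + 1 Z.- t) bound) (neg-out (+ x) P))
    from-identity (GCD.Bézout.-+ x y eq) (s , ∣d∣≡sd) = s Z.* + y , + x , identity
      where
      rearrange : ∀ d s y → d Z.* (s Z.* y) ≡ y Z.* (s Z.* d)
      rearrange = ℤSolver.solve-∀
      identity : d Z.* (s Z.* + y) ≡ + 1 Z.+ P Z.* + x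
      identity = trans (rearrange d s (+ y)) (trans (cong (+ y Z.*_) (sym ∣d∣≡sd))
        (trans (sym (Zₚ.pos-* y Z.∣ d ∣)) (trans (cong +_ (sym eq)) (trans (cong (λ t → + 1 Z.+ t) (Zₚ.pos-* x p)) (cong (λ t → + 1 Z.+ t) (Zₚ.*-comm (+ x) P))))))

  -- x ∈ ℤ₍ₚ₎.
  record Integral (x : ℚ) : Set where
    constructor integral
    field
      num den : ℤ
      P∤den   : ¬ P ∣ den
      scaled  : ι den * x ≡ ι num

  ι-integral : ∀ z → Integral (ι z)
  ι-integral z = integral z (+ 1) P∤1 (*-identityˡ (ι z))

  infixl 6 _+ᴵ_ _-ᴵ_
  infixl 7 _*ᴵ_

  _+ᴵ_ : ∀ {x y} → Integral x → Integral y → Integral (x + y)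
  _+ᴵ_ {x} {y} (integral n d ∤d h) (integral n′ d′ ∤d′ h′) =
    integral (d′ Z.* n Z.+ d Z.* n′) (d Z.* d′) (euclid ∤d ∤d′)
      (trans (cong (_* (x + y)) (ι-* d d′))
      (trans (lin₂ (ι d′) (ι d) h h′ (combine (ι d) (ι d′) x y (ι n) (ι n′)))
      (sym (trans (ι-+ (d′ Z.* n) (d Z.* n′)) (cong₂ _+_ (ι-* d′ n) (ι-* d n′))))))
    where
    combine = solve 6 (λ d d′ x y n n′ → d ⊗ d′ ⊗ (x ⊕ y) ⊖ (d′ ⊗ n ⊕ d ⊗ n′) ≋ d′ ⊗ (d ⊗ x ⊖ n) ⊕ d ⊗ (d′ ⊗ y ⊖ n′)) refl

  _*ᴵ_ : ∀ {x y} → Integral x → Integral y → Integral (x * y)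
  _*ᴵ_ {x} {y} (integral n d ∤d h) (integral n′ d′ ∤d′ h′) =
    integral (n Z.* n′) (d Z.* d′) (euclid ∤d ∤d′)
      (trans (cong (_* (x * y)) (ι-* d d′))
      (trans (regroup (ι d) (ι d′) x y) (trans (cong₂ _*_ h h′) (sym (ι-* n n′)))))
    where
    regroup = solve 4 (λ d d′ x y → d ⊗ d′ ⊗ (x ⊗ y) ≋ (d ⊗ x) ⊗ (d′ ⊗ y)) refl

  -ᴵ_ : ∀ {x} → Integral x → Integral (- x)
  -ᴵ_ {x} Ix = subst Integral (negate x) (ι-integral (Z.- (+ 1)) *ᴵ Ix)
    where
    negate = solve 1 (λ x → Κ (ι (Z.- (+ 1))) ⊗ x ≋ ⊝ x) refl

  _-ᴵ_ : ∀ {x y} → Integral x → Integral y → Integral (x - y)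
  Ix -ᴵ Iy = Ix +ᴵ (-ᴵ Iy)

  0ᴵ : Integral 0ℚ
  0ᴵ = ι-integral (+ 0)

  1ᴵ : Integral 1ℚ
  1ᴵ = ι-integral (+ 1)

  -- The dichotomy of a valuation ring: a number that is not p-integral has its reciprocal in the
  -- maximal ideal. Poles are handled below through this reciprocal `π * w`.
  data Valuation (x : ℚ) : Set where
    integer : Integral x → Valuation x
    pole    : ∀ w → Integral w → x * (π * w) ≡ 1ℚ → Valuation x

  ι≢0 : ∀ {z} → z ≢ + 0 → ι z ≢ 0ℚ
  ι≢0 z≢0 h = z≢0 (ι-injective h)

  -- A fraction in lowest terms has at most one of numerator and denominator divisible by `p`.
  valuation : ∀ x → Valuation x
  valuation x@(mkℚ _ _ c) = by-denominator (↥ x) (↧ x) (clear-denominator x) coprime ↧≢0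
    where
    ↧≢0 : ↧ x ≢ + 0
    ↧≢0 ()
    coprime : P ∣ ↧ x → P ∣ ↥ x → ⊥
    coprime ∣d ∣n = p≢1 (ℚcoprime (∣⇒∣ᵤ ∣n , ∣⇒∣ᵤ ∣d))
      where
      ℚcoprime : Coprime Z.∣ ↥ x ∣ Z.∣ ↧ x ∣
      ℚcoprime = recompute c
    by-denominator : ∀ n d → ι d * x ≡ ι n → (P ∣ d → P ∣ n → ⊥) → d ≢ + 0 → Valuation x
    by-denominator n d h coprime d≢0 with P ∣? d
    ... | no ∤d = integer (integral n d ∤d h)
    ... | yes ∣d@(divides q refl) = invert (inverse (ι≢0 n≢0))
      where
      ∤n : ¬ P ∣ n
      ∤n = coprime ∣d
      n≢0 : n ≢ + 0
      n≢0 refl = ∤n (divides (+ 0) refl)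
      h′ : ι q * π * x ≡ ι n
      h′ = trans (cong (_* x) (sym (ι-* q P))) h
      invert : ∃[ i ] ι n * i ≡ 1ℚ → Valuation x
      invert (i , ni≡1) = pole (ι q * i) (integral q n ∤n (lin₁ (ι q) ni≡1 (lem₁ (ι n) (ι q) i)))
                               (lin₂ i 1ℚ h′ ni≡1 (lem₂ x π (ι q) i (ι n)))
        where
        lem₁ = solve 3 (λ n q i → n ⊗ (q ⊗ i) ⊖ q ≋ q ⊗ (n ⊗ i ⊖ Κ 1ℚ)) refl
        lem₂ = solve 5 (λ x π q i n → x ⊗ (π ⊗ (q ⊗ i)) ⊖ Κ 1ℚ ≋ i ⊗ (q ⊗ π ⊗ x ⊖ n) ⊕ Κ 1ℚ ⊗ (n ⊗ i ⊖ Κ 1ℚ)) refl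

  pᵏ : ℕ → ℤ
  pᵏ k = + (p ℕ.^ k)

  record Div (k : ℕ) (x : ℚ) : Set where
    constructor div
    field
      quot   : ℚ
      quot-I : Integral quot
      eq     : x ≡ ι (pᵏ k) * quot

  -- Euclid's lemma repeated: each step removes one factor `p` from `n`.
  cancel-coprime : ∀ k d n m → ¬ P ∣ d → d Z.* n ≡ pᵏ k Z.* m → pᵏ k ∣ n
  cancel-coprime zero d n m ∤d h = divides n (sym (Zₚ.*-identityʳ n))
  cancel-coprime (suc k) d n m ∤d h with P ∣? n
  ... | no ∤n = ⊥-elim (euclid ∤d ∤n (divides (pᵏ k Z.* m) (trans h (trans (cong (Z._* m) (Zₚ.pos-* p (p ℕ.^ k))) (rotate P (pᵏ k) m)))))
    where
    rotate : ∀ a b m → a Z.* b Z.* m ≡ b Z.* m Z.* a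
    rotate = ℤSolver.solve-∀
  ... | yes (divides n′ refl) = shift (cancel-coprime k d n′ m ∤d (Zₚ.*-cancelʳ-≡ (d Z.* n′) (pᵏ k Z.* m) P {{P-nonZero}} step))
    where
    P-nonZero : Z.NonZero P
    P-nonZero = p-nonZero
    rotate : ∀ a b m → a Z.* b Z.* m ≡ b Z.* m Z.* a
    rotate = ℤSolver.solve-∀
    step : d Z.* n′ Z.* P ≡ pᵏ k Z.* m Z.* P
    step = trans (Zₚ.*-assoc d n′ P) (trans h (trans (cong (Z._* m) (Zₚ.pos-* p (p ℕ.^ k))) (rotate P (pᵏ k) m)))
    regroup : ∀ q b a → q Z.* b Z.* a ≡ q Z.* (a Z.* b)
    regroup = ℤSolver.solve-∀
    shift : pᵏ k ∣ n′ → pᵏ (suc k) ∣ n′ Z.* P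
    shift (divides q refl) = divides q (trans (regroup q (pᵏ k) P) (cong (q Z.*_) (sym (Zₚ.pos-* p (p ℕ.^ k)))))

  -- ℤ ∩ pᵏℤ₍ₚ₎ = pᵏℤ, because the denominator of the quotient is prime to `p`. This is the way back
  -- from local divisibility to the integers.
  div-ι : ∀ {k n} → Div k (ι n) → pᵏ k ∣ n
  div-ι {k} {n} (div z (integral m d ∤d dz≡m) n≡pz) =
    cancel-coprime k d n m ∤d (ι-injective (trans (ι-* d n)
      (trans (lin₂ (ι d) (ι (pᵏ k)) n≡pz dz≡m (lem (ι d) (ι n) (ι (pᵏ k)) z (ι m))) (sym (ι-* (pᵏ k) m)))))
    where
    lem = solve 5 (λ d n q z m → d ⊗ n ⊖ q ⊗ m ≋ d ⊗ (n ⊖ q ⊗ z) ⊕ q ⊗ (d ⊗ z ⊖ m)) refl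

  ι-P-suc : ∀ k → ι (pᵏ (suc k)) ≡ π * ι (pᵏ k)
  ι-P-suc k = trans (cong ι (Zₚ.pos-* p (p ℕ.^ k))) (ι-* P (pᵏ k))

  div-zero : ∀ {k x} → x ≡ 0ℚ → Div k x
  div-zero {k} refl = div 0ℚ 0ᴵ (zeroʳ (ι (pᵏ k)))
    where
    zeroʳ = solve 1 (λ x → Κ 0ℚ ≋ x ⊗ Κ 0ℚ) refl

  div-eq : ∀ {k x y} → x ≡ y → Div k (x - y)
  div-eq h = div-zero (x≡y⇒x-y≡0 h)

  div-+ : ∀ {k x y} → Div k x → Div k y → Div k (x + y)
  div-+ {k} (div z Iz refl) (div z′ Iz′ refl) = div (z + z′) (Iz +ᴵ Iz′) (factor (ι (pᵏ k)) z z′)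
    where
    factor = solve 3 (λ q z z′ → q ⊗ z ⊕ q ⊗ z′ ≋ q ⊗ (z ⊕ z′)) refl

  div-* : ∀ {k x} y → Integral y → Div k x → Div k (y * x)
  div-* {k} y Iy (div z Iz refl) = div (y * z) (Iy *ᴵ Iz) (factor y (ι (pᵏ k)) z)
    where
    factor = solve 3 (λ y q z → y ⊗ (q ⊗ z) ≋ q ⊗ (y ⊗ z)) refl

  div-neg : ∀ {k x} → Div k x → Div k (- x)
  div-neg {k} (div z Iz refl) = div (- z) (-ᴵ Iz) (factor (ι (pᵏ k)) z)
    where
    factor = solve 2 (λ q z → ⊝ (q ⊗ z) ≋ q ⊗ ⊝ z) refl

  div-pred : ∀ {k x} → Div (suc k) x → Div k x
  div-pred {k} (div z Iz refl) = div (π * z) (ι-integral P *ᴵ Iz) (trans (cong (_* z) (ι-P-suc k)) (swap π (ι (pᵏ k)) z))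
    where
    swap = solve 3 (λ a b z → a ⊗ b ⊗ z ≋ b ⊗ (a ⊗ z)) refl

  div-≤ : ∀ {j k x} → j ℕ.≤′ k → Div k x → Div j x
  div-≤ (ℕ.≤′-reflexive refl) h = h
  div-≤ (ℕ.≤′-step j≤k) h = div-≤ j≤k (div-pred h)

  ι-div : ∀ {k n} → pᵏ k ∣ n → Div k (ι n)
  ι-div {k} (divides q refl) = div (ι q) (ι-integral q) (trans (ι-* q (pᵏ k)) (*-comm (ι q) (ι (pᵏ k))))

  ¬div-1 : ¬ Div 1 1ℚ
  ¬div-1 h = P∤1 (subst (_∣ + 1) (cong +_ (ℕₚ.*-identityʳ p)) (div-ι {1} {+ 1} h))

  -- If `d * f = 1 + p * g`, then `n * f = x * (1 + p * g)`, so `x` differs from the integer `n * f`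
  -- by a multiple of `p`.
  digit : ∀ {x} → Integral x → ∃[ c ] ∃[ z ] Integral z × x ≡ ι c + π * z
  digit {x} (integral n d ∤d h) = from-bezout (bezout d ∤d)
    where
    from-bezout : ∃[ f ] ∃[ g ] d Z.* f ≡ + 1 Z.+ P Z.* g → ∃[ c ] ∃[ z ] Integral z × x ≡ ι c + π * z
    from-bezout (f , g , df) = n Z.* f , - ι g * x , (-ᴵ ι-integral g) *ᴵ integral n d ∤d h ,
      trans (lin₂ (ι f) (- x) h df′ (lem (ι n) (ι d) (ι f) (ι g) π x)) (cong (_+ π * (- ι g * x)) (sym (ι-* n f)))
      where
      df′ : ι d * ι f ≡ 1ℚ + π * ι g
      df′ = trans (sym (ι-* d f)) (trans (cong ι df) (trans (ι-+ (+ 1) (P Z.* g)) (cong (λ t → 1ℚ + t) (ι-* P g))))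
      lem = solve 6 (λ n d f g π x → x ⊖ (n ⊗ f ⊕ π ⊗ (⊝ g ⊗ x)) ≋ f ⊗ (d ⊗ x ⊖ n) ⊕ ⊝ x ⊗ (d ⊗ f ⊖ (Κ 1ℚ ⊕ π ⊗ g))) refl

  -- Density of ℤ in ℤ₍ₚ₎: digits are extracted one after another, the next from the remainder `z`.
  approximate : ∀ k {x} → Integral x → ∃[ c ] Div k (x - ι c)
  approximate zero {x} Ix = + 0 , div (x - ι (+ 0)) (Ix -ᴵ 0ᴵ) (one x)
    where
    one = solve 1 (λ x → x ⊖ Κ 0ℚ ≋ Κ 1ℚ ⊗ (x ⊖ Κ 0ℚ)) refl
  approximate (suc k) {x} Ix = from-digit (digit Ix)
    where
    from-digit : ∃[ c ] ∃[ z ] Integral z × x ≡ ι c + π * z → ∃[ c ] Div (suc k) (x - ι c)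
    from-digit (c , z , Iz , x≡) = refine (approximate k Iz)
      where
      refine : ∃[ c′ ] Div k (z - ι c′) → ∃[ c ] Div (suc k) (x - ι c)
      refine (c′ , div y Iy h) = c Z.+ P Z.* c′ , div y Iy
        (trans (cong (λ t → x - t) (trans (ι-+ c (P Z.* c′)) (cong (λ t → ι c + t) (ι-* P c′))))
        (trans (lin₂ 1ℚ π x≡ h (lem x (ι c) z (ι c′) π (ι (pᵏ k)) y)) (cong (_* y) (sym (ι-P-suc k)))))
        where
        lem = solve 7 (λ x c z c′ π q y → x ⊖ (c ⊕ π ⊗ c′) ⊖ π ⊗ q ⊗ y ≋ Κ 1ℚ ⊗ (x ⊖ (c ⊕ π ⊗ z)) ⊕ π ⊗ (z ⊖ c′ ⊖ q ⊗ y)) refl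

  residue : ∀ k {x} → Integral x → ∃[ r ] r ℕ.< p ℕ.^ k × Div k (x - ι (+ r))
  residue k {x} Ix = from-approximate (approximate k Ix)
    where
    from-approximate : ∃[ c ] Div k (x - ι c) → ∃[ r ] r ℕ.< p ℕ.^ k × Div k (x - ι (+ r))
    from-approximate (c , h) = r , n%ℕd<d c (p ℕ.^ k) {{ℕₚ.m^n≢0 p k}} , subst (Div k) (telescope x (ι c) (ι (+ r))) (div-+ h c-r)
      where
      instance _ = ℕₚ.m^n≢0 p k
      r = c %ℕ (p ℕ.^ k)
      s = c /ℕ (p ℕ.^ k)
      telescope = solve 3 (λ x c r → x ⊖ c ⊕ (c ⊖ r) ≋ x ⊖ r) refl
      cancel-r : ∀ r s → (r Z.+ s) Z.- r ≡ s
      cancel-r = ℤSolver.solve-∀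
      c-r : Div k (ι c - ι (+ r))
      c-r = subst (Div k) (ι-sub c (+ r))
              (ι-div (divides s (trans (cong (Z._- + r) (a≡a%ℕn+[a/ℕn]*n c (p ℕ.^ k) {{ℕₚ.m^n≢0 p k}})) (cancel-r (+ r) (s Z.* pᵏ k)))))

-- Polynomial congruences decided by enumerating residues

-- Polynomials are kept as syntax because each is read twice: in ℚ at p-integral numbers, where
-- divisibility is to be proved, and in ℤ at residues, where it is computed.
data Expr (n : ℕ) : Set where
  var            : Fin n → Expr n
  con            : ℤ → Expr n
  _:+_ _:*_ _:-_ : Expr n → Expr n → Expr n
  :-_            : Expr n → Expr n

infixl 6 _:+_ _:-_
infixl 7 _:*_
infix  8 :-_

⟦_⟧ : ∀ {n} → Expr n → Vec ℚ n → ℚ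
⟦ var i ⟧ xs   = lookup xs i
⟦ con z ⟧ xs   = ι z
⟦ e :+ f ⟧ xs  = ⟦ e ⟧ xs + ⟦ f ⟧ xs
⟦ e :* f ⟧ xs  = ⟦ e ⟧ xs * ⟦ f ⟧ xs
⟦ e :- f ⟧ xs  = ⟦ e ⟧ xs - ⟦ f ⟧ xs
⟦ :- e ⟧ xs    = - ⟦ e ⟧ xs

eval : ∀ {n} → Expr n → Vec ℤ n → ℤ
eval (var i) cs  = lookup cs i
eval (con z) cs  = z
eval (e :+ f) cs = eval e cs Z.+ eval f cs
eval (e :* f) cs = eval e cs Z.* eval f cs
eval (e :- f) cs = eval e cs Z.- eval f cs
eval (:- e) cs   = Z.- eval e cs

ι-eval : ∀ {n} (e : Expr n) cs → ι (eval e cs) ≡ ⟦ e ⟧ (Vec.map ι cs)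
ι-eval (var i) cs  = sym (lookup-map i ι cs)
ι-eval (con z) cs  = refl
ι-eval (e :+ f) cs = trans (ι-+ (eval e cs) (eval f cs)) (cong₂ _+_ (ι-eval e cs) (ι-eval f cs))
ι-eval (e :* f) cs = trans (ι-* (eval e cs) (eval f cs)) (cong₂ _*_ (ι-eval e cs) (ι-eval f cs))
ι-eval (e :- f) cs = trans (ι-sub (eval e cs) (eval f cs)) (cong₂ _-_ (ι-eval e cs) (ι-eval f cs))
ι-eval (:- e) cs   = trans (ι-neg (eval e cs)) (cong (λ x → - x) (ι-eval e cs))

-- j ∥ e is the congruence pʲ ∣ e.
infix 4 _∥_
record Constraint (n : ℕ) : Set where
  constructor _∥_
  field
    level : ℕ
    expr  : Expr n

all-below : ℕ → (ℕ → Bool) → Bool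
all-below zero f    = true
all-below (suc m) f = f m ∧ all-below m f

all-below-sound : ∀ m f → T (all-below m f) → ∀ {i} → i ℕ.< m → T (f i)
all-below-sound (suc m) f t {i} i<1+m with Equivalence.to T-∧ t | ℕₚ.m≤n⇒m<n∨m≡n (ℕ.s≤s⁻¹ i<1+m)
... | _ , rest | inj₁ i<m  = all-below-sound m f rest i<m
... | fm , _   | inj₂ refl = fm

Below : ℕ → ℤ → Set
Below m c = ∃[ i ] i ℕ.< m × c ≡ + i

all-vec : ∀ n → ℕ → (Vec ℤ n → Bool) → Bool
all-vec zero m f    = f []ᵛ
all-vec (suc n) m f = all-below m (λ c → all-vec n m (λ cs → f (+ c ∷ᵛ cs)))

all-vec-sound : ∀ n m f → T (all-vec n m f) → ∀ {cs} → AllV (Below m) cs → T (f cs)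
all-vec-sound zero m f t []ᴵ = t
all-vec-sound (suc n) m f t ((_ , c< , refl) ∷ᴵ cs<) =
  all-vec-sound n m _ (all-below-sound m _ t c<) cs<

module Residues (p : ℕ) (p-prime : Prime p) where
  open At p p-prime public

  Holds : ∀ {n} → Vec ℚ n → Constraint n → Set
  Holds xs (j ∥ e) = Div j (⟦ e ⟧ xs)

  vanishes : ∀ {n} → Constraint n → Vec ℤ n → Bool
  vanishes (j ∥ e) cs = ⌊ pᵏ j ∣? eval e cs ⌋

  -- A tuple of residues is discarded only by a hypothesis of level at most `k`: residues modulo pᵏ
  -- say nothing about higher powers.
  implies : ∀ {n} → ℕ → List (Constraint n) → Constraint n → Vec ℤ n → Bool
  implies k [] (j ∥ e) cs             = (j ℕ.≤ᵇ k) ∧ vanishes (j ∥ e) cs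
  implies k ((j ∥ h) ∷ hs) c cs = ((j ℕ.≤ᵇ k) ∧ not (vanishes (j ∥ h) cs)) ∨ implies k hs c cs

  check : ∀ {n} → ℕ → List (Constraint n) → Constraint n → Bool
  check {n} k hs c = all-vec n (p ℕ.^ k) (implies k hs c)

  ≈-+ : ∀ {k x y} a b → Div k (x - ι a) → Div k (y - ι b) → Div k (x + y - ι (a Z.+ b))
  ≈-+ {k} {x} {y} a b da db =
    subst (Div k) (trans (regroup x y (ι a) (ι b)) (cong (λ t → x + y - t) (sym (ι-+ a b)))) (div-+ da db)
    where
    regroup = solve 4 (λ x y a b → x ⊖ a ⊕ (y ⊖ b) ≋ x ⊕ y ⊖ (a ⊕ b)) refl

  ≈-sub : ∀ {k x y} a b → Div k (x - ι a) → Div k (y - ι b) → Div k (x - y - ι (a Z.- b))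
  ≈-sub {k} {x} {y} a b da db =
    subst (Div k) (trans (regroup x y (ι a) (ι b)) (cong (λ t → x - y - t) (sym (ι-sub a b)))) (div-+ da (div-neg db))
    where
    regroup = solve 4 (λ x y a b → x ⊖ a ⊕ ⊝ (y ⊖ b) ≋ x ⊖ y ⊖ (a ⊖ b)) refl

  ≈-neg : ∀ {k x} a → Div k (x - ι a) → Div k (- x - ι (Z.- a))
  ≈-neg {k} {x} a da = subst (Div k) (trans (regroup x (ι a)) (cong (λ t → - x - t) (sym (ι-neg a)))) (div-neg da)
    where
    regroup = solve 2 (λ x a → ⊝ (x ⊖ a) ≋ ⊝ x ⊖ ⊝ a) refl

  ≈-* : ∀ {k x y} a b → Integral y → Div k (x - ι a) → Div k (y - ι b) → Div k (x * y - ι (a Z.* b))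
  ≈-* {k} {x} {y} a b Iy da db =
    subst (Div k) (trans (regroup x y (ι a) (ι b)) (cong (λ t → x * y - t) (sym (ι-* a b))))
      (div-+ (div-* y Iy da) (div-* (ι a) (ι-integral a) db))
    where
    regroup = solve 4 (λ x y a b → y ⊗ (x ⊖ a) ⊕ a ⊗ (y ⊖ b) ≋ x ⊗ y ⊖ a ⊗ b) refl

  ⟦⟧-integral : ∀ {n} (e : Expr n) {xs} → AllV Integral xs → Integral (⟦ e ⟧ xs)
  ⟦⟧-integral (var i) Ixs  = VecAllₚ.lookup⁺ Ixs i
  ⟦⟧-integral (con z) Ixs  = ι-integral z
  ⟦⟧-integral (e :+ f) Ixs = ⟦⟧-integral e Ixs +ᴵ ⟦⟧-integral f Ixs
  ⟦⟧-integral (e :- f) Ixs = ⟦⟧-integral e Ixs -ᴵ ⟦⟧-integral f Ixs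
  ⟦⟧-integral (:- e) Ixs   = -ᴵ ⟦⟧-integral e Ixs
  ⟦⟧-integral (e :* f) Ixs = ⟦⟧-integral e Ixs *ᴵ ⟦⟧-integral f Ixs

  ⟦⟧-≈ : ∀ {n} k (e : Expr n) {xs cs} → AllV Integral xs → (∀ i → Div k (lookup xs i - ι (lookup cs i))) →
         Div k (⟦ e ⟧ xs - ι (eval e cs))
  ⟦⟧-≈ k (var i) Ixs d = d i
  ⟦⟧-≈ k (con z) Ixs d = div-eq {x = ι z} refl
  ⟦⟧-≈ k (e :+ f) {xs} {cs} Ixs d =
    ≈-+ {x = ⟦ e ⟧ xs} {⟦ f ⟧ xs} (eval e cs) (eval f cs) (⟦⟧-≈ k e {cs = cs} Ixs d) (⟦⟧-≈ k f {cs = cs} Ixs d)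
  ⟦⟧-≈ k (e :- f) {xs} {cs} Ixs d =
    ≈-sub {x = ⟦ e ⟧ xs} {⟦ f ⟧ xs} (eval e cs) (eval f cs) (⟦⟧-≈ k e {cs = cs} Ixs d) (⟦⟧-≈ k f {cs = cs} Ixs d)
  ⟦⟧-≈ k (:- e) {xs} {cs} Ixs d = ≈-neg {x = ⟦ e ⟧ xs} (eval e cs) (⟦⟧-≈ k e {cs = cs} Ixs d)
  ⟦⟧-≈ k (e :* f) {xs} {cs} Ixs d =
    ≈-* {x = ⟦ e ⟧ xs} {⟦ f ⟧ xs} (eval e cs) (eval f cs) (⟦⟧-integral f Ixs) (⟦⟧-≈ k e {cs = cs} Ixs d) (⟦⟧-≈ k f {cs = cs} Ixs d)

  private
    Reduces : ∀ {n} → ℕ → Vec ℚ n → Vec ℤ n → Set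
    Reduces k xs cs = ∀ i → Div k (lookup xs i - ι (lookup cs i))

    residues : ∀ {n} k {xs : Vec ℚ n} → AllV Integral xs →
               ∃[ cs ] AllV (Below (p ℕ.^ k)) cs × Reduces k xs cs
    residues k []ᴵ = []ᵛ , []ᴵ , λ ()
    residues {suc n} k {x ∷ᵛ xs} (Ix ∷ᴵ Ixs) = extend (residue k Ix) (residues k Ixs)
      where
      extend : ∃[ c ] c ℕ.< p ℕ.^ k × Div k (x - ι (+ c)) → ∃[ cs ] AllV (Below (p ℕ.^ k)) cs × Reduces k xs cs →
               ∃[ cs ] AllV (Below (p ℕ.^ k)) cs × Reduces k (x ∷ᵛ xs) cs
      extend (c , c< , d) (cs , cs< , ds) = + c ∷ᵛ cs , (c , c< , refl) ∷ᴵ cs< , λ { zero → d ; (suc i) → ds i }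

    level-≤ : ∀ {j k} → T (j ℕ.≤ᵇ k) → j ℕ.≤′ k
    level-≤ {j} {k} t = ℕₚ.≤⇒≤′ (ℕₚ.≤ᵇ⇒≤ j k t)

    close : ∀ {n k j xs cs} (e : Expr n) → AllV Integral xs → Reduces k xs cs → T (j ℕ.≤ᵇ k) →
            Div j (⟦ e ⟧ xs - ι (eval e cs))
    close {k = k} {cs = cs} e Ixs r j≤k = div-≤ (level-≤ j≤k) (⟦⟧-≈ k e {cs = cs} Ixs r)

    vanishes-complete : ∀ {n k j xs cs} (e : Expr n) → AllV Integral xs → Reduces k xs cs → T (j ℕ.≤ᵇ k) →
                        Div j (⟦ e ⟧ xs) → T (vanishes (j ∥ e) cs)
    vanishes-complete {j = j} {xs} {cs} e Ixs r j≤k h =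
      fromWitness (div-ι (subst (Div j) (telescope (⟦ e ⟧ xs) (ι (eval e cs))) (div-+ h (div-neg (close {cs = cs} e Ixs r j≤k)))))
      where
      telescope = solve 2 (λ x y → x ⊕ ⊝ (x ⊖ y) ≋ y) refl

    vanishes-sound : ∀ {n k j xs cs} (e : Expr n) → AllV Integral xs → Reduces k xs cs → T (j ℕ.≤ᵇ k) →
                     T (vanishes (j ∥ e) cs) → Div j (⟦ e ⟧ xs)
    vanishes-sound {j = j} {xs} {cs} e Ixs r j≤k t =
      subst (Div j) (telescope (⟦ e ⟧ xs) (ι (eval e cs))) (div-+ (close {cs = cs} e Ixs r j≤k)
        (ι-div (toWitness t)))
      where
      telescope = solve 2 (λ x y → x ⊖ y ⊕ y ≋ x) refl

  -- Modulo pᵏ a polynomial takes the same value at p-integral numbers as at their residues, so a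
  -- check over finitely many tuples covers all of them. For concrete constraints the check
  -- evaluates and its proof is `tt`; the conclusion `1 ∥ con (+ 1)`, refuted by `¬div-1`, serves to
  -- derive a contradiction.
  by-residues : ∀ {n} k (hs : List (Constraint n)) (c : Constraint n) → T (check k hs c) →
                ∀ {xs} → AllV Integral xs → All (Holds xs) hs → Holds xs c
  by-residues {n} k hs c t {xs} Ixs holds = conclude (residues k Ixs)
    where
    module _ {cs : Vec ℤ n} (r : Reduces k xs cs) where
      discharge : ∀ hs → All (Holds xs) hs → T (implies k hs c cs) → Holds xs c
      discharge [] []ᵃ t with Equivalence.to T-∧ t
      ... | j≤k , v = vanishes-sound {cs = cs} (Constraint.expr c) Ixs r j≤k v
      discharge ((j ∥ e) ∷ hs) (h ∷ᵃ hs′) t =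
        case-split (j ℕ.≤ᵇ k) (vanishes (j ∥ e) cs) (λ j≤k → vanishes-complete {cs = cs} e Ixs r j≤k h) t
        where
        case-split : ∀ b v → (T b → T v) → T ((b ∧ not v) ∨ implies k hs c cs) → Holds xs c
        case-split true false f _ = ⊥-elim (f tt)
        case-split true true _ t  = discharge hs hs′ t
        case-split false _ f t    = discharge hs hs′ t
    conclude : ∃[ cs ] AllV (Below (p ℕ.^ k)) cs × Reduces k xs cs → Holds xs c
    conclude (cs , cs< , r) = discharge r hs holds (all-vec-sound n (p ℕ.^ k) _ t cs<)

-- Changes of coordinates and the group law

-- The equations of `IsoQ E F` solved for the coefficients of `E`, in triangular order. An
-- isomorphism thereby becomes an equation between models.
change : ℚ → ℚ → ℚ → ℚ → WModel ℚ → WModel ℚ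
change u r s t (wm b₁ b₂ b₃ b₄ b₆) = wm a₁ a₂ a₃ a₄ a₆
  where
  a₁ = u * b₁ - q 2 * s
  a₂ = u * u * b₂ + s * a₁ - q 3 * r + s * s
  a₃ = u * u * u * b₃ - r * a₁ - q 2 * t
  a₄ = u * u * u * u * b₄ + s * a₃ - q 2 * r * a₂ + (t + r * s) * a₁ - q 3 * r * r + q 2 * s * t
  a₆ = u * u * u * u * u * u * b₆ - r * a₄ - r * r * a₂ - r * r * r + t * a₃ + t * t + r * t * a₁

isoQ⇒change : ∀ E F → IsoQ E F → ∃[ u ] ∃[ r ] ∃[ s ] ∃[ t ] u ≢ 0ℚ × E ≡ change u r s t F
isoQ⇒change (wm a₁ a₂ a₃ a₄ a₆) (wm b₁ b₂ b₃ b₄ b₆) (u , r , s , t , u≢0 , e₁ , e₂ , e₃ , e₄ , e₆) =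
  u , r , s , t , u≢0 ,
  assemble (lin₁ (- 1ℚ) e₁ (l₁ u b₁ s a₁)) (lin₁ (- 1ℚ) e₂ (l₂ u b₂ s r a₁ a₂)) (lin₁ (- 1ℚ) e₃ (l₃ u b₃ r t a₁ a₃))
           (lin₁ (- 1ℚ) e₄ (l₄ u b₄ s r t a₁ a₂ a₃ a₄)) (lin₁ (- 1ℚ) e₆ (l₆ u b₆ r t a₁ a₂ a₃ a₄ a₆))
  where
  l₁ = solve 4 (λ u b₁ s a₁ → a₁ ⊖ (u ⊗ b₁ ⊖ Κ (q 2) ⊗ s) ≋ ⊝ Κ 1ℚ ⊗ (u ⊗ b₁ ⊖ (a₁ ⊕ Κ (q 2) ⊗ s))) refl
  l₂ = solve 6 (λ u b₂ s r a₁ a₂ → a₂ ⊖ (u ⊗ u ⊗ b₂ ⊕ s ⊗ a₁ ⊖ Κ (q 3) ⊗ r ⊕ s ⊗ s) ≋ ⊝ Κ 1ℚ ⊗ (u ⊗ u ⊗ b₂ ⊖ (a₂ ⊖ s ⊗ a₁ ⊕ Κ (q 3) ⊗ r ⊖ s ⊗ s))) refl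
  l₃ = solve 6 (λ u b₃ r t a₁ a₃ → a₃ ⊖ (u ⊗ u ⊗ u ⊗ b₃ ⊖ r ⊗ a₁ ⊖ Κ (q 2) ⊗ t) ≋ ⊝ Κ 1ℚ ⊗ (u ⊗ u ⊗ u ⊗ b₃ ⊖ (a₃ ⊕ r ⊗ a₁ ⊕ Κ (q 2) ⊗ t))) refl
  l₄ = solve 9 (λ u b₄ s r t a₁ a₂ a₃ a₄ →
       a₄ ⊖ (u ⊗ u ⊗ u ⊗ u ⊗ b₄ ⊕ s ⊗ a₃ ⊖ Κ (q 2) ⊗ r ⊗ a₂ ⊕ (t ⊕ r ⊗ s) ⊗ a₁ ⊖ Κ (q 3) ⊗ r ⊗ r ⊕ Κ (q 2) ⊗ s ⊗ t)
       ≋ ⊝ Κ 1ℚ ⊗ (u ⊗ u ⊗ u ⊗ u ⊗ b₄ ⊖ (a₄ ⊖ s ⊗ a₃ ⊕ Κ (q 2) ⊗ r ⊗ a₂ ⊖ (t ⊕ r ⊗ s) ⊗ a₁ ⊕ Κ (q 3) ⊗ r ⊗ r ⊖ Κ (q 2) ⊗ s ⊗ t))) refl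
  l₆ = solve 9 (λ u b₆ r t a₁ a₂ a₃ a₄ a₆ →
       a₆ ⊖ (u ⊗ u ⊗ u ⊗ u ⊗ u ⊗ u ⊗ b₆ ⊖ r ⊗ a₄ ⊖ r ⊗ r ⊗ a₂ ⊖ r ⊗ r ⊗ r ⊕ t ⊗ a₃ ⊕ t ⊗ t ⊕ r ⊗ t ⊗ a₁)
       ≋ ⊝ Κ 1ℚ ⊗ (u ⊗ u ⊗ u ⊗ u ⊗ u ⊗ u ⊗ b₆ ⊖ (a₆ ⊕ r ⊗ a₄ ⊕ r ⊗ r ⊗ a₂ ⊕ r ⊗ r ⊗ r ⊖ t ⊗ a₃ ⊖ t ⊗ t ⊖ r ⊗ t ⊗ a₁))) refl
  assemble : ∀ {a₁ a₂ a₃ a₄ a₆} →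
    a₁ ≡ u * b₁ - q 2 * s → a₂ ≡ u * u * b₂ + s * a₁ - q 3 * r + s * s → a₃ ≡ u * u * u * b₃ - r * a₁ - q 2 * t →
    a₄ ≡ u * u * u * u * b₄ + s * a₃ - q 2 * r * a₂ + (t + r * s) * a₁ - q 3 * r * r + q 2 * s * t →
    a₆ ≡ u * u * u * u * u * u * b₆ - r * a₄ - r * r * a₂ - r * r * r + t * a₃ + t * t + r * t * a₁ →
    wm a₁ a₂ a₃ a₄ a₆ ≡ change u r s t (wm b₁ b₂ b₃ b₄ b₆)
  assemble refl refl refl refl refl = refl

scaled : ∀ E F u r s t → E ≡ change u r s t F →
  u * a1 F ≡ a1 E + q 2 * s ×
  u * u * a2 F ≡ a2 E - s * a1 E + q 3 * r - s * s ×
  u * u * u * a3 F ≡ a3 E + r * a1 E + q 2 * t ×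
  u * u * u * u * a4 F ≡ a4 E - s * a3 E + q 2 * r * a2 E - (t + r * s) * a1 E + q 3 * r * r - q 2 * s * t ×
  u * u * u * u * u * u * a6 F ≡ a6 E + r * a4 E + r * r * a2 E + r * r * r - t * a3 E - t * t - r * t * a1 E
scaled _ F u r s t refl =
  l₁ (u * a1 F) s , l₂ (u * u * a2 F) s r (a1 E) , l₃ (u * u * u * a3 F) r t (a1 E) ,
  l₄ (u * u * u * u * a4 F) s r t (a1 E) (a2 E) (a3 E) , l₆ (u * u * u * u * u * u * a6 F) r t (a1 E) (a2 E) (a3 E) (a4 E)
  where
  E = change u r s t F
  l₁ = solve 2 (λ b s → b ≋ b ⊖ Κ (q 2) ⊗ s ⊕ Κ (q 2) ⊗ s) refl
  l₂ = solve 4 (λ b s r a₁ → b ≋ b ⊕ s ⊗ a₁ ⊖ Κ (q 3) ⊗ r ⊕ s ⊗ s ⊖ s ⊗ a₁ ⊕ Κ (q 3) ⊗ r ⊖ s ⊗ s) refl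
  l₃ = solve 4 (λ b r t a₁ → b ≋ b ⊖ r ⊗ a₁ ⊖ Κ (q 2) ⊗ t ⊕ r ⊗ a₁ ⊕ Κ (q 2) ⊗ t) refl
  l₄ = solve 7 (λ b s r t a₁ a₂ a₃ → b ≋
       b ⊕ s ⊗ a₃ ⊖ Κ (q 2) ⊗ r ⊗ a₂ ⊕ (t ⊕ r ⊗ s) ⊗ a₁ ⊖ Κ (q 3) ⊗ r ⊗ r ⊕ Κ (q 2) ⊗ s ⊗ t
       ⊖ s ⊗ a₃ ⊕ Κ (q 2) ⊗ r ⊗ a₂ ⊖ (t ⊕ r ⊗ s) ⊗ a₁ ⊕ Κ (q 3) ⊗ r ⊗ r ⊖ Κ (q 2) ⊗ s ⊗ t) refl
  l₆ = solve 7 (λ b r t a₁ a₂ a₃ a₄ → b ≋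
       b ⊖ r ⊗ a₄ ⊖ r ⊗ r ⊗ a₂ ⊖ r ⊗ r ⊗ r ⊕ t ⊗ a₃ ⊕ t ⊗ t ⊕ r ⊗ t ⊗ a₁
       ⊕ r ⊗ a₄ ⊕ r ⊗ r ⊗ a₂ ⊕ r ⊗ r ⊗ r ⊖ t ⊗ a₃ ⊖ t ⊗ t ⊖ r ⊗ t ⊗ a₁) refl

-- Minimality of a model of `E` quantifies over models isomorphic to `E`, whereas a smaller model is
-- constructed from the minimal one; composition connects the two.
isoQ-trans : ∀ {E F G} → IsoQ E F → IsoQ F G → IsoQ E G
isoQ-trans {wm a₁ a₂ a₃ a₄ a₆} {wm b₁ b₂ b₃ b₄ b₆} {wm c₁ c₂ c₃ c₄ c₆}
           (u , r , s , t , u≢0 , e₁ , e₂ , e₃ , e₄ , e₆) (u′ , r′ , s′ , t′ , u′≢0 , f₁ , f₂ , f₃ , f₄ , f₆) =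
  -- Obtained by inserting the second substitution into `x = u²x′ + r`, `y = u³y′ + su²x′ + t`.
  u * u′ , u * u * r′ + r , u * s′ + s , u * u * u * t′ + s * (u * u * r′) + t , *-≢0 u≢0 u′≢0 ,
  trans (k₁ u u′ c₁) (trans (cong (u *_) f₁) (lin₁ 1ℚ e₁ (g₁ u b₁ a₁ s s′))) ,
  trans (k₂ u u′ c₂) (trans (cong (u * u *_) f₂) (lin₂ 1ℚ (- (u * s′)) e₂ e₁ (g₂ u r s r′ s′ a₁ a₂ b₁ b₂))) ,
  trans (k₃ u u′ c₃) (trans (cong (u * u * u *_) f₃) (lin₂ 1ℚ (u * u * r′) e₃ e₁ (g₃ u r s t r′ t′ a₁ a₃ b₁ b₃))) ,
  trans (k₄ u u′ c₄) (trans (cong (u * u * u * u *_) f₄)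
    (trans (g₄ u r′ s′ t′ b₁ b₂ b₃ b₄) (eq₄ e₁ e₂ e₃ e₄))) ,
  trans (k₆ u u′ c₆) (trans (cong (u * u * u * u * u * u *_) f₆)
    (trans (g₆ u r′ t′ b₁ b₂ b₃ b₄ b₆) (eq₆ e₁ e₂ e₃ e₄ e₆)))
  where
  k₁ = solve 3 (λ u u′ c → u ⊗ u′ ⊗ c ≋ u ⊗ (u′ ⊗ c)) refl
  k₂ = solve 3 (λ u u′ c → u ⊗ u′ ⊗ (u ⊗ u′) ⊗ c ≋ u ⊗ u ⊗ (u′ ⊗ u′ ⊗ c)) refl
  k₃ = solve 3 (λ u u′ c → u ⊗ u′ ⊗ (u ⊗ u′) ⊗ (u ⊗ u′) ⊗ c ≋ u ⊗ u ⊗ u ⊗ (u′ ⊗ u′ ⊗ u′ ⊗ c)) refl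
  k₄ = solve 3 (λ u u′ c → u ⊗ u′ ⊗ (u ⊗ u′) ⊗ (u ⊗ u′) ⊗ (u ⊗ u′) ⊗ c ≋ u ⊗ u ⊗ u ⊗ u ⊗ (u′ ⊗ u′ ⊗ u′ ⊗ u′ ⊗ c)) refl
  k₆ = solve 3 (λ u u′ c → u ⊗ u′ ⊗ (u ⊗ u′) ⊗ (u ⊗ u′) ⊗ (u ⊗ u′) ⊗ (u ⊗ u′) ⊗ (u ⊗ u′) ⊗ c ≋ u ⊗ u ⊗ u ⊗ u ⊗ u ⊗ u ⊗ (u′ ⊗ u′ ⊗ u′ ⊗ u′ ⊗ u′ ⊗ u′ ⊗ c)) refl
  g₁ = solve 5 (λ u b₁ a₁ s s′ → u ⊗ (b₁ ⊕ Κ (q 2) ⊗ s′) ⊖ (a₁ ⊕ Κ (q 2) ⊗ (u ⊗ s′ ⊕ s)) ≋ Κ 1ℚ ⊗ (u ⊗ b₁ ⊖ (a₁ ⊕ Κ (q 2) ⊗ s))) refl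
  g₂ = solve 9 (λ u r s r′ s′ a₁ a₂ b₁ b₂ →
    u ⊗ u ⊗ (b₂ ⊖ s′ ⊗ b₁ ⊕ Κ (q 3) ⊗ r′ ⊖ s′ ⊗ s′) ⊖ (a₂ ⊖ (u ⊗ s′ ⊕ s) ⊗ a₁ ⊕ Κ (q 3) ⊗ (u ⊗ u ⊗ r′ ⊕ r) ⊖ (u ⊗ s′ ⊕ s) ⊗ (u ⊗ s′ ⊕ s)) ≋
    Κ 1ℚ ⊗ (u ⊗ u ⊗ b₂ ⊖ (a₂ ⊖ s ⊗ a₁ ⊕ Κ (q 3) ⊗ r ⊖ s ⊗ s)) ⊕ ⊝ (u ⊗ s′) ⊗ (u ⊗ b₁ ⊖ (a₁ ⊕ Κ (q 2) ⊗ s))) refl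
  g₃ = solve 10 (λ u r s t r′ t′ a₁ a₃ b₁ b₃ →
    u ⊗ u ⊗ u ⊗ (b₃ ⊕ r′ ⊗ b₁ ⊕ Κ (q 2) ⊗ t′) ⊖ (a₃ ⊕ (u ⊗ u ⊗ r′ ⊕ r) ⊗ a₁ ⊕ Κ (q 2) ⊗ (u ⊗ u ⊗ u ⊗ t′ ⊕ s ⊗ (u ⊗ u ⊗ r′) ⊕ t)) ≋
    Κ 1ℚ ⊗ (u ⊗ u ⊗ u ⊗ b₃ ⊖ (a₃ ⊕ r ⊗ a₁ ⊕ Κ (q 2) ⊗ t)) ⊕ u ⊗ u ⊗ r′ ⊗ (u ⊗ b₁ ⊖ (a₁ ⊕ Κ (q 2) ⊗ s))) refl
  g₄ = solve 8 (λ u r′ s′ t′ b₁ b₂ b₃ b₄ →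
    u ⊗ u ⊗ u ⊗ u ⊗ (b₄ ⊖ s′ ⊗ b₃ ⊕ Κ (q 2) ⊗ r′ ⊗ b₂ ⊖ (t′ ⊕ r′ ⊗ s′) ⊗ b₁ ⊕ Κ (q 3) ⊗ r′ ⊗ r′ ⊖ Κ (q 2) ⊗ s′ ⊗ t′) ≋
    u ⊗ u ⊗ u ⊗ u ⊗ b₄ ⊖ u ⊗ s′ ⊗ (u ⊗ u ⊗ u ⊗ b₃) ⊕ Κ (q 2) ⊗ (u ⊗ u ⊗ r′) ⊗ (u ⊗ u ⊗ b₂)
    ⊖ (u ⊗ u ⊗ u ⊗ t′ ⊕ u ⊗ u ⊗ r′ ⊗ (u ⊗ s′)) ⊗ (u ⊗ b₁) ⊕ (Κ (q 3) ⊗ (u ⊗ u ⊗ r′) ⊗ (u ⊗ u ⊗ r′) ⊖ Κ (q 2) ⊗ (u ⊗ s′) ⊗ (u ⊗ u ⊗ u ⊗ t′))) refl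
  -- Here ρ = u²r′, σ = us′ and τ = u³t′.
  h₄ = solve 10 (λ ρ σ τ r s t a₁ a₂ a₃ a₄ →
    (a₄ ⊖ s ⊗ a₃ ⊕ Κ (q 2) ⊗ r ⊗ a₂ ⊖ (t ⊕ r ⊗ s) ⊗ a₁ ⊕ Κ (q 3) ⊗ r ⊗ r ⊖ Κ (q 2) ⊗ s ⊗ t) ⊖ σ ⊗ (a₃ ⊕ r ⊗ a₁ ⊕ Κ (q 2) ⊗ t)
    ⊕ Κ (q 2) ⊗ ρ ⊗ (a₂ ⊖ s ⊗ a₁ ⊕ Κ (q 3) ⊗ r ⊖ s ⊗ s) ⊖ (τ ⊕ ρ ⊗ σ) ⊗ (a₁ ⊕ Κ (q 2) ⊗ s) ⊕ (Κ (q 3) ⊗ ρ ⊗ ρ ⊖ Κ (q 2) ⊗ σ ⊗ τ) ≋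
    let r″ = ρ ⊕ r
        s″ = σ ⊕ s
        t″ = τ ⊕ s ⊗ ρ ⊕ t
    in a₄ ⊖ s″ ⊗ a₃ ⊕ Κ (q 2) ⊗ r″ ⊗ a₂ ⊖ (t″ ⊕ r″ ⊗ s″) ⊗ a₁ ⊕ Κ (q 3) ⊗ r″ ⊗ r″ ⊖ Κ (q 2) ⊗ s″ ⊗ t″) refl
  eq₄ : ∀ {x₁ x₂ x₃ x₄} → x₁ ≡ a₁ + q 2 * s → x₂ ≡ a₂ - s * a₁ + q 3 * r - s * s → x₃ ≡ a₃ + r * a₁ + q 2 * t →
    x₄ ≡ a₄ - s * a₃ + q 2 * r * a₂ - (t + r * s) * a₁ + q 3 * r * r - q 2 * s * t →
    let ρ = u * u * r′
        σ = u * s′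
        τ = u * u * u * t′
    in x₄ - σ * x₃ + q 2 * ρ * x₂ - (τ + ρ * σ) * x₁ + (q 3 * ρ * ρ - q 2 * σ * τ) ≡ _
  eq₄ refl refl refl refl = h₄ (u * u * r′) (u * s′) (u * u * u * t′) r s t a₁ a₂ a₃ a₄
  g₆ = solve 8 (λ u r′ t′ b₁ b₂ b₃ b₄ b₆ →
    u ⊗ u ⊗ u ⊗ u ⊗ u ⊗ u ⊗ (b₆ ⊕ r′ ⊗ b₄ ⊕ r′ ⊗ r′ ⊗ b₂ ⊕ r′ ⊗ r′ ⊗ r′ ⊖ t′ ⊗ b₃ ⊖ t′ ⊗ t′ ⊖ r′ ⊗ t′ ⊗ b₁) ≋
    u ⊗ u ⊗ u ⊗ u ⊗ u ⊗ u ⊗ b₆ ⊕ u ⊗ u ⊗ r′ ⊗ (u ⊗ u ⊗ u ⊗ u ⊗ b₄) ⊕ u ⊗ u ⊗ r′ ⊗ (u ⊗ u ⊗ r′) ⊗ (u ⊗ u ⊗ b₂)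
    ⊖ u ⊗ u ⊗ u ⊗ t′ ⊗ (u ⊗ u ⊗ u ⊗ b₃) ⊖ u ⊗ u ⊗ r′ ⊗ (u ⊗ u ⊗ u ⊗ t′) ⊗ (u ⊗ b₁)
    ⊕ (u ⊗ u ⊗ r′ ⊗ (u ⊗ u ⊗ r′) ⊗ (u ⊗ u ⊗ r′) ⊖ u ⊗ u ⊗ u ⊗ t′ ⊗ (u ⊗ u ⊗ u ⊗ t′))) refl
  h₆ = solve 10 (λ ρ τ r s t a₁ a₂ a₃ a₄ a₆ →
    (a₆ ⊕ r ⊗ a₄ ⊕ r ⊗ r ⊗ a₂ ⊕ r ⊗ r ⊗ r ⊖ t ⊗ a₃ ⊖ t ⊗ t ⊖ r ⊗ t ⊗ a₁)
    ⊕ ρ ⊗ (a₄ ⊖ s ⊗ a₃ ⊕ Κ (q 2) ⊗ r ⊗ a₂ ⊖ (t ⊕ r ⊗ s) ⊗ a₁ ⊕ Κ (q 3) ⊗ r ⊗ r ⊖ Κ (q 2) ⊗ s ⊗ t)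
    ⊕ ρ ⊗ ρ ⊗ (a₂ ⊖ s ⊗ a₁ ⊕ Κ (q 3) ⊗ r ⊖ s ⊗ s) ⊖ τ ⊗ (a₃ ⊕ r ⊗ a₁ ⊕ Κ (q 2) ⊗ t) ⊖ ρ ⊗ τ ⊗ (a₁ ⊕ Κ (q 2) ⊗ s) ⊕ (ρ ⊗ ρ ⊗ ρ ⊖ τ ⊗ τ) ≋
    let r″ = ρ ⊕ r
        t″ = τ ⊕ s ⊗ ρ ⊕ t
    in a₆ ⊕ r″ ⊗ a₄ ⊕ r″ ⊗ r″ ⊗ a₂ ⊕ r″ ⊗ r″ ⊗ r″ ⊖ t″ ⊗ a₃ ⊖ t″ ⊗ t″ ⊖ r″ ⊗ t″ ⊗ a₁) refl
  eq₆ : ∀ {x₁ x₂ x₃ x₄ x₆} → x₁ ≡ a₁ + q 2 * s → x₂ ≡ a₂ - s * a₁ + q 3 * r - s * s → x₃ ≡ a₃ + r * a₁ + q 2 * t →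
    x₄ ≡ a₄ - s * a₃ + q 2 * r * a₂ - (t + r * s) * a₁ + q 3 * r * r - q 2 * s * t →
    x₆ ≡ a₆ + r * a₄ + r * r * a₂ + r * r * r - t * a₃ - t * t - r * t * a₁ →
    x₆ + u * u * r′ * x₄ + u * u * r′ * (u * u * r′) * x₂ - u * u * u * t′ * x₃ - u * u * r′ * (u * u * u * t′) * x₁
    + (u * u * r′ * (u * u * r′) * (u * u * r′) - u * u * u * t′ * (u * u * u * t′)) ≡ _
  eq₆ refl refl refl refl refl = h₆ (u * u * r′) (u * u * u * t′) r s t a₁ a₂ a₃ a₄ a₆

÷-* : ∀ x {y} (y≢0 : y ≢ 0ℚ) → (x ÷ y) {{≢-nonZero y≢0}} * y ≡ x
÷-* x {y} y≢0 = lin₁ x (*-inverseʳ y {{≢-nonZero y≢0}}) (identity x y ((1/ y) {{≢-nonZero y≢0}}))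
  where
  identity = solve 3 (λ x y i → x ⊗ i ⊗ y ⊖ x ≋ x ⊗ (y ⊗ i ⊖ Κ 1ℚ)) refl

module Formulas (E : WModel ℚ) where

  opposite : ℚ → ℚ → ℚ → ℚ
  opposite x₂ y₁ y₂ = y₁ + y₂ + a1 E * x₂ + a3 E

  tangent-den : ℚ → ℚ → ℚ
  tangent-den x y = q 2 * y + a1 E * x + a3 E

  tangent-num : ℚ → ℚ → ℚ
  tangent-num x y = q 3 * x * x + q 2 * a2 E * x + a4 E - a1 E * y

  -- The graph of `addPt`. Slopes are given by equations free of division, the form in which the
  -- ring solver can use them.
  data Sum (x₁ y₁ x₂ y₂ : ℚ) : Point → Set where
    chord   : ∀ l → x₂ - x₁ ≢ 0ℚ → l * (x₂ - x₁) ≡ y₂ - y₁ → Sum x₁ y₁ x₂ y₂ (third E x₁ y₁ x₂ l)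
    tangent : ∀ l → x₂ - x₁ ≡ 0ℚ → opposite x₂ y₁ y₂ ≢ 0ℚ → tangent-den x₁ y₁ ≢ 0ℚ →
              l * tangent-den x₁ y₁ ≡ tangent-num x₁ y₁ → Sum x₁ y₁ x₂ y₂ (third E x₁ y₁ x₂ l)
    zero    : x₂ - x₁ ≡ 0ℚ → opposite x₂ y₁ y₂ ≡ 0ℚ → Sum x₁ y₁ x₂ y₂ O
    junk    : x₂ - x₁ ≡ 0ℚ → opposite x₂ y₁ y₂ ≢ 0ℚ → tangent-den x₁ y₁ ≡ 0ℚ → Sum x₁ y₁ x₂ y₂ O

open Formulas

sum : ∀ E x₁ y₁ x₂ y₂ → Sum E x₁ y₁ x₂ y₂ (addPt E (aff x₁ y₁) (aff x₂ y₂))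
sum E x₁ y₁ x₂ y₂ with (x₂ - x₁) ≟ 0ℚ
... | no d≢0 = chord (((y₂ - y₁) ÷ (x₂ - x₁)) {{≢-nonZero d≢0}}) d≢0 (÷-* (y₂ - y₁) d≢0)
... | yes d≡0 with (y₁ + y₂ + a1 E * x₂ + a3 E) ≟ 0ℚ
...   | yes n≡0 = zero d≡0 n≡0
...   | no n≢0 with (q 2 * y₁ + a1 E * x₁ + a3 E) ≟ 0ℚ
...     | yes t≡0 = junk d≡0 n≢0 t≡0
...     | no t≢0 = tangent ((tangent-num E x₁ y₁ ÷ tangent-den E x₁ y₁) {{≢-nonZero t≢0}}) d≡0 n≢0 t≢0
                       (÷-* (tangent-num E x₁ y₁) t≢0)

-- The cases exclude one another, and within a case the slope is determined because its denominator
-- is nonzero. To compute a sum it is therefore enough to exhibit a `Sum`.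
sum-unique : ∀ E x₁ y₁ x₂ y₂ {R} → Sum E x₁ y₁ x₂ y₂ R → addPt E (aff x₁ y₁) (aff x₂ y₂) ≡ R
sum-unique E x₁ y₁ x₂ y₂ S with addPt E (aff x₁ y₁) (aff x₂ y₂) | sum E x₁ y₁ x₂ y₂
sum-unique E x₁ y₁ x₂ y₂ (chord l d h) | _ | chord l′ _ h′ =
  cong (third E x₁ y₁ x₂) (cancel d (trans (*-comm (x₂ - x₁) l′) (trans (trans h′ (sym h)) (sym (*-comm (x₂ - x₁) l)))))
sum-unique E x₁ y₁ x₂ y₂ (chord l d h) | _ | tangent _ d′ _ _ _ = ⊥-elim (d d′)
sum-unique E x₁ y₁ x₂ y₂ (chord l d h) | _ | zero d′ _          = ⊥-elim (d d′)
sum-unique E x₁ y₁ x₂ y₂ (chord l d h) | _ | junk d′ _ _        = ⊥-elim (d d′)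
sum-unique E x₁ y₁ x₂ y₂ (tangent _ d _ _ _) | _ | chord _ d′ _ = ⊥-elim (d′ d)
sum-unique E x₁ y₁ x₂ y₂ (tangent l _ _ t h) | _ | tangent l′ _ _ _ h′ =
  cong (third E x₁ y₁ x₂) (cancel t (trans (*-comm den l′) (trans (trans h′ (sym h)) (sym (*-comm den l)))))
  where
  den = tangent-den E x₁ y₁
sum-unique E x₁ y₁ x₂ y₂ (tangent _ _ n _ _) | _ | zero _ n′   = ⊥-elim (n n′)
sum-unique E x₁ y₁ x₂ y₂ (tangent _ _ _ t _) | _ | junk _ _ t′ = ⊥-elim (t t′)
sum-unique E x₁ y₁ x₂ y₂ (zero d _) | _ | chord _ d′ _         = ⊥-elim (d′ d)
sum-unique E x₁ y₁ x₂ y₂ (zero _ n) | _ | tangent _ _ n′ _ _   = ⊥-elim (n′ n)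
sum-unique E x₁ y₁ x₂ y₂ (zero _ _) | _ | zero _ _             = refl
sum-unique E x₁ y₁ x₂ y₂ (zero _ _) | _ | junk _ _ _           = refl
sum-unique E x₁ y₁ x₂ y₂ (junk d _ _) | _ | chord _ d′ _       = ⊥-elim (d′ d)
sum-unique E x₁ y₁ x₂ y₂ (junk _ _ t) | _ | tangent _ _ _ t′ _ = ⊥-elim (t′ t)
sum-unique E x₁ y₁ x₂ y₂ (junk _ _ _) | _ | zero _ _           = refl
sum-unique E x₁ y₁ x₂ y₂ (junk _ _ _) | _ | junk _ _ _         = refl

cong-aff : ∀ {x y x′ y′} → x ≡ x′ → y ≡ y′ → aff x y ≡ aff x′ y′
cong-aff refl refl = refl

-- The inverse `v` of `u` is a parameter, so the maps on points are polynomial in both directions.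
module Transport (u v r s t : ℚ) (uv≡1 : u * v ≡ 1ℚ) (F : WModel ℚ) where

  E : WModel ℚ
  E = change u r s t F

  scaled-coefficients = scaled E F u r s t refl

  ψ φ : Point → Point
  ψ O         = O
  ψ (aff x y) = aff (u * u * x + r) (u * u * u * y + s * (u * u * x) + t)
  φ O         = O
  φ (aff x y) = aff (v * v * (x - r)) (v * v * v * (y - s * (x - r) - t))

  ψ∘φ : ∀ P → ψ (φ P) ≡ P
  ψ∘φ O = refl
  ψ∘φ (aff x y) = cong-aff
    (lin₁ ((x - r) * (u * v + 1ℚ)) uv≡1 (ex u v r x))
    (lin₂ ((y - s * (x - r) - t) * (u * v * (u * v) + u * v + 1ℚ)) (s * (x - r) * (u * v + 1ℚ)) uv≡1 uv≡1 (ey u v r s t x y))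
    where
    ex = solve 4 (λ u v r x → u ⊗ u ⊗ (v ⊗ v ⊗ (x ⊖ r)) ⊕ r ⊖ x ≋ (x ⊖ r) ⊗ (u ⊗ v ⊕ Κ 1ℚ) ⊗ (u ⊗ v ⊖ Κ 1ℚ)) refl
    ey = solve 7 (λ u v r s t x y →
         u ⊗ u ⊗ u ⊗ (v ⊗ v ⊗ v ⊗ (y ⊖ s ⊗ (x ⊖ r) ⊖ t)) ⊕ s ⊗ (u ⊗ u ⊗ (v ⊗ v ⊗ (x ⊖ r))) ⊕ t ⊖ y ≋
         (y ⊖ s ⊗ (x ⊖ r) ⊖ t) ⊗ (u ⊗ v ⊗ (u ⊗ v) ⊕ u ⊗ v ⊕ Κ 1ℚ) ⊗ (u ⊗ v ⊖ Κ 1ℚ) ⊕ s ⊗ (x ⊖ r) ⊗ (u ⊗ v ⊕ Κ 1ℚ) ⊗ (u ⊗ v ⊖ Κ 1ℚ)) refl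

  φ∘ψ : ∀ P → φ (ψ P) ≡ P
  φ∘ψ O = refl
  φ∘ψ (aff x y) = cong-aff
    (lin₁ (x * (u * v + 1ℚ)) uv≡1 (ex u v r x))
    (lin₁ (y * (u * v * (u * v) + u * v + 1ℚ)) uv≡1 (ey u v r s t x y))
    where
    ex = solve 4 (λ u v r x → v ⊗ v ⊗ (u ⊗ u ⊗ x ⊕ r ⊖ r) ⊖ x ≋ x ⊗ (u ⊗ v ⊕ Κ 1ℚ) ⊗ (u ⊗ v ⊖ Κ 1ℚ)) refl
    ey = solve 7 (λ u v r s t x y →
         v ⊗ v ⊗ v ⊗ (u ⊗ u ⊗ u ⊗ y ⊕ s ⊗ (u ⊗ u ⊗ x) ⊕ t ⊖ s ⊗ (u ⊗ u ⊗ x ⊕ r ⊖ r) ⊖ t) ⊖ y ≋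
         y ⊗ (u ⊗ v ⊗ (u ⊗ v) ⊕ u ⊗ v ⊕ Κ 1ℚ) ⊗ (u ⊗ v ⊖ Κ 1ℚ)) refl

  u≢0 : u ≢ 0ℚ
  u≢0 refl = contradiction (trans (sym (*-zeroˡ v)) uv≡1)
    where
    contradiction : 0ℚ ≢ 1ℚ
    contradiction ()

  u²≢0 : u * u ≢ 0ℚ
  u²≢0 = *-≢0 u≢0 u≢0

  u³≢0 : u * u * u ≢ 0ℚ
  u³≢0 = *-≢0 u²≢0 u≢0

  scale≡0 : ∀ k x {y} → y ≡ k * x → x ≡ 0ℚ → y ≡ 0ℚ
  scale≡0 k _ refl refl = *-zeroʳ k

  scale≢0 : ∀ k x {y} → k ≢ 0ℚ → y ≡ k * x → x ≢ 0ℚ → y ≢ 0ℚ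
  scale≢0 _ _ k≢0 refl x≢0 = *-≢0 k≢0 x≢0

  -- The substitution turns a line of slope `l` on `F` into a line of slope `u * l + s` on `E`.
  ψ-third : ∀ x₁ y₁ x₂ l →
            third E (u * u * x₁ + r) (u * u * u * y₁ + s * (u * u * x₁) + t) (u * u * x₂ + r) (u * l + s) ≡
            ψ (third F x₁ y₁ x₂ l)
  ψ-third x₁ y₁ x₂ l = cong-aff (ex u r s (a1 F) (a2 F) x₁ x₂ l) (ey u r s t (a1 F) (a2 F) (a3 F) x₁ y₁ x₂ l)
    where
    ex = solve 8 (λ u r s b₁ b₂ x₁ x₂ l →
         let a₁ = u ⊗ b₁ ⊖ Κ (q 2) ⊗ s
             a₂ = u ⊗ u ⊗ b₂ ⊕ s ⊗ a₁ ⊖ Κ (q 3) ⊗ r ⊕ s ⊗ s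
             L = u ⊗ l ⊕ s
         in L ⊗ L ⊕ a₁ ⊗ L ⊖ a₂ ⊖ (u ⊗ u ⊗ x₁ ⊕ r) ⊖ (u ⊗ u ⊗ x₂ ⊕ r) ≋ u ⊗ u ⊗ (l ⊗ l ⊕ b₁ ⊗ l ⊖ b₂ ⊖ x₁ ⊖ x₂) ⊕ r) refl
    ey = solve 11 (λ u r s t b₁ b₂ b₃ x₁ y₁ x₂ l →
         let a₁ = u ⊗ b₁ ⊖ Κ (q 2) ⊗ s
             a₂ = u ⊗ u ⊗ b₂ ⊕ s ⊗ a₁ ⊖ Κ (q 3) ⊗ r ⊕ s ⊗ s
             a₃ = u ⊗ u ⊗ u ⊗ b₃ ⊖ r ⊗ a₁ ⊖ Κ (q 2) ⊗ t
             L = u ⊗ l ⊕ s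
             X₃ = L ⊗ L ⊕ a₁ ⊗ L ⊖ a₂ ⊖ (u ⊗ u ⊗ x₁ ⊕ r) ⊖ (u ⊗ u ⊗ x₂ ⊕ r)
             x₃ = l ⊗ l ⊕ b₁ ⊗ l ⊖ b₂ ⊖ x₁ ⊖ x₂
         in (⊝ ((L ⊕ a₁) ⊗ X₃)) ⊖ (u ⊗ u ⊗ u ⊗ y₁ ⊕ s ⊗ (u ⊗ u ⊗ x₁) ⊕ t ⊖ L ⊗ (u ⊗ u ⊗ x₁ ⊕ r)) ⊖ a₃ ≋
            u ⊗ u ⊗ u ⊗ ((⊝ ((l ⊕ b₁) ⊗ x₃)) ⊖ (y₁ ⊖ l ⊗ x₁) ⊖ b₃) ⊕ s ⊗ (u ⊗ u ⊗ x₃) ⊕ t) refl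

  module _ (x₁ y₁ x₂ y₂ : ℚ) where
    Δx : (u * u * x₂ + r) - (u * u * x₁ + r) ≡ u * u * (x₂ - x₁)
    Δx = identity u r x₁ x₂
      where
      identity = solve 4 (λ u r x₁ x₂ → (u ⊗ u ⊗ x₂ ⊕ r) ⊖ (u ⊗ u ⊗ x₁ ⊕ r) ≋ u ⊗ u ⊗ (x₂ ⊖ x₁)) refl

    ψ-opposite : x₂ - x₁ ≡ 0ℚ →
                 opposite E (u * u * x₂ + r) (u * u * u * y₁ + s * (u * u * x₁) + t) (u * u * u * y₂ + s * (u * u * x₂) + t)
                 ≡ u * u * u * opposite F x₂ y₁ y₂
    ψ-opposite d = lin₁ (- (s * u * u)) d (identity u r s t (a1 F) (a3 F) x₁ y₁ x₂ y₂)
      where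
      identity = solve 10 (λ u r s t b₁ b₃ x₁ y₁ x₂ y₂ →
        let a₁ = u ⊗ b₁ ⊖ Κ (q 2) ⊗ s
            a₃ = u ⊗ u ⊗ u ⊗ b₃ ⊖ r ⊗ a₁ ⊖ Κ (q 2) ⊗ t
        in (u ⊗ u ⊗ u ⊗ y₁ ⊕ s ⊗ (u ⊗ u ⊗ x₁) ⊕ t) ⊕ (u ⊗ u ⊗ u ⊗ y₂ ⊕ s ⊗ (u ⊗ u ⊗ x₂) ⊕ t) ⊕ a₁ ⊗ (u ⊗ u ⊗ x₂ ⊕ r) ⊕ a₃
           ⊖ u ⊗ u ⊗ u ⊗ (y₁ ⊕ y₂ ⊕ b₁ ⊗ x₂ ⊕ b₃) ≋ ⊝ (s ⊗ u ⊗ u) ⊗ (x₂ ⊖ x₁ ⊖ Κ 0ℚ)) refl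

    ψ-den : tangent-den E (u * u * x₁ + r) (u * u * u * y₁ + s * (u * u * x₁) + t) ≡ u * u * u * tangent-den F x₁ y₁
    ψ-den = identity u r s t (a1 F) (a3 F) x₁ y₁
      where
      identity = solve 8 (λ u r s t b₁ b₃ x₁ y₁ →
        let a₁ = u ⊗ b₁ ⊖ Κ (q 2) ⊗ s
            a₃ = u ⊗ u ⊗ u ⊗ b₃ ⊖ r ⊗ a₁ ⊖ Κ (q 2) ⊗ t
        in Κ (q 2) ⊗ (u ⊗ u ⊗ u ⊗ y₁ ⊕ s ⊗ (u ⊗ u ⊗ x₁) ⊕ t) ⊕ a₁ ⊗ (u ⊗ u ⊗ x₁ ⊕ r) ⊕ a₃ ≋ u ⊗ u ⊗ u ⊗ (Κ (q 2) ⊗ y₁ ⊕ b₁ ⊗ x₁ ⊕ b₃)) refl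

    -- Split into a translation by `r`, `s`, `t` and a scaling by `u`, under which the tangent
    -- equation is homogeneous of weight 4.
    ψ-num : ∀ l → l * tangent-den F x₁ y₁ ≡ tangent-num F x₁ y₁ →
            (u * l + s) * tangent-den E (u * u * x₁ + r) (u * u * u * y₁ + s * (u * u * x₁) + t) ≡
            tangent-num E (u * u * x₁ + r) (u * u * u * y₁ + s * (u * u * x₁) + t)
    ψ-num l h = lin₁ (u * u * u * u) h (trans (shift λ′ ξ η r s t (a1 E) (a2 E) (a3 E) (a4 E))
      (trans (rewrite-coefficients scaled-coefficients) (homogeneous u (a1 F) (a2 F) (a3 F) (a4 F) x₁ y₁ l)))
      where
      λ′ = u * l
      ξ = u * u * x₁
      η = u * u * u * y₁
      shift = solve 10 (λ λ′ ξ η r s t a₁ a₂ a₃ a₄ →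
        let X = ξ ⊕ r
            Y = η ⊕ s ⊗ ξ ⊕ t
        in (λ′ ⊕ s) ⊗ (Κ (q 2) ⊗ Y ⊕ a₁ ⊗ X ⊕ a₃) ⊖ (Κ (q 3) ⊗ X ⊗ X ⊕ Κ (q 2) ⊗ a₂ ⊗ X ⊕ a₄ ⊖ a₁ ⊗ Y) ≋
           λ′ ⊗ (Κ (q 2) ⊗ η ⊕ (a₁ ⊕ Κ (q 2) ⊗ s) ⊗ ξ ⊕ (a₃ ⊕ r ⊗ a₁ ⊕ Κ (q 2) ⊗ t)) ⊖
           (Κ (q 3) ⊗ ξ ⊗ ξ ⊕ Κ (q 2) ⊗ (a₂ ⊖ s ⊗ a₁ ⊕ Κ (q 3) ⊗ r ⊖ s ⊗ s) ⊗ ξ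
            ⊕ (a₄ ⊖ s ⊗ a₃ ⊕ Κ (q 2) ⊗ r ⊗ a₂ ⊖ (t ⊕ r ⊗ s) ⊗ a₁ ⊕ Κ (q 3) ⊗ r ⊗ r ⊖ Κ (q 2) ⊗ s ⊗ t) ⊖ (a₁ ⊕ Κ (q 2) ⊗ s) ⊗ η)) refl
      homogeneous = solve 8 (λ u b₁ b₂ b₃ b₄ x y l →
        let ξ = u ⊗ u ⊗ x
            η = u ⊗ u ⊗ u ⊗ y
        in u ⊗ l ⊗ (Κ (q 2) ⊗ η ⊕ u ⊗ b₁ ⊗ ξ ⊕ u ⊗ u ⊗ u ⊗ b₃) ⊖ (Κ (q 3) ⊗ ξ ⊗ ξ ⊕ Κ (q 2) ⊗ (u ⊗ u ⊗ b₂) ⊗ ξ ⊕ u ⊗ u ⊗ u ⊗ u ⊗ b₄ ⊖ u ⊗ b₁ ⊗ η) ≋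
           u ⊗ u ⊗ u ⊗ u ⊗ (l ⊗ (Κ (q 2) ⊗ y ⊕ b₁ ⊗ x ⊕ b₃) ⊖ (Κ (q 3) ⊗ x ⊗ x ⊕ Κ (q 2) ⊗ b₂ ⊗ x ⊕ b₄ ⊖ b₁ ⊗ y))) refl
      rewrite-coefficients : ∀ {x₁ x₂ x₃ x₄ y₁ y₂ y₃ y₄} {P : Set} → x₁ ≡ y₁ × x₂ ≡ y₂ × x₃ ≡ y₃ × x₄ ≡ y₄ × P →
        λ′ * (q 2 * η + y₁ * ξ + y₃) - (q 3 * ξ * ξ + q 2 * y₂ * ξ + y₄ - y₁ * η) ≡
        λ′ * (q 2 * η + x₁ * ξ + x₃) - (q 3 * ξ * ξ + q 2 * x₂ * ξ + x₄ - x₁ * η)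
      rewrite-coefficients (refl , refl , refl , refl , _) = refl

  ψ-sum : ∀ {x₁ y₁ x₂ y₂ R} → Sum F x₁ y₁ x₂ y₂ R →
          addPt E (ψ (aff x₁ y₁)) (ψ (aff x₂ y₂)) ≡ ψ R
  ψ-sum {x₁} {y₁} {x₂} {y₂} (chord l d h) =
    trans (sum-unique E _ (u * u * u * y₁ + s * (u * u * x₁) + t) _ (u * u * u * y₂ + s * (u * u * x₂) + t) (chord (u * l + s) (scale≢0 (u * u) (x₂ - x₁) u²≢0 (Δx x₁ y₁ x₂ y₂) d) (lin₁ (u * u * u) h (slope u r s t x₁ y₁ x₂ y₂ l))))
          (ψ-third x₁ y₁ x₂ l)
    where
    slope = solve 9 (λ u r s t x₁ y₁ x₂ y₂ l →
      (u ⊗ l ⊕ s) ⊗ ((u ⊗ u ⊗ x₂ ⊕ r) ⊖ (u ⊗ u ⊗ x₁ ⊕ r)) ⊖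
      ((u ⊗ u ⊗ u ⊗ y₂ ⊕ s ⊗ (u ⊗ u ⊗ x₂) ⊕ t) ⊖ (u ⊗ u ⊗ u ⊗ y₁ ⊕ s ⊗ (u ⊗ u ⊗ x₁) ⊕ t)) ≋
      u ⊗ u ⊗ u ⊗ (l ⊗ (x₂ ⊖ x₁) ⊖ (y₂ ⊖ y₁))) refl
  ψ-sum {x₁} {y₁} {x₂} {y₂} (tangent l d n t′ h) =
    trans (sum-unique E _ (u * u * u * y₁ + s * (u * u * x₁) + t) _ (u * u * u * y₂ + s * (u * u * x₂) + t) (tangent (u * l + s) (scale≡0 (u * u) (x₂ - x₁) (Δx x₁ y₁ x₂ y₂) d) (scale≢0 (u * u * u) (opposite F x₂ y₁ y₂) u³≢0 (ψ-opposite x₁ y₁ x₂ y₂ d) n)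
                                 (scale≢0 (u * u * u) (tangent-den F x₁ y₁) u³≢0 (ψ-den x₁ y₁ x₂ y₂) t′) (ψ-num x₁ y₁ x₂ y₂ l h)))
          (ψ-third x₁ y₁ x₂ l)
  ψ-sum {x₁} {y₁} {x₂} {y₂} (zero d n) =
    sum-unique E _ (u * u * u * y₁ + s * (u * u * x₁) + t) _ (u * u * u * y₂ + s * (u * u * x₂) + t) (zero (scale≡0 (u * u) (x₂ - x₁) (Δx x₁ y₁ x₂ y₂) d) (scale≡0 (u * u * u) (opposite F x₂ y₁ y₂) (ψ-opposite x₁ y₁ x₂ y₂ d) n))
  ψ-sum {x₁} {y₁} {x₂} {y₂} (junk d n t′) =
    sum-unique E _ (u * u * u * y₁ + s * (u * u * x₁) + t) _ (u * u * u * y₂ + s * (u * u * x₂) + t) (junk (scale≡0 (u * u) (x₂ - x₁) (Δx x₁ y₁ x₂ y₂) d) (scale≢0 (u * u * u) (opposite F x₂ y₁ y₂) u³≢0 (ψ-opposite x₁ y₁ x₂ y₂ d) n)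
                       (scale≡0 (u * u * u) (tangent-den F x₁ y₁) (ψ-den x₁ y₁ x₂ y₂) t′))

  ψ-add : ∀ P Q → addPt E (ψ P) (ψ Q) ≡ ψ (addPt F P Q)
  ψ-add O Q                     = refl
  ψ-add (aff x y) O             = refl
  ψ-add (aff x₁ y₁) (aff x₂ y₂) = ψ-sum (sum F x₁ y₁ x₂ y₂)

  φ-add : ∀ P Q → φ (addPt E P Q) ≡ addPt F (φ P) (φ Q)
  φ-add P Q = trans (cong φ (trans (sym (cong₂ (addPt E) (ψ∘φ P) (ψ∘φ Q))) (ψ-add (φ P) (φ Q)))) (φ∘ψ _)

  ψ-onCurve : ∀ P → OnCurve E (ψ P) → OnCurve F P
  ψ-onCurve O _ = tt
  ψ-onCurve (aff x y) h =
    x-y≡0⇒x≡y (zero-product (trans (sym difference) (x≡y⇒x-y≡0 h)) (*-≢0 u³≢0 u³≢0))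
    where
    ξ = u * u * x
    η = u * u * u * y
    shift = solve 10 (λ ξ η r s t a₁ a₂ a₃ a₄ a₆ →
      let X = ξ ⊕ r
          Y = η ⊕ s ⊗ ξ ⊕ t
      in (Y ⊗ Y ⊕ a₁ ⊗ X ⊗ Y ⊕ a₃ ⊗ Y) ⊖ (X ⊗ X ⊗ X ⊕ a₂ ⊗ X ⊗ X ⊕ a₄ ⊗ X ⊕ a₆) ≋
         (η ⊗ η ⊕ (a₁ ⊕ Κ (q 2) ⊗ s) ⊗ ξ ⊗ η ⊕ (a₃ ⊕ r ⊗ a₁ ⊕ Κ (q 2) ⊗ t) ⊗ η) ⊖
         (ξ ⊗ ξ ⊗ ξ ⊕ (a₂ ⊖ s ⊗ a₁ ⊕ Κ (q 3) ⊗ r ⊖ s ⊗ s) ⊗ ξ ⊗ ξ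
          ⊕ (a₄ ⊖ s ⊗ a₃ ⊕ Κ (q 2) ⊗ r ⊗ a₂ ⊖ (t ⊕ r ⊗ s) ⊗ a₁ ⊕ Κ (q 3) ⊗ r ⊗ r ⊖ Κ (q 2) ⊗ s ⊗ t) ⊗ ξ
          ⊕ (a₆ ⊕ r ⊗ a₄ ⊕ r ⊗ r ⊗ a₂ ⊕ r ⊗ r ⊗ r ⊖ t ⊗ a₃ ⊖ t ⊗ t ⊖ r ⊗ t ⊗ a₁))) refl
    homogeneous = solve 8 (λ u b₁ b₂ b₃ b₄ b₆ x y →
      let ξ = u ⊗ u ⊗ x
          η = u ⊗ u ⊗ u ⊗ y
      in (η ⊗ η ⊕ u ⊗ b₁ ⊗ ξ ⊗ η ⊕ u ⊗ u ⊗ u ⊗ b₃ ⊗ η) ⊖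
         (ξ ⊗ ξ ⊗ ξ ⊕ u ⊗ u ⊗ b₂ ⊗ ξ ⊗ ξ ⊕ u ⊗ u ⊗ u ⊗ u ⊗ b₄ ⊗ ξ ⊕ u ⊗ u ⊗ u ⊗ u ⊗ u ⊗ u ⊗ b₆) ≋
         u ⊗ u ⊗ u ⊗ (u ⊗ u ⊗ u) ⊗ ((y ⊗ y ⊕ b₁ ⊗ x ⊗ y ⊕ b₃ ⊗ y) ⊖ (x ⊗ x ⊗ x ⊕ b₂ ⊗ x ⊗ x ⊕ b₄ ⊗ x ⊕ b₆))) refl
    rewrite-coefficients : ∀ {x₁ x₂ x₃ x₄ x₆ y₁ y₂ y₃ y₄ y₆} → x₁ ≡ y₁ × x₂ ≡ y₂ × x₃ ≡ y₃ × x₄ ≡ y₄ × x₆ ≡ y₆ →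
      (η * η + y₁ * ξ * η + y₃ * η) - (ξ * ξ * ξ + y₂ * ξ * ξ + y₄ * ξ + y₆) ≡
      (η * η + x₁ * ξ * η + x₃ * η) - (ξ * ξ * ξ + x₂ * ξ * ξ + x₄ * ξ + x₆)
    rewrite-coefficients (refl , refl , refl , refl , refl) = refl
    difference : _ ≡ u * u * u * (u * u * u) * ((y * y + a1 F * x * y + a3 F * y) - (x * x * x + a2 F * x * x + a4 F * x + a6 F))
    difference = trans (shift ξ η r s t (a1 E) (a2 E) (a3 E) (a4 E) (a6 E))
      (trans (rewrite-coefficients scaled-coefficients) (homogeneous u (a1 F) (a2 F) (a3 F) (a4 F) (a6 F) x y))

  φ-onCurve : ∀ P → OnCurve E P → OnCurve F (φ P)
  φ-onCurve P h = ψ-onCurve (φ P) (subst (OnCurve E) (sym (ψ∘φ P)) h)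

  φ-injective : ∀ {P Q} → φ P ≡ φ Q → P ≡ Q
  φ-injective {P} {Q} h = trans (sym (ψ∘φ P)) (trans (cong ψ h) (ψ∘φ Q))

  φ-embeds : ∀ T → Embeds T E → Embeds T F
  φ-embeds T (f , on , hom , inj) =
    φ ∘ f , (λ g → φ-onCurve (f g) (on g)) , (λ g h → trans (cong φ (hom g h)) (φ-add (f g) (f h))) , inj ∘ φ-injective

-- The duplication formula on abscissae

b₂ b₄ b₆ b₈ : WModel ℚ → ℚ
b₂ (wm a₁ a₂ a₃ a₄ a₆) = a₁ * a₁ + q 4 * a₂
b₄ (wm a₁ a₂ a₃ a₄ a₆) = q 2 * a₄ + a₁ * a₃
b₆ (wm a₁ a₂ a₃ a₄ a₆) = a₃ * a₃ + q 4 * a₆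
b₈ (wm a₁ a₂ a₃ a₄ a₆) = a₁ * a₁ * a₆ + q 4 * a₂ * a₆ - a₁ * a₃ * a₄ + a₂ * a₃ * a₃ - a₄ * a₄

-- x(2P) = φ₂(x)/ψ₂²(x).
ψ₂² φ₂ : WModel ℚ → ℚ → ℚ
ψ₂² E x = q 4 * x * x * x + b₂ E * x * x + q 2 * b₄ E * x + b₆ E
φ₂ E x  = x * x * x * x - b₄ E * x * x - q 2 * b₆ E * x - b₈ E

-- This is the Weierstrass equation with the square in `y` completed.
den²≡ψ₂² : ∀ E x y → OnCurve E (aff x y) → tangent-den E x y * tangent-den E x y ≡ ψ₂² E x
den²≡ψ₂² (wm a₁ a₂ a₃ a₄ a₆) x y h = lin₁ (q 4) h (identity a₁ a₂ a₃ a₄ a₆ x y)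
  where
  identity = solve 7 (λ a₁ a₂ a₃ a₄ a₆ x y →
    (Κ (q 2) ⊗ y ⊕ a₁ ⊗ x ⊕ a₃) ⊗ (Κ (q 2) ⊗ y ⊕ a₁ ⊗ x ⊕ a₃) ⊖
    (Κ (q 4) ⊗ x ⊗ x ⊗ x ⊕ (a₁ ⊗ a₁ ⊕ Κ (q 4) ⊗ a₂) ⊗ x ⊗ x ⊕ Κ (q 2) ⊗ (Κ (q 2) ⊗ a₄ ⊕ a₁ ⊗ a₃) ⊗ x ⊕ (a₃ ⊗ a₃ ⊕ Κ (q 4) ⊗ a₆)) ≋
    Κ (q 4) ⊗ (y ⊗ y ⊕ a₁ ⊗ x ⊗ y ⊕ a₃ ⊗ y ⊖ (x ⊗ x ⊗ x ⊕ a₂ ⊗ x ⊗ x ⊕ a₄ ⊗ x ⊕ a₆))) refl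

third-x : WModel ℚ → ℚ → ℚ → ℚ → ℚ
third-x E x₁ x₂ l = l * l + a1 E * l - a2 E - x₁ - x₂

third-y : WModel ℚ → ℚ → ℚ → ℚ → ℚ → ℚ
third-y E x₁ y₁ x₃ l = (- ((l + a1 E) * x₃)) - (y₁ - l * x₁) - a3 E

duplicate : ∀ E x y l → OnCurve E (aff x y) → l * tangent-den E x y ≡ tangent-num E x y →
            third-x E x x l * ψ₂² E x ≡ φ₂ E x
duplicate E@(wm a₁ a₂ a₃ a₄ a₆) x y l h slope =
  trans (cong (third-x E x x l *_) (sym (den²≡ψ₂² E x y h)))
  (lin₂ (l * (q 2 * y + a₁ * x + a₃) + (q 3 * x * x + q 2 * a₂ * x + a₄ - a₁ * y) + a₁ * (q 2 * y + a₁ * x + a₃))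
        (- (a₁ * a₁ + q 4 * a₂ + q 8 * x)) slope h (identity a₁ a₂ a₃ a₄ a₆ x y l))
  where
  identity = solve 8 (λ a₁ a₂ a₃ a₄ a₆ x y l →
    let den = Κ (q 2) ⊗ y ⊕ a₁ ⊗ x ⊕ a₃
        num = Κ (q 3) ⊗ x ⊗ x ⊕ Κ (q 2) ⊗ a₂ ⊗ x ⊕ a₄ ⊖ a₁ ⊗ y
        B₄ = Κ (q 2) ⊗ a₄ ⊕ a₁ ⊗ a₃
        B₆ = a₃ ⊗ a₃ ⊕ Κ (q 4) ⊗ a₆
        B₈ = a₁ ⊗ a₁ ⊗ a₆ ⊕ Κ (q 4) ⊗ a₂ ⊗ a₆ ⊖ a₁ ⊗ a₃ ⊗ a₄ ⊕ a₂ ⊗ a₃ ⊗ a₃ ⊖ a₄ ⊗ a₄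
    in (l ⊗ l ⊕ a₁ ⊗ l ⊖ a₂ ⊖ x ⊖ x) ⊗ (den ⊗ den) ⊖ (x ⊗ x ⊗ x ⊗ x ⊖ B₄ ⊗ x ⊗ x ⊖ Κ (q 2) ⊗ B₆ ⊗ x ⊖ B₈) ≋
       (l ⊗ den ⊕ num ⊕ a₁ ⊗ den) ⊗ (l ⊗ den ⊖ num) ⊕
       (⊝ (a₁ ⊗ a₁ ⊕ Κ (q 4) ⊗ a₂ ⊕ Κ (q 8) ⊗ x)) ⊗ (y ⊗ y ⊕ a₁ ⊗ x ⊗ y ⊕ a₃ ⊗ y ⊖ (x ⊗ x ⊗ x ⊕ a₂ ⊗ x ⊗ x ⊕ a₄ ⊗ x ⊕ a₆))) refl

-- Elements of given order and the coordinates of their images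

module Multiples (T : TorsionGroup) where

  e : Carrier T
  e = zero , zero

  infixl 6 _⊞_
  _⊞_ : Carrier T → Carrier T → Carrier T
  _⊞_ = addC T

  infix 8 2×_ 3×_ 4×_ 5×_
  2×_ 3×_ 4×_ 5×_ : Carrier T → Carrier T
  2× g = g ⊞ g
  3× g = g ⊞ 2× g
  4× g = g ⊞ 3× g
  5× g = g ⊞ 4× g

  -- These records collect the relations among multiples that the geometric arguments consume.
  -- Differently bracketed multiples, such as `4× g` and `2× g ⊞ 2× g`, are related by fields; for a
  -- concrete element every field holds by computation.
  record Order₂ (g : Carrier T) : Set where
    constructor order₂
    field
      g≢e  : g ≢ e
      2g≡e : 2× g ≡ e

  record Order₃ (g : Carrier T) : Set where
    constructor order₃
    field
      g≢e  : g ≢ e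
      2g≢e : 2× g ≢ e
      3g≡e : 3× g ≡ e

  record Order₄ (g : Carrier T) : Set where
    constructor order₄
    field
      g≢e  : g ≢ e
      2g≢e : 2× g ≢ e
      4g≡e : 2× g ⊞ 2× g ≡ e

  record Order₅ (g : Carrier T) : Set where
    constructor order₅
    field
      g≢e     : g ≢ e
      2g≢e    : 2× g ≢ e
      3g≢e    : 3× g ≢ e
      4g≢e    : 2× g ⊞ 2× g ≢ e
      g≢2g    : g ≢ 2× g
      4g⊞g≡e  : 2× g ⊞ 2× g ⊞ g ≡ e
      2g⊞3g≡e : 2× g ⊞ 3× g ≡ e

  record Order₇ (g : Carrier T) : Set where
    constructor order₇
    field
      g≢e      : g ≢ e
      2g≢e     : 2× g ≢ e
      3g≢e     : 3× g ≢ e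
      4g≢e     : 4× g ≢ e
      g≢2g     : g ≢ 2× g
      g≢3g     : g ≢ 3× g
      2g⊞2g≡4g : 2× g ⊞ 2× g ≡ 4× g
      4g⊞4g≡g  : 4× g ⊞ 4× g ≡ g
      3g⊞4g≡e  : 3× g ⊞ 4× g ≡ e

  record Order₈ (g : Carrier T) : Set where
    constructor order₈
    field
      g≢e      : g ≢ e
      2g≢e     : 2× g ≢ e
      3g≢e     : 3× g ≢ e
      4g≢e     : 4× g ≢ e
      6g≢e     : 3× g ⊞ 3× g ≢ e
      g≢2g     : g ≢ 2× g
      g≢3g     : g ≢ 3× g
      2g⊞2g≡4g : 2× g ⊞ 2× g ≡ 4× g
      4g⊞4g≡e  : 4× g ⊞ 4× g ≡ e
      2g⊞6g≡e  : 2× g ⊞ (3× g ⊞ 3× g) ≡ e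

  record Order₉ (g : Carrier T) : Set where
    constructor order₉
    field
      g≢e      : g ≢ e
      2g≢e     : 2× g ≢ e
      3g≢e     : 3× g ≢ e
      4g≢e     : 4× g ≢ e
      5g≢e     : 5× g ≢ e
      6g≢e     : 3× g ⊞ 3× g ≢ e
      8g≢e     : 4× g ⊞ 4× g ≢ e
      g≢2g     : g ≢ 2× g
      g≢3g     : g ≢ 3× g
      g≢4g     : g ≢ 4× g
      2g⊞2g≡4g : 2× g ⊞ 2× g ≡ 4× g
      8g⊞g≡e   : 4× g ⊞ 4× g ⊞ g ≡ e
      6g⊞3g≡e  : 3× g ⊞ 3× g ⊞ 3× g ≡ e
      4g⊞5g≡e  : 4× g ⊞ 5× g ≡ e

  -- Neither equal nor opposite: for affine points this means distinct abscissae.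
  record Apart (g h : Carrier T) : Set where
    constructor apart
    field
      distinct : g ≢ h
      sum≢e    : g ⊞ h ≢ e

module Coordinates {T : TorsionGroup} {E : WModel ℚ} (embedding : Embeds T E) where

  private
    f   = proj₁ embedding
    on  = proj₁ (proj₂ embedding)
    hom = proj₁ (proj₂ (proj₂ embedding))
    inj = proj₂ (proj₂ (proj₂ embedding))

  open Multiples T public

  -- The value at `O` is a default; coordinates carry meaning for elements other than `e`.
  point-x point-y : Point → ℚ
  point-x O         = 0ℚ
  point-x (aff x y) = x
  point-y O         = 0ℚ
  point-y (aff x y) = y

  X Y : Carrier T → ℚ
  X g = point-x (f g)
  Y g = point-y (f g)

  -- If the tangent construction returned the same affine point, the formula for `y` would read
  -- `y = - y - a₁x - a₃`, so the tangent denominator would vanish.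
  idempotent⇒O : ∀ P → P ≡ addPt E P P → P ≡ O
  idempotent⇒O O _ = refl
  idempotent⇒O (aff x y) h = by-sum (sum E x y x y) h
    where
    flip = solve 5 (λ a₁ a₃ x y l → (Κ (q 2) ⊗ y ⊕ a₁ ⊗ x ⊕ a₃) ⊖ Κ 0ℚ ≋ Κ 1ℚ ⊗ (y ⊖ ((⊝ ((l ⊕ a₁) ⊗ x)) ⊖ (y ⊖ l ⊗ x) ⊖ a₃))) refl
    coordinates : ∀ {x₃ y₃} → aff x y ≡ aff x₃ y₃ → x ≡ x₃ × y ≡ y₃
    coordinates refl = refl , refl
    fixed : ∀ l {x₃} → x ≡ x₃ → y ≡ (- ((l + a1 E) * x₃)) - (y - l * x) - a3 E → tangent-den E x y ≡ 0ℚ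
    fixed l refl h = lin₁ 1ℚ h (flip (a1 E) (a3 E) x y l)
    by-sum : ∀ {R} → Sum E x y x y R → aff x y ≡ R → aff x y ≡ O
    by-sum (chord _ d _) _       = ⊥-elim (d (+-inverseʳ x))
    by-sum (tangent l _ _ t _) h = ⊥-elim (t (fixed l (proj₁ (coordinates h)) (proj₂ (coordinates h))))
    by-sum (zero _ _) h          = h
    by-sum (junk _ _ _) h        = h

  f-e : f e ≡ O
  f-e = idempotent⇒O (f e) (hom e e)

  module _ {g : Carrier T} (g≢e : g ≢ e) where

    affine : f g ≡ aff (X g) (Y g)
    affine = by-point (f g) refl
      where
      by-point : ∀ P → f g ≡ P → f g ≡ aff (X g) (Y g)
      by-point O h         = ⊥-elim (g≢e (inj (trans h (sym f-e))))
      by-point (aff x y) h = subst (λ P → P ≡ aff (point-x P) (point-y P)) (sym h) refl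

    on-curve : OnCurve E (aff (X g) (Y g))
    on-curve = subst (OnCurve E) affine (on g)

  add : ∀ {g h} → g ≢ e → h ≢ e → Sum E (X g) (Y g) (X h) (Y h) (f (g ⊞ h))
  add {g} {h} g≢e h≢e =
    subst (Sum E (X g) (Y g) (X h) (Y h))
      (trans (cong₂ (addPt E) (sym (affine g≢e)) (sym (affine h≢e))) (sym (hom g h)))
      (sum E (X g) (Y g) (X h) (Y h))

  -- The ordinates over one abscissa are roots of the same quadratic; the two equations are
  -- subtracted.
  on-curve-difference : ∀ {x y y′} → OnCurve E (aff x y) → OnCurve E (aff x y′) → (y′ - y) * opposite E x y y′ ≡ 0ℚ
  on-curve-difference {x} {y} {y′} h h′ =
    lin₂ (- 1ℚ) 1ℚ h h′ (identity (a1 E) (a3 E) x y y′ (x * x * x + a2 E * x * x + a4 E * x + a6 E))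
    where
    identity = solve 6 (λ a₁ a₃ x y y′ c → (y′ ⊖ y) ⊗ (y ⊕ y′ ⊕ a₁ ⊗ x ⊕ a₃) ⊖ Κ 0ℚ ≋
               ⊝ Κ 1ℚ ⊗ (y ⊗ y ⊕ a₁ ⊗ x ⊗ y ⊕ a₃ ⊗ y ⊖ c) ⊕ Κ 1ℚ ⊗ (y′ ⊗ y′ ⊕ a₁ ⊗ x ⊗ y′ ⊕ a₃ ⊗ y′ ⊖ c)) refl

  X-injective : ∀ {g h} → g ≢ e → h ≢ e → X g ≡ X h → g ≡ h ⊎ g ⊞ h ≡ e
  X-injective {g} {h} g≢e h≢e eq with (Y h - Y g) ≟ 0ℚ
  ... | yes Y≡ = inj₁ (inj (trans (affine g≢e) (trans (cong-aff eq (sym (x-y≡0⇒x≡y Y≡))) (sym (affine h≢e)))))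
  ... | no Y≢  = inj₂ (inj (trans (trans (hom g h) (trans (cong₂ (addPt E) (affine g≢e) (affine h≢e))
                        (sum-unique E (X g) (Y g) (X h) (Y h) (zero (x≡y⇒x-y≡0 (sym eq)) opposite≡0)))) (sym f-e)))
    where
    opposite≡0 : opposite E (X h) (Y g) (Y h) ≡ 0ℚ
    opposite≡0 = zero-product (on-curve-difference {X h} {Y g} {Y h} (subst (λ x → OnCurve E (aff x (Y g))) eq (on-curve g≢e)) (on-curve h≢e)) Y≢

  X-distinct : ∀ {g h} → g ≢ e → h ≢ e → Apart g h → X g ≢ X h
  X-distinct {g} {h} g≢e h≢e (apart g≢h g⊞h≢e) eq = by-cases (X-injective g≢e h≢e eq)
    where
    by-cases : g ≡ h ⊎ g ⊞ h ≡ e → ⊥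
    by-cases (inj₁ g≡h)   = g≢h g≡h
    by-cases (inj₂ g⊞h≡e) = g⊞h≢e g⊞h≡e

  record Line (g h : Carrier T) : Set where
    constructor line
    field
      slope : ℚ
      sum-x : X (g ⊞ h) ≡ third-x E (X g) (X h) slope
      sum-y : Y (g ⊞ h) ≡ third-y E (X g) (Y g) (X (g ⊞ h)) slope

  private
    read : ∀ {g h l} → f (g ⊞ h) ≡ third E (X g) (Y g) (X h) l → Line g h
    read {g} {h} {l} eq = line l (cong point-x eq)
      (trans (cong point-y eq) (cong (λ x → third-y E (X g) (Y g) x l) (sym (cong point-x eq))))

  module _ {g h : Carrier T} (g≢e : g ≢ e) (h≢e : h ≢ e) where

    chord-line : X h ≢ X g → Σ (Line g h) λ L → Line.slope L * (X h - X g) ≡ Y h - Y g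
    chord-line X≢ = from (add g≢e h≢e) refl
      where
      from : ∀ {R} → Sum E (X g) (Y g) (X h) (Y h) R → f (g ⊞ h) ≡ R → Σ (Line g h) λ L → Line.slope L * (X h - X g) ≡ Y h - Y g
      from (chord l _ s) eq       = read {g} {h} {l} eq , s
      from (tangent _ d _ _ _) eq = ⊥-elim (X≢ (x-y≡0⇒x≡y d))
      from (zero d _) eq          = ⊥-elim (X≢ (x-y≡0⇒x≡y d))
      from (junk d _ _) eq        = ⊥-elim (X≢ (x-y≡0⇒x≡y d))

    opposites : g ⊞ h ≡ e → X h ≡ X g × opposite E (X h) (Y g) (Y h) ≡ 0ℚ
    opposites g⊞h≡e = from (add g≢e h≢e) (trans (cong f g⊞h≡e) f-e)
      where
      from : ∀ {R} → Sum E (X g) (Y g) (X h) (Y h) R → R ≡ O → X h ≡ X g × opposite E (X h) (Y g) (Y h) ≡ 0ℚ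
      from (zero d o) _   = x-y≡0⇒x≡y d , o
      -- The ordinates lie over one abscissa. If they agree, `opposite` is the tangent denominator,
      -- which is zero in this case; if not, `on-curve-difference` makes it vanish.
      from (junk d o t) _ = ⊥-elim (o (opposite≡0 (Y h - Y g ≟ 0ℚ)))
        where
        Xh≡Xg : X h ≡ X g
        Xh≡Xg = x-y≡0⇒x≡y d
        shift = solve 5 (λ a₁ a₃ x y y′ → y ⊕ y′ ⊕ a₁ ⊗ x ⊕ a₃ ⊖ Κ 0ℚ ≋ Κ 1ℚ ⊗ (Κ (q 2) ⊗ y ⊕ a₁ ⊗ x ⊕ a₃ ⊖ Κ 0ℚ) ⊕ Κ 1ℚ ⊗ (y′ ⊖ y ⊖ Κ 0ℚ)) refl
        opposite≡0 : Dec (Y h - Y g ≡ 0ℚ) → opposite E (X h) (Y g) (Y h) ≡ 0ℚ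
        opposite≡0 (yes Y≡) = trans (cong (λ x → opposite E x (Y g) (Y h)) Xh≡Xg) (lin₂ 1ℚ 1ℚ t Y≡ (shift (a1 E) (a3 E) (X g) (Y g) (Y h)))
        opposite≡0 (no Y≢)  = zero-product (on-curve-difference {X h} {Y g} {Y h} (subst (λ x → OnCurve E (aff x (Y g))) (sym Xh≡Xg) (on-curve g≢e)) (on-curve h≢e)) Y≢

  module _ {g : Carrier T} (g≢e : g ≢ e) where

    tangent-line : g ⊞ g ≢ e → tangent-den E (X g) (Y g) ≢ 0ℚ ×
                   Σ (Line g g) λ L → Line.slope L * tangent-den E (X g) (Y g) ≡ tangent-num E (X g) (Y g)
    tangent-line 2g≢e = from (add g≢e g≢e) refl
      where
      from : ∀ {R} → Sum E (X g) (Y g) (X g) (Y g) R → f (g ⊞ g) ≡ R → tangent-den E (X g) (Y g) ≢ 0ℚ ×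
             Σ (Line g g) λ L → Line.slope L * tangent-den E (X g) (Y g) ≡ tangent-num E (X g) (Y g)
      from (chord _ d _) eq       = ⊥-elim (d (+-inverseʳ (X g)))
      from (tangent l _ _ t s) eq = t , read {g} {g} {l} eq , s
      from (zero _ _) eq          = ⊥-elim (2g≢e (inj (trans eq (sym f-e))))
      from (junk _ _ _) eq        = ⊥-elim (2g≢e (inj (trans eq (sym f-e))))

    two-torsion : g ⊞ g ≡ e → tangent-den E (X g) (Y g) ≡ 0ℚ
    two-torsion 2g≡e = lin₁ 1ℚ (proj₂ (opposites g≢e g≢e 2g≡e)) (double (a1 E) (a3 E) (X g) (Y g))
      where
      double = solve 4 (λ a₁ a₃ x y → Κ (q 2) ⊗ y ⊕ a₁ ⊗ x ⊕ a₃ ⊖ Κ 0ℚ ≋ Κ 1ℚ ⊗ (y ⊕ y ⊕ a₁ ⊗ x ⊕ a₃ ⊖ Κ 0ℚ)) refl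

    ψ₂²-root : g ⊞ g ≡ e → ψ₂² E (X g) ≡ 0ℚ
    ψ₂²-root 2g≡e = trans (sym (den²≡ψ₂² E (X g) (Y g) (on-curve g≢e)))
      (trans (cong₂ _*_ (two-torsion 2g≡e) (two-torsion 2g≡e)) refl)

    duplication : g ⊞ g ≢ e → X (g ⊞ g) * ψ₂² E (X g) ≡ φ₂ E (X g)
    duplication 2g≢e = from (tangent-line 2g≢e)
      where
      from : tangent-den E (X g) (Y g) ≢ 0ℚ × (Σ (Line g g) λ L → Line.slope L * tangent-den E (X g) (Y g) ≡ tangent-num E (X g) (Y g)) →
             X (g ⊞ g) * ψ₂² E (X g) ≡ φ₂ E (X g)
      from (_ , line l sx _ , s) = trans (cong (_* ψ₂² E (X g)) sx) (duplicate E (X g) (Y g) l (on-curve g≢e) s)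

-- Minimality

-- Four times the discriminant, with b₈ eliminated by `4b₈ = b₂b₆ - b₄²`. The quantities b₂, b₄, b₆
-- transform without `s` and `t`, which keeps the transformation identity small.
D : ℚ → ℚ → ℚ → ℚ
D B₂ B₄ B₆ = q 36 * B₂ * B₄ * B₆ - B₂ * B₂ * (B₂ * B₆ - B₄ * B₄) - q 32 * B₄ * B₄ * B₄ - q 108 * B₆ * B₆

4disc≡D : ∀ E → q 4 * discQ E ≡ D (b₂ E) (b₄ E) (b₆ E)
4disc≡D (wm a₁ a₂ a₃ a₄ a₆) = identity a₁ a₂ a₃ a₄ a₆
  where
  identity = solve 5 (λ a₁ a₂ a₃ a₄ a₆ →
    let B₂ = a₁ ⊗ a₁ ⊕ Κ (q 4) ⊗ a₂
        B₄ = Κ (q 2) ⊗ a₄ ⊕ a₁ ⊗ a₃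
        B₆ = a₃ ⊗ a₃ ⊕ Κ (q 4) ⊗ a₆
        B₈ = a₁ ⊗ a₁ ⊗ a₆ ⊕ Κ (q 4) ⊗ a₂ ⊗ a₆ ⊖ a₁ ⊗ a₃ ⊗ a₄ ⊕ a₂ ⊗ a₃ ⊗ a₃ ⊖ a₄ ⊗ a₄
    in Κ (q 4) ⊗ ((⊝ (B₂ ⊗ B₂ ⊗ B₈)) ⊖ Κ (q 8) ⊗ B₄ ⊗ B₄ ⊗ B₄ ⊖ Κ (q 27) ⊗ B₆ ⊗ B₆ ⊕ Κ (q 9) ⊗ B₂ ⊗ B₄ ⊗ B₆) ≋
       Κ (q 36) ⊗ B₂ ⊗ B₄ ⊗ B₆ ⊖ B₂ ⊗ B₂ ⊗ (B₂ ⊗ B₆ ⊖ B₄ ⊗ B₄) ⊖ Κ (q 32) ⊗ B₄ ⊗ B₄ ⊗ B₄ ⊖ Κ (q 108) ⊗ B₆ ⊗ B₆) refl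

D-change : ∀ u r B₂ B₄ B₆ →
  let C₂ = u * u * B₂ - q 12 * r
      C₄ = u * u * u * u * B₄ - r * C₂ - q 6 * r * r
      C₆ = u * u * u * u * u * u * B₆ - q 2 * r * C₄ - r * r * C₂ - q 4 * r * r * r
  in D C₂ C₄ C₆ ≡ (u * u * u * (u * u * u)) * (u * u * u * (u * u * u)) * D B₂ B₄ B₆
D-change = identity
  where
  identity = solve 5 (λ u r B₂ B₄ B₆ →
    let C₂ = u ⊗ u ⊗ B₂ ⊖ Κ (q 12) ⊗ r
        C₄ = u ⊗ u ⊗ u ⊗ u ⊗ B₄ ⊖ r ⊗ C₂ ⊖ Κ (q 6) ⊗ r ⊗ r
        C₆ = u ⊗ u ⊗ u ⊗ u ⊗ u ⊗ u ⊗ B₆ ⊖ Κ (q 2) ⊗ r ⊗ C₄ ⊖ r ⊗ r ⊗ C₂ ⊖ Κ (q 4) ⊗ r ⊗ r ⊗ r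
    in Κ (q 36) ⊗ C₂ ⊗ C₄ ⊗ C₆ ⊖ C₂ ⊗ C₂ ⊗ (C₂ ⊗ C₆ ⊖ C₄ ⊗ C₄) ⊖ Κ (q 32) ⊗ C₄ ⊗ C₄ ⊗ C₄ ⊖ Κ (q 108) ⊗ C₆ ⊗ C₆ ≋
       (u ⊗ u ⊗ u ⊗ (u ⊗ u ⊗ u)) ⊗ (u ⊗ u ⊗ u ⊗ (u ⊗ u ⊗ u)) ⊗
       (Κ (q 36) ⊗ B₂ ⊗ B₄ ⊗ B₆ ⊖ B₂ ⊗ B₂ ⊗ (B₂ ⊗ B₆ ⊖ B₄ ⊗ B₄) ⊖ Κ (q 32) ⊗ B₄ ⊗ B₄ ⊗ B₄ ⊖ Κ (q 108) ⊗ B₆ ⊗ B₆)) refl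

disc-change : ∀ u r s t F → discQ (change u r s t F) ≡ (u * u * u * (u * u * u)) * (u * u * u * (u * u * u)) * discQ F
disc-change u r s t F@(wm c₁ c₂ c₃ c₄ c₆) = cancel {q 4} (λ ())
  (trans (4disc≡D E)
  (trans (D-cong (β₂ u r s c₁ c₂) (β₄ u r s t c₁ c₂ c₃ c₄) (β₆ u r s t c₁ c₂ c₃ c₄ c₆))
  (trans (D-change u r (b₂ F) (b₄ F) (b₆ F))
  (trans (cong ((u * u * u * (u * u * u)) * (u * u * u * (u * u * u)) *_) (sym (4disc≡D F)))
  (pull ((u * u * u * (u * u * u)) * (u * u * u * (u * u * u))) (discQ F))))))
  where
  E = change u r s t F
  D-cong : ∀ {x y z x′ y′ z′} → x ≡ x′ → y ≡ y′ → z ≡ z′ → D x y z ≡ D x′ y′ z′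
  D-cong refl refl refl = refl
  pull = solve 2 (λ k d → k ⊗ (Κ (q 4) ⊗ d) ≋ Κ (q 4) ⊗ (k ⊗ d)) refl
  β₂ = solve 5 (λ u r s c₁ c₂ →
    let a₁ = u ⊗ c₁ ⊖ Κ (q 2) ⊗ s
        a₂ = u ⊗ u ⊗ c₂ ⊕ s ⊗ a₁ ⊖ Κ (q 3) ⊗ r ⊕ s ⊗ s
    in a₁ ⊗ a₁ ⊕ Κ (q 4) ⊗ a₂ ≋ u ⊗ u ⊗ (c₁ ⊗ c₁ ⊕ Κ (q 4) ⊗ c₂) ⊖ Κ (q 12) ⊗ r) refl
  β₄ = solve 8 (λ u r s t c₁ c₂ c₃ c₄ →
    let a₁ = u ⊗ c₁ ⊖ Κ (q 2) ⊗ s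
        a₂ = u ⊗ u ⊗ c₂ ⊕ s ⊗ a₁ ⊖ Κ (q 3) ⊗ r ⊕ s ⊗ s
        a₃ = u ⊗ u ⊗ u ⊗ c₃ ⊖ r ⊗ a₁ ⊖ Κ (q 2) ⊗ t
        a₄ = u ⊗ u ⊗ u ⊗ u ⊗ c₄ ⊕ s ⊗ a₃ ⊖ Κ (q 2) ⊗ r ⊗ a₂ ⊕ (t ⊕ r ⊗ s) ⊗ a₁ ⊖ Κ (q 3) ⊗ r ⊗ r ⊕ Κ (q 2) ⊗ s ⊗ t
    in Κ (q 2) ⊗ a₄ ⊕ a₁ ⊗ a₃ ≋
       u ⊗ u ⊗ u ⊗ u ⊗ (Κ (q 2) ⊗ c₄ ⊕ c₁ ⊗ c₃) ⊖ r ⊗ (u ⊗ u ⊗ (c₁ ⊗ c₁ ⊕ Κ (q 4) ⊗ c₂) ⊖ Κ (q 12) ⊗ r) ⊖ Κ (q 6) ⊗ r ⊗ r) refl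
  β₆ = solve 9 (λ u r s t c₁ c₂ c₃ c₄ c₆ →
    let a₁ = u ⊗ c₁ ⊖ Κ (q 2) ⊗ s
        a₂ = u ⊗ u ⊗ c₂ ⊕ s ⊗ a₁ ⊖ Κ (q 3) ⊗ r ⊕ s ⊗ s
        a₃ = u ⊗ u ⊗ u ⊗ c₃ ⊖ r ⊗ a₁ ⊖ Κ (q 2) ⊗ t
        a₄ = u ⊗ u ⊗ u ⊗ u ⊗ c₄ ⊕ s ⊗ a₃ ⊖ Κ (q 2) ⊗ r ⊗ a₂ ⊕ (t ⊕ r ⊗ s) ⊗ a₁ ⊖ Κ (q 3) ⊗ r ⊗ r ⊕ Κ (q 2) ⊗ s ⊗ t
        a₆ = u ⊗ u ⊗ u ⊗ u ⊗ u ⊗ u ⊗ c₆ ⊖ r ⊗ a₄ ⊖ r ⊗ r ⊗ a₂ ⊖ r ⊗ r ⊗ r ⊕ t ⊗ a₃ ⊕ t ⊗ t ⊕ r ⊗ t ⊗ a₁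
        C₂ = u ⊗ u ⊗ (c₁ ⊗ c₁ ⊕ Κ (q 4) ⊗ c₂) ⊖ Κ (q 12) ⊗ r
        C₄ = u ⊗ u ⊗ u ⊗ u ⊗ (Κ (q 2) ⊗ c₄ ⊕ c₁ ⊗ c₃) ⊖ r ⊗ C₂ ⊖ Κ (q 6) ⊗ r ⊗ r
    in a₃ ⊗ a₃ ⊕ Κ (q 4) ⊗ a₆ ≋ u ⊗ u ⊗ u ⊗ u ⊗ u ⊗ u ⊗ (c₃ ⊗ c₃ ⊕ Κ (q 4) ⊗ c₆) ⊖ Κ (q 2) ⊗ r ⊗ C₄ ⊖ r ⊗ r ⊗ C₂ ⊖ Κ (q 4) ⊗ r ⊗ r ⊗ r) refl

-- `discZ` and `discQ` are the two readings of this polynomial, so `ι-eval` identifies them.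
disc-expr : Expr 5
disc-expr = (:- (B₂ :* B₂ :* B₈)) :- con (+ 8) :* B₄ :* B₄ :* B₄ :- con (+ 27) :* B₆ :* B₆ :+ con (+ 9) :* B₂ :* B₄ :* B₆
  where
  x₁ = var (# 0)
  x₂ = var (# 1)
  x₃ = var (# 2)
  x₄ = var (# 3)
  x₆ = var (# 4)
  B₂ = x₁ :* x₁ :+ con (+ 4) :* x₂
  B₄ = con (+ 2) :* x₄ :+ x₁ :* x₃
  B₆ = x₃ :* x₃ :+ con (+ 4) :* x₆
  B₈ = x₁ :* x₁ :* x₆ :+ con (+ 4) :* x₂ :* x₆ :- x₁ :* x₃ :* x₄ :+ x₂ :* x₃ :* x₃ :- x₄ :* x₄

ι-disc : ∀ M → ι (discZ M) ≡ discQ (toQ M)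
ι-disc (wm a₁ a₂ a₃ a₄ a₆) = ι-eval disc-expr (a₁ ∷ᵛ a₂ ∷ᵛ a₃ ∷ᵛ a₄ ∷ᵛ a₆ ∷ᵛ []ᵛ)

-- The coefficients after x = x′ + r, y = y′ + s x′ + t, in the variables a₁, a₂, a₃, a₄, a₆, r, s, t.
module ShiftedCoefficients where
  private
    x₁ x₂ x₃ x₄ x₆ r s t : Expr 8
    x₁ = var (# 0)
    x₂ = var (# 1)
    x₃ = var (# 2)
    x₄ = var (# 3)
    x₆ = var (# 4)
    r  = var (# 5)
    s  = var (# 6)
    t  = var (# 7)
  c₁ c₂ c₃ c₄ c₆ : Expr 8
  c₁ = x₁ :+ con (+ 2) :* s
  c₂ = x₂ :- s :* x₁ :+ con (+ 3) :* r :- s :* s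
  c₃ = x₃ :+ r :* x₁ :+ con (+ 2) :* t
  c₄ = x₄ :- s :* x₃ :+ con (+ 2) :* r :* x₂ :- (t :+ r :* s) :* x₁ :+ con (+ 3) :* r :* r :- con (+ 2) :* s :* t
  c₆ = x₆ :+ r :* x₄ :+ r :* r :* x₂ :+ r :* r :* r :- t :* x₃ :- t :* t :- r :* t :* x₁

open ShiftedCoefficients

coefficients : ∀ {A : Set} → WModel A → A → A → A → Vec A 8
coefficients (wm a₁ a₂ a₃ a₄ a₆) r s t = a₁ ∷ᵛ a₂ ∷ᵛ a₃ ∷ᵛ a₄ ∷ᵛ a₆ ∷ᵛ r ∷ᵛ s ∷ᵛ t ∷ᵛ []ᵛ

module Minimality (p : ℕ) (p-prime : Prime p) where
  open Residues p p-prime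

  power : ℕ → ℚ
  power zero    = 1ℚ
  power (suc k) = π * power k

  ι-pᵏ : ∀ k → ι (pᵏ k) ≡ power k
  ι-pᵏ zero    = refl
  ι-pᵏ (suc k) = trans (ι-P-suc k) (cong (π *_) (ι-pᵏ k))

  π≢0 : π ≢ 0ℚ
  π≢0 h = ℕ.≢-nonZero⁻¹ p {{prime⇒nonZero p-prime}} (Zₚ.+-injective (ι-injective {P} {+ 0} h))

  module _ (M : WModel ℤ) (r s t : ℤ) where
    private cs = coefficients M r s t

    -- After the translation each coefficient of index i is divisible by pⁱ, so scaling with `u = p`
    -- keeps the model integral.
    Reducible : Set
    Reducible = pᵏ 1 ∣ eval c₁ cs × pᵏ 2 ∣ eval c₂ cs × pᵏ 3 ∣ eval c₃ cs × pᵏ 4 ∣ eval c₄ cs × pᵏ 6 ∣ eval c₆ cs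

    scaled-model : Reducible → WModel ℤ
    scaled-model (divides b₁ _ , divides b₂ _ , divides b₃ _ , divides b₄ _ , divides b₆ _) = wm b₁ b₂ b₃ b₄ b₆

  quotient-eq : ∀ {b z} k → z ≡ b Z.* pᵏ k → power k * ι b ≡ ι z
  quotient-eq {b} k refl = sym (trans (ι-* b (pᵏ k)) (trans (cong (ι b *_) (ι-pᵏ k)) (*-comm (ι b) (power k))))

  scaled-iso : ∀ M r s t (red : Reducible M r s t) → IsoQ (toQ M) (toQ (scaled-model M r s t red))
  scaled-iso M@(wm _ _ _ _ _) r s t (divides b₁ h₁ , divides b₂ h₂ , divides b₃ h₃ , divides b₄ h₄ , divides b₆ h₆) =
    π , ι r , ι s , ι t , π≢0 ,
    trans (k₁ π (ι b₁)) (trans (quotient-eq {b₁} 1 h₁) (ι-eval c₁ cs)) ,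
    trans (k₂ π (ι b₂)) (trans (quotient-eq {b₂} 2 h₂) (ι-eval c₂ cs)) ,
    trans (k₃ π (ι b₃)) (trans (quotient-eq {b₃} 3 h₃) (ι-eval c₃ cs)) ,
    trans (k₄ π (ι b₄)) (trans (quotient-eq {b₄} 4 h₄) (ι-eval c₄ cs)) ,
    trans (k₆ π (ι b₆)) (trans (quotient-eq {b₆} 6 h₆) (ι-eval c₆ cs))
    where
    cs = coefficients M r s t
    k₁ = solve 2 (λ π b → π ⊗ b ≋ π ⊗ Κ 1ℚ ⊗ b) refl
    k₂ = solve 2 (λ π b → π ⊗ π ⊗ b ≋ π ⊗ (π ⊗ Κ 1ℚ) ⊗ b) refl
    k₃ = solve 2 (λ π b → π ⊗ π ⊗ π ⊗ b ≋ π ⊗ (π ⊗ (π ⊗ Κ 1ℚ)) ⊗ b) refl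
    k₄ = solve 2 (λ π b → π ⊗ π ⊗ π ⊗ π ⊗ b ≋ π ⊗ (π ⊗ (π ⊗ (π ⊗ Κ 1ℚ))) ⊗ b) refl
    k₆ = solve 2 (λ π b → π ⊗ π ⊗ π ⊗ π ⊗ π ⊗ π ⊗ b ≋ π ⊗ (π ⊗ (π ⊗ (π ⊗ (π ⊗ (π ⊗ Κ 1ℚ))))) ⊗ b) refl

  scaled-disc : ∀ M r s t (red : Reducible M r s t) → discZ M ≡ pᵏ 12 Z.* discZ (scaled-model M r s t red)
  scaled-disc M r s t red = ι-injective (trans (ι-disc M) (trans (from (isoQ⇒change (toQ M) (toQ M′) (scaled-iso M r s t red)) refl refl) (sym (ι-* (pᵏ 12) (discZ M′)))))
    where
    M′ = scaled-model M r s t red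
    from : (c : ∃[ u ] ∃[ r ] ∃[ s ] ∃[ t ] u ≢ 0ℚ × toQ M ≡ change u r s t (toQ M′)) → proj₁ c ≡ π → discZ M′ ≡ discZ M′ →
           discQ (toQ M) ≡ ι (pᵏ 12) * ι (discZ M′)
    from (u , r , s , t , _ , eq) refl _ = trans (cong discQ eq) (trans (disc-change π r s t (toQ M′))
      (trans (cong₂ _*_ (assoc π) (sym (ι-disc M′))) (cong (_* ι (discZ M′)) (sym (ι-pᵏ 12)))))
      where
      assoc = solve 1 (λ π → (π ⊗ π ⊗ π ⊗ (π ⊗ π ⊗ π)) ⊗ (π ⊗ π ⊗ π ⊗ (π ⊗ π ⊗ π)) ≋
                    π ⊗ (π ⊗ (π ⊗ (π ⊗ (π ⊗ (π ⊗ (π ⊗ (π ⊗ (π ⊗ (π ⊗ (π ⊗ (π ⊗ Κ 1ℚ)))))))))))) refl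

  module _ {E : WModel ℚ} {M : WModel ℤ} (disc≢0 : discQ E ≢ 0ℚ) (minimal : IsGlobalMinimal E M) where

    -- Makes the division of the discriminant by p¹² a strict decrease.
    disc-M≢0 : discZ M ≢ + 0
    disc-M≢0 h = from (isoQ⇒change E (toQ M) (proj₁ minimal))
      where
      from : ∃[ u ] ∃[ r ] ∃[ s ] ∃[ t ] u ≢ 0ℚ × E ≡ change u r s t (toQ M) → ⊥
      from (u , r , s , t , _ , eq) = disc≢0 (trans (cong discQ eq) (trans (disc-change u r s t (toQ M))
        (trans (cong (k *_) (trans (sym (ι-disc M)) (cong ι h))) (*-zeroʳ k))))
        where
        k = (u * u * u * (u * u * u)) * (u * u * u * (u * u * u))

    -- The scaled model is again an integral model of `E`, with discriminant smaller by the factor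
    -- p¹².
    irreducible : ∀ r s t → ¬ Reducible M r s t
    irreducible r s t red = iso⇒⊥ (isoQ-trans {E} {toQ M} {toQ M′} (proj₁ minimal) (scaled-iso M r s t red))
      where
      M′ = scaled-model M r s t red
      iso⇒⊥ : ¬ IsoQ E (toQ M′)
      iso⇒⊥ iso = ℕₚ.<⇒≱ big (proj₂ minimal M′ iso)
        where
        disc-M′≢0 : Z.∣ discZ M′ ∣ ≢ 0
        disc-M′≢0 h = disc-M≢0 (trans (scaled-disc M r s t red) (trans (cong (pᵏ 12 Z.*_) (Zₚ.∣i∣≡0⇒i≡0 h)) (Zₚ.*-zeroʳ (pᵏ 12))))
        p>1 : 1 ℕ.< p ℕ.^ 12
        p>1 = ℕₚ.<-≤-trans (ℕ.nonTrivial⇒n>1 p {{prime⇒nonTrivial p-prime}}) (ℕₚ.m≤m*n p (p ℕ.^ 11) {{ℕₚ.m^n≢0 p 11 {{prime⇒nonZero p-prime}}}})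
        big : Z.∣ discZ M′ ∣ ℕ.< Z.∣ discZ M ∣
        big = subst (Z.∣ discZ M′ ∣ ℕ.<_) (sym (trans (cong Z.∣_∣ (scaled-disc M r s t red)) (Zₚ.abs-* (pᵏ 12) (discZ M′))))
          (subst (ℕ._< p ℕ.^ 12 ℕ.* Z.∣ discZ M′ ∣) (ℕₚ.*-identityˡ Z.∣ discZ M′ ∣)
            (ℕₚ.*-monoˡ-< Z.∣ discZ M′ ∣ {{ℕ.≢-nonZero disc-M′≢0}} p>1))

    -- Integers p-adically close to r, s, t give a model that is integral at every prime.
    minimal-at-p : ∀ {r s t} → Integral r → Integral s → Integral t →
      let xs = coefficients (toQ M) r s t in
      Div 1 (⟦ c₁ ⟧ xs) → Div 2 (⟦ c₂ ⟧ xs) → Div 3 (⟦ c₃ ⟧ xs) → Div 4 (⟦ c₄ ⟧ xs) → Div 6 (⟦ c₆ ⟧ xs) → ⊥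
    -- Six digits suffice, 6 being the largest exponent in `Reducible`.
    minimal-at-p {r} {s} {t} Ir Is It d₁ d₂ d₃ d₄ d₆ = from (approximate 6 Ir) (approximate 6 Is) (approximate 6 It)
      where
      from : ∃[ c ] Div 6 (r - ι c) → ∃[ c ] Div 6 (s - ι c) → ∃[ c ] Div 6 (t - ι c) → ⊥
      from (r₀ , dr) (s₀ , ds) (t₀ , dt) = irreducible r₀ s₀ t₀
        (transfer 1 c₁ tt d₁ , transfer 2 c₂ tt d₂ , transfer 3 c₃ tt d₃ , transfer 4 c₄ tt d₄ , transfer 6 c₆ tt d₆)
        where
        xs = coefficients (toQ M) r s t
        cs = coefficients M r₀ s₀ t₀
        I-xs : AllV Integral xs
        I-xs = ι-integral (a1 M) ∷ᴵ ι-integral (a2 M) ∷ᴵ ι-integral (a3 M) ∷ᴵ ι-integral (a4 M) ∷ᴵ ι-integral (a6 M) ∷ᴵ Ir ∷ᴵ Is ∷ᴵ It ∷ᴵ []ᴵ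
        close : ∀ i → Div 6 (lookup xs i - ι (lookup cs i))
        close zero                                                 = div-eq {x = ι (a1 M)} refl
        close (suc zero)                                           = div-eq {x = ι (a2 M)} refl
        close (suc (suc zero))                                     = div-eq {x = ι (a3 M)} refl
        close (suc (suc (suc zero)))                               = div-eq {x = ι (a4 M)} refl
        close (suc (suc (suc (suc zero))))                         = div-eq {x = ι (a6 M)} refl
        close (suc (suc (suc (suc (suc zero)))))                   = dr
        close (suc (suc (suc (suc (suc (suc zero))))))             = ds
        close (suc (suc (suc (suc (suc (suc (suc zero)))))))       = dt
        transfer : ∀ j (e : Expr 8) → T (j ℕ.≤ᵇ 6) → Div j (⟦ e ⟧ xs) → pᵏ j ∣ eval e cs
        transfer j e j≤6 d = div-ι (subst (Div j) (telescope (⟦ e ⟧ xs) (ι (eval e cs)))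
          (div-+ d (div-neg (div-≤ (ℕₚ.≤⇒≤′ (ℕₚ.≤ᵇ⇒≤ j 6 j≤6)) (⟦⟧-≈ 6 e {cs = cs} I-xs close)))))
          where
          telescope = solve 2 (λ x y → x ⊕ ⊝ (x ⊖ y) ≋ y) refl

-- Integrality of torsion points

module Integrality (p : ℕ) (p-prime : Prime p) where
  open Residues p p-prime

  ι-P-1 : ι (pᵏ 1) ≡ π
  ι-P-1 = trans (ι-P-suc 0) (*-identityʳ π)

  π-div : ∀ {x} → Integral x → Div 1 (π * x)
  π-div {x} Ix = div x Ix (cong (_* x) (sym ι-P-1))

  div-π : ∀ {x} → Div 1 x → ∃[ z ] Integral z × x ≡ π * z
  div-π (div z Iz eq) = z , Iz , trans eq (cong (_* z) ι-P-1)

  1≢π* : ∀ {z} → Integral z → 1ℚ ≢ π * z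
  1≢π* Iz h = ¬div-1 (subst (Div 1) (sym h) (π-div Iz))

  -- ℤ₍ₚ₎ is integrally closed, here for monic quadratics: at a pole, multiplying the equation by
  -- `(π * w)²` leaves 1 as a multiple of `π`.
  root₂ : ∀ {x} b c → Integral b → Integral c → x * x + b * x + c ≡ 0ℚ → Integral x
  root₂ {x} b c Ib Ic h = from (valuation x)
    where
    from : Valuation x → Integral x
    from (integer Ix)    = Ix
    from (pole w Iw xw≡1) = ⊥-elim (1≢π* (-ᴵ ((Ib +ᴵ Ic *ᴵ (ι-integral P *ᴵ Iw)) *ᴵ Iw))
      (lin₂ (π * w * (π * w)) (- (1ℚ + x * (π * w) + b * (π * w))) h xw≡1 (identity x b c π w)))
      where
      identity = solve 5 (λ x b c π w → Κ 1ℚ ⊖ π ⊗ ⊝ ((b ⊕ c ⊗ (π ⊗ w)) ⊗ w) ≋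
        π ⊗ w ⊗ (π ⊗ w) ⊗ (x ⊗ x ⊕ b ⊗ x ⊕ c ⊖ Κ 0ℚ) ⊕ ⊝ (Κ 1ℚ ⊕ x ⊗ (π ⊗ w) ⊕ b ⊗ (π ⊗ w)) ⊗ (x ⊗ (π ⊗ w) ⊖ Κ 1ℚ)) refl

  sqrt-integral : ∀ {x c} → x * x ≡ c → Integral c → Integral x
  sqrt-integral {x} {c} h Ic = root₂ 0ℚ (- c) 0ᴵ (-ᴵ Ic) (lin₁ 1ℚ h (identity x c))
    where
    identity = solve 2 (λ x c → x ⊗ x ⊕ Κ 0ℚ ⊗ x ⊕ ⊝ c ⊖ Κ 0ℚ ≋ Κ 1ℚ ⊗ (x ⊗ x ⊖ c)) refl

  -- If the inverse had a pole, `x` itself would be divisible by `p`.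
  unit-inverse : ∀ {x} → Integral x → Div 1 (x - 1ℚ) → ∃[ y ] Integral y × x * y ≡ 1ℚ
  unit-inverse {x} Ix d = by-inverse (x ≟ 0ℚ)
    where
    from-div : ∃[ z ] Integral z × x - 1ℚ ≡ π * z → ∀ w → Integral w → x ≢ π * w
    from-div (z , Iz , h) w Iw x≡ = 1≢π* (Iw -ᴵ Iz) (lin₂ 1ℚ (- 1ℚ) x≡ h (identity x π w z))
      where
      identity = solve 4 (λ x π w z → Κ 1ℚ ⊖ π ⊗ (w ⊖ z) ≋ Κ 1ℚ ⊗ (x ⊖ π ⊗ w) ⊕ ⊝ Κ 1ℚ ⊗ (x ⊖ Κ 1ℚ ⊖ π ⊗ z)) refl
    by-inverse : Dec (x ≡ 0ℚ) → ∃[ y ] Integral y × x * y ≡ 1ℚ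
    by-inverse (yes refl) = ⊥-elim (from-div (div-π d) 0ℚ 0ᴵ (π*0 π))
      where
      π*0 = solve 1 (λ π → Κ 0ℚ ≋ π ⊗ Κ 0ℚ) refl
    by-inverse (no x≢0) = by-valuation (inverse x≢0)
      where
      by-valuation : ∃[ y ] x * y ≡ 1ℚ → ∃[ y ] Integral y × x * y ≡ 1ℚ
      by-valuation (y , xy≡1) = from (valuation y)
        where
        from : Valuation y → ∃[ y ] Integral y × x * y ≡ 1ℚ
        from (integer Iy)     = y , Iy , xy≡1
        from (pole w Iw yw≡1) = ⊥-elim (from-div (div-π d) w Iw (lin₂ (- x) (π * w) yw≡1 xy≡1 (identity x y π w)))
          where
          identity = solve 4 (λ x y π w → x ⊖ π ⊗ w ≋ ⊝ x ⊗ (y ⊗ (π ⊗ w) ⊖ Κ 1ℚ) ⊕ π ⊗ w ⊗ (x ⊗ y ⊖ Κ 1ℚ)) refl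

  -- If 1/x is integral, its square turns `x * x ≡ π * z` into 1 ∈ pℤ₍ₚ₎; if 1/x has a pole, `x` is
  -- divisible by `p`.
  square-div : ∀ {x} → Integral x → Div 1 (x * x) → Div 1 x
  square-div {x} Ix d = by-zero (x ≟ 0ℚ)
    where
    by-zero : Dec (x ≡ 0ℚ) → Div 1 x
    by-zero (yes x≡0) = div-zero x≡0
    by-zero (no x≢0)  = by-inverse (inverse x≢0)
      where
      by-inverse : ∃[ y ] x * y ≡ 1ℚ → Div 1 x
      by-inverse (y , xy≡1) = from (valuation y) (div-π d)
        where
        from : Valuation y → ∃[ z ] Integral z × x * x ≡ π * z → Div 1 x
        from (integer Iy) (z , Iz , h) = ⊥-elim (1≢π* (Iy *ᴵ Iy *ᴵ Iz) (lin₂ (y * y) (- (1ℚ + x * y)) h xy≡1 (identity x y π z)))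
          where
          identity = solve 4 (λ x y π z → Κ 1ℚ ⊖ π ⊗ (y ⊗ y ⊗ z) ≋ y ⊗ y ⊗ (x ⊗ x ⊖ π ⊗ z) ⊕ ⊝ (Κ 1ℚ ⊕ x ⊗ y) ⊗ (x ⊗ y ⊖ Κ 1ℚ)) refl
        from (pole w Iw yw≡1) _ = subst (Div 1) (sym (lin₂ (- x) (π * w) yw≡1 xy≡1 (identity x y π w))) (π-div Iw)
          where
          identity = solve 4 (λ x y π w → x ⊖ π ⊗ w ≋ ⊝ x ⊗ (y ⊗ (π ⊗ w) ⊖ Κ 1ℚ) ⊕ π ⊗ w ⊗ (x ⊗ y ⊖ Κ 1ℚ)) refl

  module Model (N : WModel ℚ)
           (I₁ : Integral (a1 N)) (I₂ : Integral (a2 N)) (I₃ : Integral (a3 N)) (I₄ : Integral (a4 N)) (I₆ : Integral (a6 N)) where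

    -- W = 1/x; by the Weierstrass equation the pole has even order.
    data Pole (x : ℚ) : Set where
      pole : ∀ W → Integral W → Div 2 W → x * W ≡ 1ℚ → Pole x

    y-integral : ∀ x y → OnCurve N (aff x y) → Integral x → Integral y
    y-integral x y h Ix =
      root₂ (a1 N * x + a3 N) (- (x * x * x + a2 N * x * x + a4 N * x + a6 N))
            (I₁ *ᴵ Ix +ᴵ I₃) (-ᴵ (Ix *ᴵ Ix *ᴵ Ix +ᴵ I₂ *ᴵ Ix *ᴵ Ix +ᴵ I₄ *ᴵ Ix +ᴵ I₆))
            (lin₁ 1ℚ h (identity (a1 N) (a3 N) x y (x * x * x + a2 N * x * x + a4 N * x + a6 N)))
      where
      identity = solve 5 (λ a₁ a₃ x y c → y ⊗ y ⊕ (a₁ ⊗ x ⊕ a₃) ⊗ y ⊕ ⊝ c ⊖ Κ 0ℚ ≋ Κ 1ℚ ⊗ (y ⊗ y ⊕ a₁ ⊗ x ⊗ y ⊕ a₃ ⊗ y ⊖ c)) refl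

    -- Three collinear points give the slope a monic equation, `l² + a₁l = a₂ + x₁ + x₂ + x₃`.
    slope-integral : ∀ {x₁ x₂ x₃ l} → x₃ ≡ third-x N x₁ x₂ l → Integral x₁ → Integral x₂ → Integral x₃ → Integral l
    slope-integral {x₁} {x₂} {x₃} {l} h J₁ J₂ J₃ =
      root₂ (a1 N) (- (a2 N + x₁ + x₂ + x₃)) I₁ (-ᴵ (I₂ +ᴵ J₁ +ᴵ J₂ +ᴵ J₃)) (lin₁ (- 1ℚ) h (identity (a1 N) (a2 N) x₁ x₂ x₃ l))
      where
      identity = solve 6 (λ a₁ a₂ x₁ x₂ x₃ l → l ⊗ l ⊕ a₁ ⊗ l ⊕ ⊝ (a₂ ⊕ x₁ ⊕ x₂ ⊕ x₃) ⊖ Κ 0ℚ ≋ ⊝ Κ 1ℚ ⊗ (x₃ ⊖ (l ⊗ l ⊕ a₁ ⊗ l ⊖ a₂ ⊖ x₁ ⊖ x₂))) refl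

    -- In the coordinates `W = 1/x` and `η = y/x²`, divisibility of `W` by p passes to `η²` and so
    -- to `η`. Then every term of `relation` apart from `W` is divisible by p², hence so is `W`.
    pole-or-integral : ∀ x y → OnCurve N (aff x y) → Integral x ⊎ Pole x
    pole-or-integral x y h = from (valuation x)
      where
      from : Valuation x → Integral x ⊎ Pole x
      from (integer Ix)     = inj₁ Ix
      from (pole w Iw xw≡1) = inj₂ (finish (div-π (square-div Iη η²)))
        where
        W = π * w
        IW : Integral W
        IW = ι-integral P *ᴵ Iw
        η = W * W * y
        -- Multiplying the Weierstrass equation by W⁴ gives η² + a₁Wη + a₃W²η = W + a₂W² + a₄W³ + a₆W⁴.
        relation : η * η + (a1 N * W + a3 N * W * W) * η + - (W * (1ℚ + a2 N * W + a4 N * W * W + a6 N * W * W * W)) ≡ 0ℚ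
        relation = lin₂ (W * W * W * W) (W * (1ℚ + x * W + x * W * (x * W) + a2 N * W * (1ℚ + x * W) + a4 N * W * W) - a1 N * W * W * W * y)
                     h xw≡1 (identity (a1 N) (a2 N) (a3 N) (a4 N) (a6 N) x y W)
          where
          identity = solve 8 (λ a₁ a₂ a₃ a₄ a₆ x y W →
            (W ⊗ W ⊗ y) ⊗ (W ⊗ W ⊗ y) ⊕ (a₁ ⊗ W ⊕ a₃ ⊗ W ⊗ W) ⊗ (W ⊗ W ⊗ y) ⊕ ⊝ (W ⊗ (Κ 1ℚ ⊕ a₂ ⊗ W ⊕ a₄ ⊗ W ⊗ W ⊕ a₆ ⊗ W ⊗ W ⊗ W)) ⊖ Κ 0ℚ ≋
            W ⊗ W ⊗ W ⊗ W ⊗ (y ⊗ y ⊕ a₁ ⊗ x ⊗ y ⊕ a₃ ⊗ y ⊖ (x ⊗ x ⊗ x ⊕ a₂ ⊗ x ⊗ x ⊕ a₄ ⊗ x ⊕ a₆)) ⊕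
            (W ⊗ (Κ 1ℚ ⊕ x ⊗ W ⊕ x ⊗ W ⊗ (x ⊗ W) ⊕ a₂ ⊗ W ⊗ (Κ 1ℚ ⊕ x ⊗ W) ⊕ a₄ ⊗ W ⊗ W) ⊖ a₁ ⊗ W ⊗ W ⊗ W ⊗ y) ⊗ (x ⊗ W ⊖ Κ 1ℚ)) refl
        Ic : Integral (1ℚ + a2 N * W + a4 N * W * W + a6 N * W * W * W)
        Ic = 1ᴵ +ᴵ I₂ *ᴵ IW +ᴵ I₄ *ᴵ IW *ᴵ IW +ᴵ I₆ *ᴵ IW *ᴵ IW *ᴵ IW
        Iη : Integral η
        Iη = root₂ (a1 N * W + a3 N * W * W) _ (I₁ *ᴵ IW +ᴵ I₃ *ᴵ IW *ᴵ IW) (-ᴵ (IW *ᴵ Ic)) relation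
        η² : Div 1 (η * η)
        η² = subst (Div 1) (sym (lin₁ 1ℚ relation (identity (a1 N) (a2 N) (a3 N) (a4 N) (a6 N) η π w)))
               (π-div (Iw *ᴵ (Ic -ᴵ (I₁ +ᴵ I₃ *ᴵ IW) *ᴵ Iη)))
          where
          identity = solve 8 (λ a₁ a₂ a₃ a₄ a₆ η π w →
            let W = π ⊗ w
                c = Κ 1ℚ ⊕ a₂ ⊗ W ⊕ a₄ ⊗ W ⊗ W ⊕ a₆ ⊗ W ⊗ W ⊗ W
            in η ⊗ η ⊖ π ⊗ (w ⊗ (c ⊖ (a₁ ⊕ a₃ ⊗ W) ⊗ η)) ≋ Κ 1ℚ ⊗ (η ⊗ η ⊕ (a₁ ⊗ W ⊕ a₃ ⊗ W ⊗ W) ⊗ η ⊕ ⊝ (W ⊗ c) ⊖ Κ 0ℚ)) refl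
        finish : ∃[ z ] Integral z × η ≡ π * z → Pole x
        finish (z , Iz , η≡) = pole W IW (subst (Div 2) (sym W≡) (div c Ic′ (cong (_* c) (sym π²)))) xw≡1
          where
          c = z * z + (a1 N + a3 N * W) * w * z - w * w * (a2 N + a4 N * W + a6 N * W * W)
          Ic′ : Integral c
          Ic′ = Iz *ᴵ Iz +ᴵ (I₁ +ᴵ I₃ *ᴵ IW) *ᴵ Iw *ᴵ Iz -ᴵ Iw *ᴵ Iw *ᴵ (I₂ +ᴵ I₄ *ᴵ IW +ᴵ I₆ *ᴵ IW *ᴵ IW)
          π² : ι (pᵏ 2) ≡ π * π
          π² = trans (ι-P-suc 1) (cong (π *_) ι-P-1)
          W≡ : W ≡ π * π * c
          W≡ = lin₂ (- 1ℚ) (η + π * z + (a1 N * W + a3 N * W * W)) relation η≡ (identity (a1 N) (a2 N) (a3 N) (a4 N) (a6 N) η π w z)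
            where
            identity = solve 9 (λ a₁ a₂ a₃ a₄ a₆ η π w z →
              let W = π ⊗ w
                  c = z ⊗ z ⊕ (a₁ ⊕ a₃ ⊗ W) ⊗ w ⊗ z ⊖ w ⊗ w ⊗ (a₂ ⊕ a₄ ⊗ W ⊕ a₆ ⊗ W ⊗ W)
              in W ⊖ π ⊗ π ⊗ c ≋
                 ⊝ Κ 1ℚ ⊗ (η ⊗ η ⊕ (a₁ ⊗ W ⊕ a₃ ⊗ W ⊗ W) ⊗ η ⊕ ⊝ (W ⊗ (Κ 1ℚ ⊕ a₂ ⊗ W ⊕ a₄ ⊗ W ⊗ W ⊕ a₆ ⊗ W ⊗ W ⊗ W)) ⊖ Κ 0ℚ)
                 ⊕ (η ⊕ π ⊗ z ⊕ (a₁ ⊗ W ⊕ a₃ ⊗ W ⊗ W)) ⊗ (η ⊖ π ⊗ z)) refl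

    B₂ B₄ B₆ B₈ : ℚ
    B₂ = b₂ N
    B₄ = b₄ N
    B₆ = b₆ N
    B₈ = b₈ N

    J₂ : Integral B₂
    J₂ = I₁ *ᴵ I₁ +ᴵ ι-integral (+ 4) *ᴵ I₂
    J₄ : Integral B₄
    J₄ = ι-integral (+ 2) *ᴵ I₄ +ᴵ I₁ *ᴵ I₃
    J₆ : Integral B₆
    J₆ = I₃ *ᴵ I₃ +ᴵ ι-integral (+ 4) *ᴵ I₆
    J₈ : Integral B₈
    J₈ = I₁ *ᴵ I₁ *ᴵ I₆ +ᴵ ι-integral (+ 4) *ᴵ I₂ *ᴵ I₆ -ᴵ I₁ *ᴵ I₃ *ᴵ I₄ +ᴵ I₂ *ᴵ I₃ *ᴵ I₃ -ᴵ I₄ *ᴵ I₄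

    -- ψ₂²(1/W) = (4 + W c)/W³ and φ₂(1/W) = (1 − W c′)/W⁴.
    c c′ : ℚ → ℚ
    c W  = B₂ + q 2 * B₄ * W + B₆ * W * W
    c′ W = B₄ * W + q 2 * B₆ * W * W + B₈ * W * W * W

    c-integral : ∀ {W} → Integral W → Integral (c W)
    c-integral IW = J₂ +ᴵ ι-integral (+ 2) *ᴵ J₄ *ᴵ IW +ᴵ J₆ *ᴵ IW *ᴵ IW

    c′-integral : ∀ {W} → Integral W → Integral (c′ W)
    c′-integral IW = J₄ *ᴵ IW +ᴵ ι-integral (+ 2) *ᴵ J₆ *ᴵ IW *ᴵ IW +ᴵ J₈ *ᴵ IW *ᴵ IW *ᴵ IW

    duplicate-pole : ∀ {x x₂ W} → x * W ≡ 1ℚ → x₂ * ψ₂² N x ≡ φ₂ N x → x₂ * W * (q 4 + W * c W) ≡ 1ℚ - W * c′ W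
    duplicate-pole {x} {x₂} {W} xW≡1 h =
      lin₂ (W * W * W * W)
        (- (x₂ * W * (q 4 * (1ℚ + x * W + x * W * (x * W)) + B₂ * W * (1ℚ + x * W) + q 2 * B₄ * W * W)) +
         ((1ℚ + x * W) * (1ℚ + x * W * (x * W)) - B₄ * W * W * (1ℚ + x * W) - q 2 * B₆ * W * W * W))
        h xW≡1 (identity x x₂ W B₂ B₄ B₆ B₈)
      where
      identity = solve 7 (λ x x₂ W B₂ B₄ B₆ B₈ →
        x₂ ⊗ W ⊗ (Κ (q 4) ⊕ W ⊗ (B₂ ⊕ Κ (q 2) ⊗ B₄ ⊗ W ⊕ B₆ ⊗ W ⊗ W)) ⊖ (Κ 1ℚ ⊖ W ⊗ (B₄ ⊗ W ⊕ Κ (q 2) ⊗ B₆ ⊗ W ⊗ W ⊕ B₈ ⊗ W ⊗ W ⊗ W)) ≋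
        W ⊗ W ⊗ W ⊗ W ⊗ (x₂ ⊗ (Κ (q 4) ⊗ x ⊗ x ⊗ x ⊕ B₂ ⊗ x ⊗ x ⊕ Κ (q 2) ⊗ B₄ ⊗ x ⊕ B₆) ⊖ (x ⊗ x ⊗ x ⊗ x ⊖ B₄ ⊗ x ⊗ x ⊖ Κ (q 2) ⊗ B₆ ⊗ x ⊖ B₈)) ⊕
        (⊝ (x₂ ⊗ W ⊗ (Κ (q 4) ⊗ (Κ 1ℚ ⊕ x ⊗ W ⊕ x ⊗ W ⊗ (x ⊗ W)) ⊕ B₂ ⊗ W ⊗ (Κ 1ℚ ⊕ x ⊗ W) ⊕ Κ (q 2) ⊗ B₄ ⊗ W ⊗ W)) ⊕
         ((Κ 1ℚ ⊕ x ⊗ W) ⊗ (Κ 1ℚ ⊕ x ⊗ W ⊗ (x ⊗ W)) ⊖ B₄ ⊗ W ⊗ W ⊗ (Κ 1ℚ ⊕ x ⊗ W) ⊖ Κ (q 2) ⊗ B₆ ⊗ W ⊗ W ⊗ W)) ⊗ (x ⊗ W ⊖ Κ 1ℚ)) refl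

    no-root : ∀ {x W} → x * W ≡ 1ℚ → ψ₂² N x ≡ 0ℚ → q 4 + W * c W ≡ 0ℚ
    no-root {x} {W} xW≡1 h =
      lin₂ (W * W * W) (- (q 4 * (1ℚ + x * W + x * W * (x * W)) + B₂ * W * (1ℚ + x * W) + q 2 * B₄ * W * W)) h xW≡1 (identity x W B₂ B₄ B₆)
      where
      identity = solve 5 (λ x W B₂ B₄ B₆ →
        Κ (q 4) ⊕ W ⊗ (B₂ ⊕ Κ (q 2) ⊗ B₄ ⊗ W ⊕ B₆ ⊗ W ⊗ W) ⊖ Κ 0ℚ ≋
        W ⊗ W ⊗ W ⊗ (Κ (q 4) ⊗ x ⊗ x ⊗ x ⊕ B₂ ⊗ x ⊗ x ⊕ Κ (q 2) ⊗ B₄ ⊗ x ⊕ B₆ ⊖ Κ 0ℚ) ⊕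
        ⊝ (Κ (q 4) ⊗ (Κ 1ℚ ⊕ x ⊗ W ⊕ x ⊗ W ⊗ (x ⊗ W)) ⊕ B₂ ⊗ W ⊗ (Κ 1ℚ ⊕ x ⊗ W) ⊕ Κ (q 2) ⊗ B₄ ⊗ W ⊗ W) ⊗ (x ⊗ W ⊖ Κ 1ℚ)) refl

    -- 1/x(2P) = z/x(P).
    record Step (x₂ W : ℚ) : Set where
      constructor step
      field
        z   : ℚ
        I-z : Integral z
        eq  : x₂ * (W * z) ≡ 1ℚ
        z≡  : z * (1ℚ - W * c′ W) ≡ q 4 + W * c W

    -- `1 - W * c′ W` is a unit because p divides `W`, so the ratio of 1/x(2P) to 1/x(P) is
    -- integral.
    duplicate-step : ∀ {x x₂ W} → Integral W → Div 2 W → x * W ≡ 1ℚ → x₂ * ψ₂² N x ≡ φ₂ N x → Step x₂ W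
    duplicate-step {x} {x₂} {W} IW d xW≡1 h = from (unit-inverse IU (subst (Div 1) (shift W (c′ W)) (div-neg (subst (Div 1) (*-comm (c′ W) W) (div-* (c′ W) (c′-integral IW) (div-pred d))))))
      where
      U = 1ℚ - W * c′ W
      IU : Integral U
      IU = 1ᴵ -ᴵ IW *ᴵ c′-integral IW
      shift = solve 2 (λ W c′ → ⊝ (W ⊗ c′) ≋ Κ 1ℚ ⊖ W ⊗ c′ ⊖ Κ 1ℚ) refl
      from : ∃[ U′ ] Integral U′ × U * U′ ≡ 1ℚ → Step x₂ W
      from (U′ , IU′ , UU′≡1) = step (S * U′) ((ι-integral (+ 4) +ᴵ IW *ᴵ c-integral IW) *ᴵ IU′)
        (lin₂ U′ 1ℚ (duplicate-pole {x} {x₂} {W} xW≡1 h) UU′≡1 (identity x₂ W S U U′)) (lin₁ S UU′≡1 (identity′ S U U′))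
        where
        S = q 4 + W * c W
        identity = solve 5 (λ x₂ W S U U′ → x₂ ⊗ (W ⊗ (S ⊗ U′)) ⊖ Κ 1ℚ ≋ U′ ⊗ (x₂ ⊗ W ⊗ S ⊖ U) ⊕ Κ 1ℚ ⊗ (U ⊗ U′ ⊖ Κ 1ℚ)) refl
        identity′ = solve 3 (λ S U U′ → S ⊗ U′ ⊗ U ⊖ S ≋ S ⊗ (U ⊗ U′ ⊖ Κ 1ℚ)) refl

    no-pole : ∀ {x W} → Integral x → Div 1 W → x * W ≢ 1ℚ
    no-pole {x} Ix d h = ¬div-1 (subst (Div 1) h (div-* x Ix d))

    -- A pole at P passes to 2P, since 1/x(2P) is an integral multiple of 1/x(P).
    half-integral : ∀ x y x₂ → OnCurve N (aff x y) → x₂ * ψ₂² N x ≡ φ₂ N x → Integral x₂ → Integral x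
    half-integral x y x₂ on h I₂ = from (pole-or-integral x y on)
      where
      contra : ∀ {W} → Div 1 W → Step x₂ W → ⊥
      contra {W} d (step z Iz eq _) = no-pole I₂ (subst (Div 1) (*-comm z W) (div-* z Iz d)) eq
      from : Integral x ⊎ Pole x → Integral x
      from (inj₁ Ix)                = Ix
      from (inj₂ (pole W IW d xW≡1)) = ⊥-elim (contra (div-pred d) (duplicate-step {x} {x₂} IW d xW≡1 h))

    -- Chains of duplications on abscissae. Opposite points are identified, so a chain closes as
    -- soon as a power of 2 takes P to P or to -P.
    data Doubles : ℚ → ℚ → Set where
      []ᵈ  : ∀ {x} → Doubles x x
      via  : ∀ {x} x₂ {x₃} → x₂ * ψ₂² N x ≡ φ₂ N x → Doubles x₂ x₃ → Doubles x x₃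

-- Exclusion of poles at 2 and at 3

two-prime : Prime 2
two-prime = from-yes (prime? 2)

three-prime : Prime 3
three-prime = from-yes (prime? 3)

module Integrality₂ (N : WModel ℚ) where
  open Residues 2 two-prime
  open Integrality 2 two-prime

  module Model₂ (I₁ : Integral (a1 N)) (I₂ : Integral (a2 N)) (I₃ : Integral (a3 N)) (I₄ : Integral (a4 N)) (I₆ : Integral (a6 N)) where
    open Model N I₁ I₂ I₃ I₄ I₆ public

    private
      Wᵉ zᵉ cᵉ c′ᵉ : Expr 4
      Wᵉ  = var (# 0)
      zᵉ  = var (# 1)
      cᵉ  = var (# 2)
      c′ᵉ = var (# 3)

    -- At 2 both summands of `4 + W * c W` are divisible by 4, and the factor in front of `z` is a
    -- unit.
    even-step : ∀ {x₂ W} → Integral W → Div 2 W → (S : Step x₂ W) → Div 2 (Step.z S)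
    even-step {x₂} {W₀} IW d (step z₀ Iz eq z≡) =
      by-residues 2 ((2 ∥ Wᵉ) ∷ (2 ∥ zᵉ :* (con (+ 1) :- Wᵉ :* c′ᵉ) :- (con (+ 4) :+ Wᵉ :* cᵉ)) ∷ []) (2 ∥ zᵉ) tt
        (IW ∷ᴵ Iz ∷ᴵ c-integral IW ∷ᴵ c′-integral IW ∷ᴵ []ᴵ) (d ∷ᵃ div-eq z≡ ∷ᵃ []ᵃ)

    doubles-pole : ∀ {x x′ W} → Integral W → Div 2 W → x * W ≡ 1ℚ → Doubles x x′ →
                   ∃[ z ] Integral z × x′ * (W * z) ≡ 1ℚ
    doubles-pole {x} {x′} {W} IW d xW≡1 []ᵈ = 1ℚ , 1ᴵ , trans (one x W) xW≡1
      where
      one = solve 2 (λ x W → x ⊗ (W ⊗ Κ 1ℚ) ≋ x ⊗ W) refl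
    doubles-pole {x} {x′} {W} IW d xW≡1 (via x₂ h hs) = from (duplicate-step {x} {x₂} IW d xW≡1 h)
      where
      from : Step x₂ W → ∃[ z ] Integral z × x′ * (W * z) ≡ 1ℚ
      from (step z Iz eq _) = continue (doubles-pole (IW *ᴵ Iz) (subst (Div 2) (*-comm z W) (div-* z Iz d)) eq hs)
        where
        continue : ∃[ z′ ] Integral z′ × x′ * (W * z * z′) ≡ 1ℚ → ∃[ z ] Integral z × x′ * (W * z) ≡ 1ℚ
        continue (z′ , Iz′ , h) = z * z′ , Iz *ᴵ Iz′ , trans (assoc x′ W z z′) h
          where
          assoc = solve 4 (λ x W z z′ → x ⊗ (W ⊗ (z ⊗ z′)) ≋ x ⊗ (W ⊗ z ⊗ z′)) refl

    -- Doubling strictly deepens a 2-adic pole, so x is integral on a cycle of doublings.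
    cyclic-integral : ∀ x y x₂ → OnCurve N (aff x y) → x₂ * ψ₂² N x ≡ φ₂ N x → Doubles x₂ x → Integral x
    cyclic-integral x y x₂ on h hs = from (pole-or-integral x y on)
      where
      from : Integral x ⊎ Pole x → Integral x
      from (inj₁ Ix) = Ix
      from (inj₂ (pole W IW d xW≡1)) = ⊥-elim (contra (duplicate-step {x} {x₂} IW d xW≡1 h))
        where
        contra : Step x₂ W → ⊥
        contra S@(step z Iz eq _) = close (doubles-pole (IW *ᴵ Iz) (subst (Div 2) (*-comm z W) (div-* z Iz d)) eq hs)
          where
          close : ∃[ z′ ] Integral z′ × x * (W * z * z′) ≡ 1ℚ → ⊥
          close (z′ , Iz′ , h′) = ¬div-1 (subst (Div 1) (lin₂ 1ℚ (- (z * z′)) h′ xW≡1 (identity x W z z′)) (div-* z′ Iz′ (div-pred (even-step IW d S))))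
            where
            identity = solve 4 (λ x W z z′ → z′ ⊗ z ⊖ Κ 1ℚ ≋ Κ 1ℚ ⊗ (x ⊗ (W ⊗ z ⊗ z′) ⊖ Κ 1ℚ) ⊕ ⊝ (z ⊗ z′) ⊗ (x ⊗ W ⊖ Κ 1ℚ)) refl

    -- A pole at P would make 1/x(2P) divisible by 16, contradicting modulo 8 the equation
    -- `4 + W * c W ≡ 0ℚ` that holds for `W = 1/x(2P)`.
    quarter-integral : ∀ x y x₂ → OnCurve N (aff x y) → x₂ * ψ₂² N x ≡ φ₂ N x → ψ₂² N x₂ ≡ 0ℚ → Integral x
    quarter-integral x y x₂ on h h₂ = from (pole-or-integral x y on)
      where
      from : Integral x ⊎ Pole x → Integral x
      from (inj₁ Ix) = Ix
      from (inj₂ (pole W IW d xW≡1)) = ⊥-elim (contra (duplicate-step {x} {x₂} IW d xW≡1 h))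
        where
        contra : Step x₂ W → ⊥
        contra S@(step z₀ Iz eq _) = ¬div-1 (by-residues 3
            ((2 ∥ var (# 0)) ∷ (2 ∥ var (# 1)) ∷ (3 ∥ con (+ 4) :+ (var (# 0)) :* var (# 1) :* var (# 2) :- con (+ 0)) ∷ []) (1 ∥ con (+ 1)) tt
            (IW ∷ᴵ Iz ∷ᴵ c-integral (IW *ᴵ Iz) ∷ᴵ []ᴵ)
            (d ∷ᵃ even-step IW d S ∷ᵃ div-eq (no-root {x₂} {W * z₀} eq h₂) ∷ᵃ []ᵃ))

module Integrality₃ (N : WModel ℚ) where
  open Residues 3 three-prime
  open Integrality 3 three-prime

  module Model₃ (I₁ : Integral (a1 N)) (I₂ : Integral (a2 N)) (I₃ : Integral (a3 N)) (I₄ : Integral (a4 N)) (I₆ : Integral (a6 N)) where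
    open Model N I₁ I₂ I₃ I₄ I₆ public

    private
      Wᵉ zᵉ cᵉ c′ᵉ : Expr 4
      Wᵉ  = var (# 0)
      zᵉ  = var (# 1)
      cᵉ  = var (# 2)
      c′ᵉ = var (# 3)

    -- When 3 divides 1/x, the equation of `no-root` would give 4 ≡ 0 modulo 3.
    root-integral : ∀ x y → OnCurve N (aff x y) → ψ₂² N x ≡ 0ℚ → Integral x
    root-integral x y on h = from (pole-or-integral x y on)
      where
      from : Integral x ⊎ Pole x → Integral x
      from (inj₁ Ix) = Ix
      from (inj₂ (pole W₀ IW d xW≡1)) = ⊥-elim (¬div-1 (by-residues 1
        ((1 ∥ var (# 0)) ∷ (1 ∥ con (+ 4) :+ var (# 0) :* var (# 1) :- con (+ 0)) ∷ []) (1 ∥ con (+ 1)) tt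
        (IW ∷ᴵ c-integral IW ∷ᴵ []ᴵ) (div-pred d ∷ᵃ div-eq (no-root {x} {W₀} xW≡1 h) ∷ᵃ []ᵃ)))

    -- Equality of x(2P) and x(P) at a pole would give 4 ≡ 1 modulo 9. The even order of the pole
    -- matters here, as the congruence does hold modulo 3.
    three-integral : ∀ x y → OnCurve N (aff x y) → x * ψ₂² N x ≡ φ₂ N x → Integral x
    three-integral x y on h = from (pole-or-integral x y on)
      where
      from : Integral x ⊎ Pole x → Integral x
      from (inj₁ Ix) = Ix
      from (inj₂ (pole W₀ IW d xW≡1)) = ⊥-elim (¬div-1 (by-residues 2
        ((2 ∥ var (# 0)) ∷ (2 ∥ con (+ 4) :+ var (# 0) :* var (# 1) :- (con (+ 1) :- var (# 0) :* var (# 2))) ∷ []) (1 ∥ con (+ 1)) tt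
        (IW ∷ᴵ c-integral IW ∷ᴵ c′-integral IW ∷ᴵ []ᴵ)
        (d ∷ᵃ div-eq {x = q 4 + W₀ * c W₀} {1ℚ - W₀ * c′ W₀} (trans (sym (trans (cong (_* (q 4 + W₀ * c W₀)) xW≡1) (*-identityˡ (q 4 + W₀ * c W₀)))) (duplicate-pole {x} {x} {W₀} xW≡1 h)) ∷ᵃ []ᵃ)))

    four-step : ∀ {x₂ W} → Integral W → Div 2 W → (S : Step x₂ W) → Div 2 (Step.z S - q 4)
    four-step IW d (step z₀ Iz eq z≡) =
      by-residues 2 ((2 ∥ Wᵉ) ∷ (2 ∥ zᵉ :* (con (+ 1) :- Wᵉ :* c′ᵉ) :- (con (+ 4) :+ Wᵉ :* cᵉ)) ∷ []) (2 ∥ zᵉ :- con (+ 4)) tt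
        (IW ∷ᴵ Iz ∷ᴵ c-integral IW ∷ᴵ c′-integral IW ∷ᴵ []ᴵ) (d ∷ᵃ div-eq z≡ ∷ᵃ []ᵃ)

    -- Two doublings return to the same abscissa, so `z₀ * z′` is 1, whereas 4² ≡ 7 modulo 9.
    five-integral : ∀ x y x₂ → OnCurve N (aff x y) → x₂ * ψ₂² N x ≡ φ₂ N x → x * ψ₂² N x₂ ≡ φ₂ N x₂ → Integral x
    five-integral x y x₂ on h h₂ = from (pole-or-integral x y on)
      where
      from : Integral x ⊎ Pole x → Integral x
      from (inj₁ Ix) = Ix
      from (inj₂ (pole W₀ IW d xW≡1)) = ⊥-elim (contra (duplicate-step {x} {x₂} IW d xW≡1 h))
        where
        contra : Step x₂ W₀ → ⊥
        contra S@(step z₀ Iz eq _) = contra′ (duplicate-step {x₂} {x} (IW *ᴵ Iz) d′ eq h₂)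
          where
          d′ : Div 2 (W₀ * z₀)
          d′ = subst (Div 2) (*-comm z₀ W₀) (div-* z₀ Iz d)
          contra′ : Step x (W₀ * z₀) → ⊥
          contra′ S′@(step z′ Iz′ eq′ _) = ¬div-1 (by-residues 2
            ((2 ∥ var (# 0) :- con (+ 4)) ∷ (2 ∥ var (# 1) :- con (+ 4)) ∷ (2 ∥ var (# 0) :* var (# 1) :- con (+ 1)) ∷ []) (1 ∥ con (+ 1)) tt
            (Iz ∷ᴵ Iz′ ∷ᴵ []ᴵ)
            (four-step IW d S ∷ᵃ four-step (IW *ᴵ Iz) d′ S′ ∷ᵃ
             div-eq {x = z₀ * z′} {1ℚ} (lin₂ 1ℚ (- (z₀ * z′)) eq′ xW≡1 (identity x W₀ z₀ z′)) ∷ᵃ []ᵃ))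
            where
            identity = solve 4 (λ x W z z′ → z ⊗ z′ ⊖ Κ 1ℚ ≋ Κ 1ℚ ⊗ (x ⊗ (W ⊗ z ⊗ z′) ⊖ Κ 1ℚ) ⊕ ⊝ (z ⊗ z′) ⊗ (x ⊗ W ⊖ Κ 1ℚ)) refl

    -- Order 7 needs a sharper value of `z` than 4 modulo 9, since 4³ ≡ 1 there. The error of the
    -- linear approximation is a multiple of `W * W`, hence of 81.
    fine-step : ∀ {x₂ W} → Integral W → Div 2 W → (S : Step x₂ W) → Div 3 (Step.z S - (q 4 + W * B₂))
    fine-step {x₂} {W} IW (div w Iw W≡) (step z Iz eq z≡) = div-pred {3} (div y Iy (trans eq₁ (trans (cong₂ (λ a b → a * b * c″) W≡ W≡) (regroup w c″))))
      where
      c″ = q 2 * B₄ + B₆ * W + z * (B₄ + q 2 * B₆ * W + B₈ * W * W)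
      y = w * w * c″
      Iy : Integral y
      Iy = Iw *ᴵ Iw *ᴵ (ι-integral (+ 2) *ᴵ J₄ +ᴵ J₆ *ᴵ IW +ᴵ Iz *ᴵ (J₄ +ᴵ ι-integral (+ 2) *ᴵ J₆ *ᴵ IW +ᴵ J₈ *ᴵ IW *ᴵ IW))
      eq₁ : z - (q 4 + W * B₂) ≡ W * W * c″
      eq₁ = lin₁ 1ℚ z≡ (identity W z B₂ B₄ B₆ B₈)
        where
        identity = solve 6 (λ W z B₂ B₄ B₆ B₈ → z ⊖ (Κ (q 4) ⊕ W ⊗ B₂) ⊖ W ⊗ W ⊗ (Κ (q 2) ⊗ B₄ ⊕ B₆ ⊗ W ⊕ z ⊗ (B₄ ⊕ Κ (q 2) ⊗ B₆ ⊗ W ⊕ B₈ ⊗ W ⊗ W)) ≋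
          Κ 1ℚ ⊗ (z ⊗ (Κ 1ℚ ⊖ W ⊗ (B₄ ⊗ W ⊕ Κ (q 2) ⊗ B₆ ⊗ W ⊗ W ⊕ B₈ ⊗ W ⊗ W ⊗ W)) ⊖ (Κ (q 4) ⊕ W ⊗ (B₂ ⊕ Κ (q 2) ⊗ B₄ ⊗ W ⊕ B₆ ⊗ W ⊗ W)))) refl
      regroup = solve 2 (λ w c → Κ (q 9) ⊗ w ⊗ (Κ (q 9) ⊗ w) ⊗ c ≋ Κ (q 81) ⊗ (w ⊗ w ⊗ c)) refl

    -- The three factors multiply to 1. Modulo 27 their product is `64 + 336 * b₂ * W`; as 9 divides
    -- `W` and 3 divides 336, this is 10.
    seven-integral : ∀ x y x₂ x₄ → OnCurve N (aff x y) → x₂ * ψ₂² N x ≡ φ₂ N x → x₄ * ψ₂² N x₂ ≡ φ₂ N x₂ → x * ψ₂² N x₄ ≡ φ₂ N x₄ → Integral x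
    seven-integral x y x₂ x₄ on h h₂ h₄ = from (pole-or-integral x y on)
      where
      from : Integral x ⊎ Pole x → Integral x
      from (inj₁ Ix) = Ix
      from (inj₂ (pole W₀ IW d xW≡1)) = ⊥-elim (contra₁ (duplicate-step {x} {x₂} IW d xW≡1 h))
        where
        contra₁ : Step x₂ W₀ → ⊥
        contra₁ S₁@(step z₁ Iz₁ eq₁ _) = contra₂ (duplicate-step {x₂} {x₄} IW₁ d₁ eq₁ h₂)
          where
          IW₁ : Integral (W₀ * z₁)
          IW₁ = IW *ᴵ Iz₁
          d₁ : Div 2 (W₀ * z₁)
          d₁ = subst (Div 2) (*-comm z₁ W₀) (div-* z₁ Iz₁ d)
          contra₂ : Step x₄ (W₀ * z₁) → ⊥
          contra₂ S₂@(step z₂ Iz₂ eq₂ _) = contra₃ (duplicate-step {x₄} {x} IW₂ d₂ eq₂ h₄)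
            where
            IW₂ : Integral (W₀ * z₁ * z₂)
            IW₂ = IW₁ *ᴵ Iz₂
            d₂ : Div 2 (W₀ * z₁ * z₂)
            d₂ = subst (Div 2) (*-comm z₂ (W₀ * z₁)) (div-* z₂ Iz₂ d₁)
            contra₃ : Step x (W₀ * z₁ * z₂) → ⊥
            contra₃ S₃@(step z₃ Iz₃ eq₃ _) = ¬div-1 (by-residues 3 ((2 ∥ Wᵉ₂) ∷ (3 ∥ ζ₁ᵉ :* ζ₂ᵉ :* ζ₃ᵉ :- con (+ 1)) ∷ []) (1 ∥ con (+ 1)) tt
              (IW ∷ᴵ J₂ ∷ᴵ []ᴵ) (d ∷ᵃ subst (λ t → Div 3 (ζ₁ * ζ₂ * ζ₃ - t)) product (≈-product ζ₁≈ ζ₂≈ ζ₃≈) ∷ᵃ []ᵃ))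
              where
              -- The approximations express all three factors through `W₀` and `B₂`, so the
              -- enumeration modulo 27 has only two variables.
              Wᵉ₂ Bᵉ ζ₁ᵉ ζ₂ᵉ ζ₃ᵉ : Expr 2
              Wᵉ₂ = var zero
              Bᵉ = var (suc zero)
              ζ₁ᵉ = con (+ 4) :+ Wᵉ₂ :* Bᵉ
              ζ₂ᵉ = con (+ 4) :+ Wᵉ₂ :* ζ₁ᵉ :* Bᵉ
              ζ₃ᵉ = con (+ 4) :+ Wᵉ₂ :* ζ₁ᵉ :* ζ₂ᵉ :* Bᵉ
              ζ₁ ζ₂ ζ₃ : ℚ
              ζ₁ = q 4 + W₀ * B₂
              ζ₂ = q 4 + W₀ * ζ₁ * B₂
              ζ₃ = q 4 + W₀ * ζ₁ * ζ₂ * B₂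
              I4 = ι-integral (+ 4)
              Iζ₁ : Integral ζ₁
              Iζ₁ = I4 +ᴵ IW *ᴵ J₂
              Iζ₂ : Integral ζ₂
              Iζ₂ = I4 +ᴵ IW *ᴵ Iζ₁ *ᴵ J₂
              flip : ∀ a b → Div 3 (a - b) → Div 3 (b - a)
              flip a b e = subst (Div 3) (swap a b) (div-neg e)
                where
                swap = solve 2 (λ a b → ⊝ (a ⊖ b) ≋ b ⊖ a) refl
              ζ₁≈ : Div 3 (ζ₁ - z₁)
              ζ₁≈ = flip z₁ ζ₁ (fine-step IW d S₁)
              ζ₂≈ : Div 3 (ζ₂ - z₂)
              ζ₂≈ = subst (Div 3) (telescope₂ W₀ B₂ ζ₁ z₁ z₂) (div-+ (div-* (W₀ * B₂) (IW *ᴵ J₂) ζ₁≈) (flip z₂ (q 4 + W₀ * z₁ * B₂) (fine-step IW₁ d₁ S₂)))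
                where
                telescope₂ = solve 5 (λ W B ζ₁ z₁ z₂ → W ⊗ B ⊗ (ζ₁ ⊖ z₁) ⊕ (Κ (q 4) ⊕ W ⊗ z₁ ⊗ B ⊖ z₂) ≋ Κ (q 4) ⊕ W ⊗ ζ₁ ⊗ B ⊖ z₂) refl
              ζ₃≈ : Div 3 (ζ₃ - z₃)
              ζ₃≈ = subst (Div 3) (telescope₃ W₀ B₂ ζ₁ ζ₂ z₁ z₂ z₃)
                (div-+ (div-+ (div-* (W₀ * B₂ * ζ₂) (IW *ᴵ J₂ *ᴵ Iζ₂) ζ₁≈) (div-* (W₀ * B₂ * z₁) (IW *ᴵ J₂ *ᴵ Iz₁) ζ₂≈)) (flip z₃ (q 4 + W₀ * z₁ * z₂ * B₂) (fine-step IW₂ d₂ S₃)))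
                where
                telescope₃ = solve 7 (λ W B ζ₁ ζ₂ z₁ z₂ z₃ → W ⊗ B ⊗ ζ₂ ⊗ (ζ₁ ⊖ z₁) ⊕ W ⊗ B ⊗ z₁ ⊗ (ζ₂ ⊖ z₂) ⊕ (Κ (q 4) ⊕ W ⊗ z₁ ⊗ z₂ ⊗ B ⊖ z₃) ≋
                  Κ (q 4) ⊕ W ⊗ ζ₁ ⊗ ζ₂ ⊗ B ⊖ z₃) refl
              ≈-product : Div 3 (ζ₁ - z₁) → Div 3 (ζ₂ - z₂) → Div 3 (ζ₃ - z₃) → Div 3 (ζ₁ * ζ₂ * ζ₃ - z₁ * z₂ * z₃)
              ≈-product e₁ e₂ e₃ = subst (Div 3) (telescope ζ₁ ζ₂ ζ₃ z₁ z₂ z₃)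
                (div-+ (div-+ (div-* (ζ₂ * ζ₃) (Iζ₂ *ᴵ Iζ₃) e₁) (div-* (z₁ * ζ₃) (Iz₁ *ᴵ Iζ₃) e₂)) (div-* (z₁ * z₂) (Iz₁ *ᴵ Iz₂) e₃))
                where
                Iζ₃ : Integral ζ₃
                Iζ₃ = I4 +ᴵ IW *ᴵ Iζ₁ *ᴵ Iζ₂ *ᴵ J₂
                telescope = solve 6 (λ a b c x y z → b ⊗ c ⊗ (a ⊖ x) ⊕ x ⊗ c ⊗ (b ⊖ y) ⊕ x ⊗ y ⊗ (c ⊖ z) ≋ a ⊗ b ⊗ c ⊖ x ⊗ y ⊗ z) refl
              product : z₁ * z₂ * z₃ ≡ 1ℚ
              product = lin₂ 1ℚ (- (z₁ * z₂ * z₃)) eq₃ xW≡1 (identity x W₀ z₁ z₂ z₃)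
                where
                identity = solve 5 (λ x W a b c → a ⊗ b ⊗ c ⊖ Κ 1ℚ ≋ Κ 1ℚ ⊗ (x ⊗ (W ⊗ a ⊗ b ⊗ c) ⊖ Κ 1ℚ) ⊕ ⊝ (a ⊗ b ⊗ c) ⊗ (x ⊗ W ⊖ Κ 1ℚ)) refl

-- Normal forms

-- The point g is P = (0, 0), with horizontal tangent.
module Origin {T : TorsionGroup} {A₁ A₂ A₃ : ℚ} (embW : Embeds T (wm A₁ A₂ A₃ 0ℚ 0ℚ)) (g : Carrier T)
              (X-g : Coordinates.X embW g ≡ 0ℚ) (Y-g : Coordinates.Y embW g ≡ 0ℚ)
              (g≢e : g ≢ (zero , zero)) (2g≢e : addC T g g ≢ (zero , zero)) where
  open Coordinates embW public

  W : WModel ℚ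
  W = wm A₁ A₂ A₃ 0ℚ 0ℚ

  g₂ g₃ g₄ g₅ : Carrier T
  g₂ = g ⊞ g
  g₃ = g ⊞ g₂
  g₄ = g ⊞ g₃
  g₅ = g ⊞ g₄

  distinct : ∀ {h} → h ≢ e → g ≢ h → g ⊞ h ≢ e → X h ≢ 0ℚ
  distinct h≢e g≢h g⊞h≢e X≡0 = X-distinct g≢e h≢e (apart g≢h g⊞h≢e) (trans X-g (sym X≡0))

  private
    tangent-W = tangent-line g≢e 2g≢e

  -- `A₃` is the tangent denominator at the origin.
  A₃≢0 : A₃ ≢ 0ℚ
  A₃≢0 h = proj₁ tangent-W (trans (identity (X g) (Y g) A₁ A₃) (trans (cong₂ _+_ (trans (cong₂ (λ x y → q 2 * y + A₁ * x) X-g Y-g) (zeros A₁)) h) refl))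
    where
    identity = solve 4 (λ x y A₁ A₃ → Κ (q 2) ⊗ y ⊕ A₁ ⊗ x ⊕ A₃ ≋ (Κ (q 2) ⊗ y ⊕ A₁ ⊗ x) ⊕ A₃) refl
    zeros = solve 1 (λ A₁ → Κ (q 2) ⊗ Κ 0ℚ ⊕ A₁ ⊗ Κ 0ℚ ≋ Κ 0ℚ) refl

  line-2g : X g₂ ≡ - A₂ × Y g₂ ≡ A₁ * A₂ - A₃
  line-2g = from tangent-W
    where
    horizontal : ∀ {l x y} → x ≡ 0ℚ → y ≡ 0ℚ → l * tangent-den W x y ≡ tangent-num W x y → l ≡ 0ℚ
    horizontal {l} refl refl h = zero-product {A₃} (lin₁ 1ℚ h (identity A₁ A₂ A₃ l)) A₃≢0
      where
      identity = solve 4 (λ A₁ A₂ A₃ l → A₃ ⊗ l ⊖ Κ 0ℚ ≋ Κ 1ℚ ⊗ (l ⊗ (Κ (q 2) ⊗ Κ 0ℚ ⊕ A₁ ⊗ Κ 0ℚ ⊕ A₃) ⊖ (Κ (q 3) ⊗ Κ 0ℚ ⊗ Κ 0ℚ ⊕ Κ (q 2) ⊗ A₂ ⊗ Κ 0ℚ ⊕ Κ 0ℚ ⊖ A₁ ⊗ Κ 0ℚ))) refl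
    coordinates : ∀ {l x y x₂ y₂} → x ≡ 0ℚ → y ≡ 0ℚ → l ≡ 0ℚ → x₂ ≡ third-x W x x l → y₂ ≡ third-y W x y x₂ l →
                  x₂ ≡ - A₂ × y₂ ≡ A₁ * A₂ - A₃
    coordinates refl refl refl refl refl = ex A₁ A₂ , ey A₁ A₂ A₃
      where
      ex = solve 2 (λ A₁ A₂ → Κ 0ℚ ⊗ Κ 0ℚ ⊕ A₁ ⊗ Κ 0ℚ ⊖ A₂ ⊖ Κ 0ℚ ⊖ Κ 0ℚ ≋ ⊝ A₂) refl
      ey = solve 3 (λ A₁ A₂ A₃ → (⊝ ((Κ 0ℚ ⊕ A₁) ⊗ (Κ 0ℚ ⊗ Κ 0ℚ ⊕ A₁ ⊗ Κ 0ℚ ⊖ A₂ ⊖ Κ 0ℚ ⊖ Κ 0ℚ))) ⊖ (Κ 0ℚ ⊖ Κ 0ℚ ⊗ Κ 0ℚ) ⊖ A₃ ≋ A₁ ⊗ A₂ ⊖ A₃) refl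
    from : tangent-den W (X g) (Y g) ≢ 0ℚ × (Σ (Line g g) λ L → Line.slope L * tangent-den W (X g) (Y g) ≡ tangent-num W (X g) (Y g)) →
           X g₂ ≡ - A₂ × Y g₂ ≡ A₁ * A₂ - A₃
    from (_ , line l sx sy , h) = coordinates {l} {X g} {Y g} {X g₂} {Y g₂} X-g Y-g (horizontal {l} {X g} {Y g} X-g Y-g h) sx sy

  line-through : ∀ {h} → h ≢ e → g ≢ h → g ⊞ h ≢ e →
    ∃[ l ] l * X h ≡ Y h × X (g ⊞ h) ≡ l * l + A₁ * l - A₂ - X h × Y (g ⊞ h) ≡ - ((l + A₁) * X (g ⊞ h)) - A₃
  line-through {h} h≢e g≢h g⊞h≢e = from (chord-line g≢e h≢e (λ eq → distinct h≢e g≢h g⊞h≢e (trans eq X-g)))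
    where
    coordinates : ∀ {l x y x′ y′ x₃ y₃} → x ≡ 0ℚ → y ≡ 0ℚ → l * (x′ - x) ≡ y′ - y → x₃ ≡ third-x W x x′ l → y₃ ≡ third-y W x y x₃ l →
                  l * x′ ≡ y′ × x₃ ≡ l * l + A₁ * l - A₂ - x′ × y₃ ≡ - ((l + A₁) * x₃) - A₃
    coordinates {l} {x′ = x′} {y′} {x₃} refl refl h sx sy =
      lin₁ 1ℚ h (e₁ l x′ y′) , trans sx (e₂ A₁ A₂ l x′) , trans sy (e₃ A₁ A₃ l x₃)
      where
      e₁ = solve 3 (λ l x′ y′ → l ⊗ x′ ⊖ y′ ≋ Κ 1ℚ ⊗ (l ⊗ (x′ ⊖ Κ 0ℚ) ⊖ (y′ ⊖ Κ 0ℚ))) refl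
      e₂ = solve 4 (λ A₁ A₂ l x′ → l ⊗ l ⊕ A₁ ⊗ l ⊖ A₂ ⊖ Κ 0ℚ ⊖ x′ ≋ l ⊗ l ⊕ A₁ ⊗ l ⊖ A₂ ⊖ x′) refl
      e₃ = solve 4 (λ A₁ A₃ l x₃ → (⊝ ((l ⊕ A₁) ⊗ x₃)) ⊖ (Κ 0ℚ ⊖ l ⊗ Κ 0ℚ) ⊖ A₃ ≋ ⊝ ((l ⊕ A₁) ⊗ x₃) ⊖ A₃) refl
    from : (Σ (Line g h) λ L → Line.slope L * (X h - X g) ≡ Y h - Y g) →
           ∃[ l ] l * X h ≡ Y h × X (g ⊞ h) ≡ l * l + A₁ * l - A₂ - X h × Y (g ⊞ h) ≡ - ((l + A₁) * X (g ⊞ h)) - A₃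
    from (line l sx sy , slope) = l , coordinates {l} {X g} {Y g} {X h} {Y h} {X (g ⊞ h)} {Y (g ⊞ h)} X-g Y-g slope sx sy

  -- ε is the slope of the line through P and 2P.
  record Form₃ : Set where
    constructor form₃
    field
      u ε : ℚ
      A₁≡ : A₁ ≡ u - ε
      A₃≡ : A₃ ≡ u * A₂
      X₂≡ : X g₂ ≡ - A₂
      X₃≡ : X g₃ ≡ u * ε
      Y₃≡ : Y g₃ ≡ - (u * (u * ε + A₂))

  -- The line through P and 3P has slope −(u + γ).
  record Form₄ : Set where
    constructor form₄
    field
      u ε γ : ℚ
      A₁≡ : A₁ ≡ u - ε
      A₂≡ : A₂ ≡ γ * ε
      A₃≡ : A₃ ≡ u * (γ * ε)
      X₂≡ : X g₂ ≡ - (γ * ε)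
      X₃≡ : X g₃ ≡ u * ε
      Y₃≡ : Y g₃ ≡ - (u * (u * ε + A₂))
      X₄≡ : X g₄ ≡ γ * (u + γ)
      Y₄≡ : Y g₄ ≡ γ * γ * (u + γ + ε)

  module Multiples-of-g (3g≢e : g₃ ≢ e) (g≢2g : g ≢ g₂) where

    -- The line through P and 2P = (-A₂, A₁A₂ - A₃) has `l * (- A₂) = A₁ * A₂ - A₃`. Thus `A₃` is
    -- `A₂` times `A₁ + l`, which is taken as `u`.
    to-form₃ : Form₃
    to-form₃ = from (line-through 2g≢e g≢2g 3g≢e) line-2g
      where
      from : (∃[ l ] l * X g₂ ≡ Y g₂ × X g₃ ≡ l * l + A₁ * l - A₂ - X g₂ × Y g₃ ≡ - ((l + A₁) * X g₃) - A₃) →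
             X g₂ ≡ - A₂ × Y g₂ ≡ A₁ * A₂ - A₃ → Form₃
      from (l , slope , x₃ , y₃) (x₂ , y₂) = form₃ (A₁ + l) l (e₁ A₁ l) A₃≡ x₂ X₃≡ (trans y₃ (trans (cong₂ (λ x a → - ((l + A₁) * x) - a) X₃≡ A₃≡) (e₄ A₁ A₂ l)))
        where
        e₁ = solve 2 (λ A₁ l → A₁ ≋ A₁ ⊕ l ⊖ l) refl
        e₂ = solve 6 (λ A₁ A₂ A₃ l x y → A₃ ⊖ (A₁ ⊕ l) ⊗ A₂ ≋ Κ 1ℚ ⊗ (l ⊗ x ⊖ y) ⊕ (⊝ l) ⊗ (x ⊖ ⊝ A₂) ⊕ Κ 1ℚ ⊗ (y ⊖ (A₁ ⊗ A₂ ⊖ A₃))) refl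
        e₃ = solve 3 (λ A₁ A₂ l → l ⊗ l ⊕ A₁ ⊗ l ⊖ A₂ ⊖ ⊝ A₂ ≋ (A₁ ⊕ l) ⊗ l) refl
        e₄ = solve 3 (λ A₁ A₂ l → ⊝ ((l ⊕ A₁) ⊗ ((A₁ ⊕ l) ⊗ l)) ⊖ (A₁ ⊕ l) ⊗ A₂ ≋ ⊝ ((A₁ ⊕ l) ⊗ ((A₁ ⊕ l) ⊗ l ⊕ A₂))) refl
        A₃≡ : A₃ ≡ (A₁ + l) * A₂
        A₃≡ = lin₃ 1ℚ (- l) 1ℚ slope x₂ y₂ (e₂ A₁ A₂ A₃ l (X g₂) (Y g₂))
        X₃≡ : X g₃ ≡ (A₁ + l) * l
        X₃≡ = trans x₃ (trans (cong (λ x → l * l + A₁ * l - A₂ - x) x₂) (e₃ A₁ A₂ l))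

    module _ (4g≢e : g₄ ≢ e) (g≢3g : g ≢ g₃) where

      -- The line through P and 3P has `l * (u * ε) = - (u * (u * ε + A₂))`. Cancelling `u` exhibits
      -- `A₂` as a multiple of `ε`, and `γ` is the quotient.
      to-form₄ : Form₄
      to-form₄ = from to-form₃ (line-through 3g≢e g≢3g 4g≢e)
        where
        from : Form₃ → (∃[ l ] l * X g₃ ≡ Y g₃ × X g₄ ≡ l * l + A₁ * l - A₂ - X g₃ × Y g₄ ≡ - ((l + A₁) * X g₄) - A₃) → Form₄
        from (form₃ u ε A₁≡ A₃≡ X₂≡ X₃≡ Y₃≡) (l , slope , x₄ , y₄) =
          form₄ u ε (- (u + l)) A₁≡ A₂≡ (trans A₃≡ (cong (u *_) A₂≡)) (trans X₂≡ (cong (λ x → - x) A₂≡)) X₃≡ Y₃≡ X₄≡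
            (trans y₄ (trans (cong₂ (λ a x → - ((l + a) * x) - A₃) A₁≡ X₄≡) (trans (cong (λ a → - ((l + (u - ε)) * (- (u + l) * (u + - (u + l)))) - a) (trans A₃≡ (cong (u *_) A₂≡))) (e₃ u ε l))))
          where
          u≢0 : u ≢ 0ℚ
          u≢0 refl = A₃≢0 (trans A₃≡ (*-zeroˡ A₂))
          e₁ = solve 6 (λ u ε l A₂ x y → u ⊗ A₂ ⊖ u ⊗ (⊝ (u ⊕ l) ⊗ ε) ≋ Κ 1ℚ ⊗ (l ⊗ x ⊖ y) ⊕ (⊝ l) ⊗ (x ⊖ u ⊗ ε) ⊕ Κ 1ℚ ⊗ (y ⊖ ⊝ (u ⊗ (u ⊗ ε ⊕ A₂)))) refl
          A₂≡ : A₂ ≡ - (u + l) * ε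
          A₂≡ = cancel u≢0 (lin₃ 1ℚ (- l) 1ℚ slope X₃≡ Y₃≡ (e₁ u ε l A₂ (X g₃) (Y g₃)))
          e₂ = solve 3 (λ u ε l → l ⊗ l ⊕ (u ⊖ ε) ⊗ l ⊖ ⊝ (u ⊕ l) ⊗ ε ⊖ u ⊗ ε ≋ ⊝ (u ⊕ l) ⊗ (u ⊕ ⊝ (u ⊕ l))) refl
          eq₄ : ∀ {a₁ a₂ x} → a₁ ≡ u - ε → a₂ ≡ - (u + l) * ε → x ≡ u * ε → l * l + a₁ * l - a₂ - x ≡ - (u + l) * (u + - (u + l))
          eq₄ refl refl refl = e₂ u ε l
          X₄≡ : X g₄ ≡ - (u + l) * (u + - (u + l))
          X₄≡ = trans x₄ (eq₄ A₁≡ A₂≡ X₃≡)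
          e₃ = solve 3 (λ u ε l → ⊝ ((l ⊕ (u ⊖ ε)) ⊗ (⊝ (u ⊕ l) ⊗ (u ⊕ ⊝ (u ⊕ l)))) ⊖ u ⊗ (⊝ (u ⊕ l) ⊗ ε) ≋ ⊝ (u ⊕ l) ⊗ ⊝ (u ⊕ l) ⊗ (u ⊕ ⊝ (u ⊕ l) ⊕ ε)) refl

-- Reaching the normal form by a translation

module TateForm {T : TorsionGroup} {N : WModel ℚ} (embN : Embeds T N) where
  open Coordinates embN public

  module At-order≥3 (g : Carrier T) (g≢e : g ≢ e) (2g≢e : g ⊞ g ≢ e) where

    private
      tangent-at-g = tangent-line g≢e 2g≢e

    r s t A₁ A₂ A₃ : ℚ
    r = X g
    s = Line.slope (proj₁ (proj₂ tangent-at-g))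
    t = Y g
    A₁ = a1 N + q 2 * s
    A₂ = a2 N - s * a1 N + q 3 * r - s * s
    A₃ = a3 N + r * a1 N + q 2 * t

    W : WModel ℚ
    W = wm A₁ A₂ A₃ 0ℚ 0ℚ

    r-2g : X (g ⊞ g) ≡ third-x N r r s
    r-2g = Line.sum-x (proj₁ (proj₂ tangent-at-g))

    -- The new a₄ vanishes because `s` is the slope of the tangent at `g`; the new a₆ vanishes
    -- because `g` lies on the curve.
    A₄≡0 : a4 N - s * a3 N + q 2 * r * a2 N - (t + r * s) * a1 N + q 3 * r * r - q 2 * s * t ≡ 0ℚ
    A₄≡0 = lin₁ (- 1ℚ) (proj₂ (proj₂ tangent-at-g)) (identity (a1 N) (a2 N) (a3 N) (a4 N) r s t)
      where
      identity = solve 7 (λ a₁ a₂ a₃ a₄ r s t →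
        a₄ ⊖ s ⊗ a₃ ⊕ Κ (q 2) ⊗ r ⊗ a₂ ⊖ (t ⊕ r ⊗ s) ⊗ a₁ ⊕ Κ (q 3) ⊗ r ⊗ r ⊖ Κ (q 2) ⊗ s ⊗ t ⊖ Κ 0ℚ ≋
        ⊝ Κ 1ℚ ⊗ (s ⊗ (Κ (q 2) ⊗ t ⊕ a₁ ⊗ r ⊕ a₃) ⊖ (Κ (q 3) ⊗ r ⊗ r ⊕ Κ (q 2) ⊗ a₂ ⊗ r ⊕ a₄ ⊖ a₁ ⊗ t))) refl

    A₆≡0 : a6 N + r * a4 N + r * r * a2 N + r * r * r - t * a3 N - t * t - r * t * a1 N ≡ 0ℚ
    A₆≡0 = lin₁ (- 1ℚ) (on-curve g≢e) (identity (a1 N) (a2 N) (a3 N) (a4 N) (a6 N) r t)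
      where
      identity = solve 7 (λ a₁ a₂ a₃ a₄ a₆ r t →
        a₆ ⊕ r ⊗ a₄ ⊕ r ⊗ r ⊗ a₂ ⊕ r ⊗ r ⊗ r ⊖ t ⊗ a₃ ⊖ t ⊗ t ⊖ r ⊗ t ⊗ a₁ ⊖ Κ 0ℚ ≋
        ⊝ Κ 1ℚ ⊗ (t ⊗ t ⊕ a₁ ⊗ r ⊗ t ⊕ a₃ ⊗ t ⊖ (r ⊗ r ⊗ r ⊕ a₂ ⊗ r ⊗ r ⊕ a₄ ⊗ r ⊕ a₆))) refl

    isoW : IsoQ N W
    isoW = 1ℚ , r , s , t , (λ ()) , *-identityˡ A₁ , k₂ A₂ , k₃ A₃ , trans (k₄ 0ℚ) (sym A₄≡0) , trans (k₆ 0ℚ) (sym A₆≡0)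
      where
      k₂ = solve 1 (λ x → Κ 1ℚ ⊗ Κ 1ℚ ⊗ x ≋ x) refl
      k₃ = solve 1 (λ x → Κ 1ℚ ⊗ Κ 1ℚ ⊗ Κ 1ℚ ⊗ x ≋ x) refl
      k₄ = solve 1 (λ x → Κ 1ℚ ⊗ Κ 1ℚ ⊗ Κ 1ℚ ⊗ Κ 1ℚ ⊗ x ≋ x) refl
      k₆ = solve 1 (λ x → Κ 1ℚ ⊗ Κ 1ℚ ⊗ Κ 1ℚ ⊗ Κ 1ℚ ⊗ Κ 1ℚ ⊗ Κ 1ℚ ⊗ x ≋ x) refl

    N≡ : N ≡ change 1ℚ r s t W
    N≡ = proj₂ (proj₂ (proj₂ (proj₂ (proj₂ (isoQ⇒change N W isoW)))))

    module τ = Transport 1ℚ 1ℚ r s t refl W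

    embW : Embeds T W
    embW = τ.φ-embeds T (subst (Embeds T) N≡ embN)

    private module V = Coordinates embW

    f-subst : ∀ {N N′} (eq : N ≡ N′) (em : Embeds T N) h → proj₁ (subst (Embeds T) eq em) h ≡ proj₁ em h
    f-subst refl em h = refl

    fW : ∀ {h} → h ≢ e → proj₁ embW h ≡ τ.φ (aff (X h) (Y h))
    fW {h} h≢e = cong τ.φ (trans (f-subst N≡ embN h) (affine h≢e))

    X-shift : ∀ {h} → h ≢ e → X h ≡ V.X h + r
    X-shift {h} h≢e = trans (identity (X h) r) (cong (_+ r) (sym (cong V.point-x (fW h≢e))))
      where
      identity = solve 2 (λ x r → x ≋ Κ 1ℚ ⊗ Κ 1ℚ ⊗ (x ⊖ r) ⊕ r) refl

    X-g : V.X g ≡ 0ℚ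
    X-g = trans (cong V.point-x (fW g≢e)) (identity r)
      where
      identity = solve 1 (λ r → Κ 1ℚ ⊗ Κ 1ℚ ⊗ (r ⊖ r) ≋ Κ 0ℚ) refl

    Y-g : V.Y g ≡ 0ℚ
    Y-g = trans (cong V.point-y (fW g≢e)) (identity r s t)
      where
      identity = solve 3 (λ r s t → Κ 1ℚ ⊗ Κ 1ℚ ⊗ Κ 1ℚ ⊗ (t ⊖ s ⊗ (r ⊖ r) ⊖ t) ≋ Κ 0ℚ) refl

  -- N in the coordinates for which g = (0, 0) has a horizontal tangent.
  record Normalised (g : Carrier T) : Set where
    field
      s A₁ A₂ A₃ : ℚ
      A₁-def : a1 N + q 2 * s ≡ A₁
      A₂-def : a2 N - s * a1 N + q 3 * X g - s * s ≡ A₂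
      A₃-def : a3 N + X g * a1 N + q 2 * Y g ≡ A₃
      A₄≡0   : a4 N - s * a3 N + q 2 * X g * a2 N - (Y g + X g * s) * a1 N + q 3 * X g * X g - q 2 * s * Y g ≡ 0ℚ
      A₆≡0   : a6 N + X g * a4 N + X g * X g * a2 N + X g * X g * X g - Y g * a3 N - Y g * Y g - X g * Y g * a1 N ≡ 0ℚ
      2g-x   : X (g ⊞ g) ≡ third-x N (X g) (X g) s
      embW   : Embeds T (wm A₁ A₂ A₃ 0ℚ 0ℚ)
      X-g    : Coordinates.X embW g ≡ 0ℚ
      Y-g    : Coordinates.Y embW g ≡ 0ℚ
      shift  : ∀ {h} → h ≢ e → X h ≡ Coordinates.X embW h + X g

  normalise : ∀ g → g ≢ e → g ⊞ g ≢ e → Normalised g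
  normalise g g≢e 2g≢e = record
    { s = s ; A₁ = A₁ ; A₂ = A₂ ; A₃ = A₃ ; A₁-def = refl ; A₂-def = refl ; A₃-def = refl ; A₄≡0 = A₄≡0 ; A₆≡0 = A₆≡0
    ; 2g-x = r-2g ; embW = embW ; X-g = X-g ; Y-g = Y-g ; shift = X-shift }
    where open At-order≥3 g g≢e 2g≢e

-- If e is one root of 4x³ + b₂x² + 2b₄x + b₆, any other root x has (8x + b₂ + 4e)² equal to the
-- discriminant of the complementary quadratic factor.
complementary-root : ∀ {B₂ B₄ B₆ e x} → q 4 * e * e * e + B₂ * e * e + q 2 * B₄ * e + B₆ ≡ 0ℚ →
  q 4 * x * x * x + B₂ * x * x + q 2 * B₄ * x + B₆ ≡ 0ℚ → x ≢ e →
  (q 8 * x + (B₂ + q 4 * e)) * (q 8 * x + (B₂ + q 4 * e)) ≡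
  (B₂ + q 4 * e) * (B₂ + q 4 * e) - q 16 * (q 2 * B₄ + e * (B₂ + q 4 * e))
complementary-root {B₂} {B₄} {B₆} {e} {x} he hx x≢e =
  lin₁ (q 16) (zero-product {x - e} (lin₂ 1ℚ (- 1ℚ) hx he (factor B₂ B₄ B₆ e x)) (λ h → x≢e (x-y≡0⇒x≡y h))) (complete B₂ B₄ e x)
  where
  factor = solve 5 (λ B₂ B₄ B₆ e x →
    (x ⊖ e) ⊗ (Κ (q 4) ⊗ x ⊗ x ⊕ (B₂ ⊕ Κ (q 4) ⊗ e) ⊗ x ⊕ (Κ (q 2) ⊗ B₄ ⊕ e ⊗ (B₂ ⊕ Κ (q 4) ⊗ e))) ⊖ Κ 0ℚ ≋
    Κ 1ℚ ⊗ (Κ (q 4) ⊗ x ⊗ x ⊗ x ⊕ B₂ ⊗ x ⊗ x ⊕ Κ (q 2) ⊗ B₄ ⊗ x ⊕ B₆ ⊖ Κ 0ℚ) ⊕ ⊝ Κ 1ℚ ⊗ (Κ (q 4) ⊗ e ⊗ e ⊗ e ⊕ B₂ ⊗ e ⊗ e ⊕ Κ (q 2) ⊗ B₄ ⊗ e ⊕ B₆ ⊖ Κ 0ℚ)) refl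
  complete = solve 4 (λ B₂ B₄ e x →
    (Κ (q 8) ⊗ x ⊕ (B₂ ⊕ Κ (q 4) ⊗ e)) ⊗ (Κ (q 8) ⊗ x ⊕ (B₂ ⊕ Κ (q 4) ⊗ e)) ⊖
    ((B₂ ⊕ Κ (q 4) ⊗ e) ⊗ (B₂ ⊕ Κ (q 4) ⊗ e) ⊖ Κ (q 16) ⊗ (Κ (q 2) ⊗ B₄ ⊕ e ⊗ (B₂ ⊕ Κ (q 4) ⊗ e))) ≋
    Κ (q 16) ⊗ (Κ (q 4) ⊗ x ⊗ x ⊕ (B₂ ⊕ Κ (q 4) ⊗ e) ⊗ x ⊕ (Κ (q 2) ⊗ B₄ ⊕ e ⊗ (B₂ ⊕ Κ (q 4) ⊗ e)) ⊖ Κ 0ℚ)) refl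

square-quotient : ∀ y i K {d} → y * y ≡ K * K * d → K * i ≡ 1ℚ → y * i * (y * i) ≡ d
square-quotient y i K {d} h Ki≡1 = lin₂ (i * i) (d * (K * i + 1ℚ)) h Ki≡1 (identity y i K d)
  where
  identity = solve 4 (λ y i K d → y ⊗ i ⊗ (y ⊗ i) ⊖ d ≋ i ⊗ i ⊗ (y ⊗ y ⊖ K ⊗ K ⊗ d) ⊕ d ⊗ (K ⊗ i ⊕ Κ 1ℚ) ⊗ (K ⊗ i ⊖ Κ 1ℚ)) refl

-- Relations between the parameters forced by the orders of points

module Relations {T : TorsionGroup} {A₁ A₂ A₃ : ℚ} (embW : Embeds T (wm A₁ A₂ A₃ 0ℚ 0ℚ)) (g : Carrier T)
              (X-g : Coordinates.X embW g ≡ 0ℚ) (Y-g : Coordinates.Y embW g ≡ 0ℚ)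
              (g≢e : g ≢ (zero , zero)) (2g≢e : addC T g g ≢ (zero , zero)) where
  open Origin embW g X-g Y-g g≢e 2g≢e public

  module AfterForm₄ (F : Form₄) (3g≢e : g₃ ≢ e) (g≢2g : g ≢ g₂) where
    open Form₄ F

    k : ℚ
    k = u + γ

    γ≢0 : γ ≢ 0ℚ
    γ≢0 γ≡0 = distinct 2g≢e g≢2g 3g≢e (trans X₂≡ (trans (cong (λ x → - (x * ε)) γ≡0) (vanish ε)))
      where
      vanish = solve 1 (λ ε → ⊝ (Κ 0ℚ ⊗ ε) ≋ Κ 0ℚ) refl

    ε≢0 : ε ≢ 0ℚ
    ε≢0 ε≡0 = distinct 2g≢e g≢2g 3g≢e (trans X₂≡ (trans (cong (λ x → - (γ * x)) ε≡0) (vanish γ)))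
      where
      vanish = solve 1 (λ γ → ⊝ (γ ⊗ Κ 0ℚ) ≋ Κ 0ℚ) refl

    u≢0 : u ≢ 0ℚ
    u≢0 u≡0 = A₃≢0 (trans A₃≡ (trans (cong (_* (γ * ε)) u≡0) (*-zeroˡ (γ * ε))))

    -- `m + γ` is the slope of the line through P and 4P. The third relation follows from the first
    -- two only after cancelling `γ²`, which is impossible modulo 2 when `γ` is even; hence it is
    -- recorded.
    record Ninefold : Set where
      constructor ninefold
      field
        m         : ℚ
        relation₁ : m * k ≡ γ * ε
        relation₂ : m * (γ + m - k - ε) ≡ γ * k
        relation₃ : m * (k + ε) ≡ k * k + k * ε + ε * ε

    -- 5P = −4P.
    nine : g₄ ≢ e → g ≢ g₄ → g₅ ≢ e → g₄ ⊞ g₅ ≡ e → Ninefold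
    nine 4g≢e g≢4g 5g≢e 9g≡e = from (line-through 4g≢e g≢4g 5g≢e) (proj₁ (opposites 4g≢e 5g≢e 9g≡e))
      where
      from : (∃[ l ] l * X g₄ ≡ Y g₄ × X g₅ ≡ l * l + A₁ * l - A₂ - X g₄ × Y g₅ ≡ - ((l + A₁) * X g₅) - A₃) → X g₅ ≡ X g₄ → Ninefold
      from (l , slope , x₅ , _) x₅≡x₄ = ninefold m r₁ r₂ r₃
        where
        m = l - γ
        e₁ = solve 4 (λ l γ k ε → γ ⊗ ((l ⊖ γ) ⊗ k) ⊖ γ ⊗ (γ ⊗ ε) ≋ Κ 1ℚ ⊗ (l ⊗ (γ ⊗ k) ⊖ γ ⊗ γ ⊗ (k ⊕ ε))) refl
        r₁ : m * k ≡ γ * ε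
        r₁ = cancel γ≢0 (lin₁ 1ℚ (trans (cong (l *_) (sym X₄≡)) (trans slope Y₄≡)) (e₁ l γ k ε))
        eq₅ : γ * k ≡ l * l + (u - ε) * l - γ * ε - γ * k
        eq₅ = trans (sym X₄≡) (trans (trans (sym x₅≡x₄) x₅) (three A₁≡ A₂≡ X₄≡))
          where
          three : ∀ {a₁ a₂ x} → a₁ ≡ u - ε → a₂ ≡ γ * ε → x ≡ γ * k → l * l + a₁ * l - a₂ - x ≡ l * l + (u - ε) * l - γ * ε - γ * k
          three refl refl refl = refl
        e₂ = solve 4 (λ l γ u ε → let m = l ⊖ γ in m ⊗ (γ ⊕ m ⊖ (u ⊕ γ) ⊖ ε) ⊖ γ ⊗ (u ⊕ γ) ≋
             ⊝ Κ 1ℚ ⊗ (γ ⊗ (u ⊕ γ) ⊖ (l ⊗ l ⊕ (u ⊖ ε) ⊗ l ⊖ γ ⊗ ε ⊖ γ ⊗ (u ⊕ γ))) ⊕ ⊝ (Κ 1ℚ ⊕ Κ 1ℚ) ⊗ (m ⊗ (u ⊕ γ) ⊖ γ ⊗ ε)) refl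
        r₂ : m * (γ + m - k - ε) ≡ γ * k
        r₂ = lin₂ (- 1ℚ) (- (1ℚ + 1ℚ)) eq₅ r₁ (e₂ l γ u ε)
        e₃ = solve 4 (λ m γ k ε → γ ⊗ γ ⊗ (m ⊗ (k ⊕ ε)) ⊖ γ ⊗ γ ⊗ (k ⊗ k ⊕ k ⊗ ε ⊕ ε ⊗ ε) ≋
             γ ⊗ (k ⊖ m ⊕ ε) ⊗ (m ⊗ k ⊖ γ ⊗ ε) ⊕ k ⊗ γ ⊗ (m ⊗ (γ ⊕ m ⊖ k ⊖ ε) ⊖ γ ⊗ k)) refl
        r₃ : m * (k + ε) ≡ k * k + k * ε + ε * ε
        r₃ = cancel (*-≢0 γ≢0 γ≢0) (lin₂ (γ * (k - m + ε)) (k * γ) r₁ r₂ (e₃ m γ k ε))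

    -- 4P is a point of order 2.
    eight : g₄ ≢ e → g₄ ⊞ g₄ ≡ e → q 2 * γ * γ + γ * (q 3 * u + ε) + u * u ≡ 0ℚ
    eight 4g≢e 8g≡e = zero-product {γ} (lin₁ 1ℚ (trans (sym (eq A₁≡ A₃≡ X₄≡ Y₄≡)) (two-torsion 4g≢e 8g≡e)) (identity u ε γ)) γ≢0
      where
      eq : ∀ {a₁ a₃ x y} → a₁ ≡ u - ε → a₃ ≡ u * (γ * ε) → x ≡ γ * (u + γ) → y ≡ γ * γ * (u + γ + ε) →
           q 2 * y + a₁ * x + a₃ ≡ q 2 * (γ * γ * (u + γ + ε)) + (u - ε) * (γ * (u + γ)) + u * (γ * ε)
      eq refl refl refl refl = refl
      identity = solve 3 (λ u ε γ → γ ⊗ (Κ (q 2) ⊗ γ ⊗ γ ⊕ γ ⊗ (Κ (q 3) ⊗ u ⊕ ε) ⊕ u ⊗ u) ⊖ Κ 0ℚ ≋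
                 Κ 1ℚ ⊗ (Κ (q 2) ⊗ (γ ⊗ γ ⊗ (u ⊕ γ ⊕ ε)) ⊕ (u ⊖ ε) ⊗ (γ ⊗ (u ⊕ γ)) ⊕ u ⊗ (γ ⊗ ε) ⊖ Κ 0ℚ)) refl

    -- The other points of order 2 are rational.
    eight-two : g₄ ≢ e → g₄ ⊞ g₄ ≡ e → ∀ τ → τ ≢ e → τ ⊞ τ ≡ e → X τ ≢ X g₄ → ∃[ v ] v * v ≡ q 8 * γ * γ + q 8 * γ * u + u * u
    eight-two 4g≢e 8g≡e τ τ≢e 2τ≡e Xτ≢ = from (inverse K≢0)
      where
      ρ = eight 4g≢e 8g≡e
      A₂≡′ : A₂ ≡ - ((u + γ) * (u + q 2 * γ))
      A₂≡′ = trans A₂≡ (lin₁ 1ℚ ρ (identity u ε γ))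
        where
        identity = solve 3 (λ u ε γ → γ ⊗ ε ⊖ ⊝ ((u ⊕ γ) ⊗ (u ⊕ Κ (q 2) ⊗ γ)) ≋ Κ 1ℚ ⊗ (Κ (q 2) ⊗ γ ⊗ γ ⊕ γ ⊗ (Κ (q 3) ⊗ u ⊕ ε) ⊕ u ⊗ u ⊖ Κ 0ℚ)) refl
      u+2γ≢0 : u + q 2 * γ ≢ 0ℚ
      u+2γ≢0 h = *-≢0 γ≢0 ε≢0 (trans (sym A₂≡) (trans A₂≡′ (trans (cong (λ x → - ((u + γ) * x)) h) (vanish (u + γ)))))
        where
        vanish = solve 1 (λ x → ⊝ (x ⊗ Κ 0ℚ) ≋ Κ 0ℚ) refl
      -- Eliminating `ε` through `ρ` costs a factor `γ` in `A₁`, so `S` and the constant term of the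
      -- complementary quadratic are multiplied by `γ²`. Its discriminant, multiplied by `γ⁴`,
      -- becomes `K²` times the number to be shown a square.
      K = u * ((u + q 2 * γ) * (u + q 2 * γ))
      K≢0 : K ≢ 0ℚ
      K≢0 = *-≢0 u≢0 (*-≢0 u+2γ≢0 u+2γ≢0)
      B₂ = A₁ * A₁ + q 4 * A₂
      B₄ = q 2 * 0ℚ + A₁ * A₃
      a = u * u + q 4 * u * γ + q 2 * γ * γ
      α₂ = - ((u + γ) * (u + q 2 * γ))
      S = B₂ + q 4 * X g₄
      w = q 8 * X τ + S
      w² : w * w ≡ S * S - q 16 * (q 2 * B₄ + X g₄ * S)
      w² = complementary-root {B₂} {B₄} {A₃ * A₃ + q 4 * 0ℚ} {X g₄} {X τ} (ψ₂²-root 4g≢e 8g≡e) (ψ₂²-root τ≢e 2τ≡e) Xτ≢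
      A₁γ : A₁ * γ ≡ a
      A₁γ = trans (cong (_* γ) A₁≡) (lin₁ (- 1ℚ) ρ (identity u ε γ))
        where
        identity = solve 3 (λ u ε γ → (u ⊖ ε) ⊗ γ ⊖ (u ⊗ u ⊕ Κ (q 4) ⊗ u ⊗ γ ⊕ Κ (q 2) ⊗ γ ⊗ γ) ≋ ⊝ Κ 1ℚ ⊗ (Κ (q 2) ⊗ γ ⊗ γ ⊕ γ ⊗ (Κ (q 3) ⊗ u ⊕ ε) ⊕ u ⊗ u ⊖ Κ 0ℚ)) refl
      β = a * a + q 4 * (α₂ + γ * (u + γ)) * γ * γ
      Sγ² : S * (γ * γ) ≡ β
      Sγ² = lin₃ (A₁ * γ + a) (q 4 * γ * γ) (q 4 * γ * γ) A₁γ A₂≡′ X₄≡ (identity A₁ A₂ (X g₄) γ a α₂ (γ * (u + γ)))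
        where
        identity = solve 7 (λ A₁ A₂ x γ a α₂ x′ → (A₁ ⊗ A₁ ⊕ Κ (q 4) ⊗ A₂ ⊕ Κ (q 4) ⊗ x) ⊗ (γ ⊗ γ) ⊖ (a ⊗ a ⊕ Κ (q 4) ⊗ (α₂ ⊕ x′) ⊗ γ ⊗ γ) ≋
                   (A₁ ⊗ γ ⊕ a) ⊗ (A₁ ⊗ γ ⊖ a) ⊕ Κ (q 4) ⊗ γ ⊗ γ ⊗ (A₂ ⊖ α₂) ⊕ Κ (q 4) ⊗ γ ⊗ γ ⊗ (x ⊖ x′)) refl
      κ = q 2 * a * γ * (u * α₂) + γ * (u + γ) * β
      A₃≡′ : A₃ ≡ u * α₂
      A₃≡′ = trans A₃≡ (cong (u *_) (trans (sym A₂≡) A₂≡′))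
      Cγ² : (q 2 * B₄ + X g₄ * S) * (γ * γ) ≡ κ
      Cγ² = trans (cong₂ (λ a₃ x → (q 2 * (q 2 * 0ℚ + A₁ * a₃) + x * S) * (γ * γ)) A₃≡′ X₄≡)
              (lin₂ (q 2 * γ * (u * α₂)) (γ * (u + γ)) A₁γ Sγ² (identity A₁ (u * α₂) (γ * (u + γ)) S γ a β))
        where
        identity = solve 7 (λ A₁ c x S γ a β → (Κ (q 2) ⊗ (Κ (q 2) ⊗ Κ 0ℚ ⊕ A₁ ⊗ c) ⊕ x ⊗ S) ⊗ (γ ⊗ γ) ⊖ (Κ (q 2) ⊗ a ⊗ γ ⊗ c ⊕ x ⊗ β) ≋
                   Κ (q 2) ⊗ γ ⊗ c ⊗ (A₁ ⊗ γ ⊖ a) ⊕ x ⊗ (S ⊗ (γ ⊗ γ) ⊖ β)) refl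
      square : w * (γ * γ) * (w * (γ * γ)) ≡ K * K * (q 8 * γ * γ + q 8 * γ * u + u * u)
      square = trans (lin₃ (γ * γ * (γ * γ)) (S * (γ * γ) + β) (- (q 16 * γ * γ)) w² Sγ² Cγ² (identity₁ w S (q 2 * B₄ + X g₄ * S) γ β κ)) (identity₂ u γ)
        where
        identity₁ = solve 6 (λ w S C γ β κ → w ⊗ (γ ⊗ γ) ⊗ (w ⊗ (γ ⊗ γ)) ⊖ (β ⊗ β ⊖ Κ (q 16) ⊗ κ ⊗ γ ⊗ γ) ≋
                    γ ⊗ γ ⊗ (γ ⊗ γ) ⊗ (w ⊗ w ⊖ (S ⊗ S ⊖ Κ (q 16) ⊗ C)) ⊕ (S ⊗ (γ ⊗ γ) ⊕ β) ⊗ (S ⊗ (γ ⊗ γ) ⊖ β) ⊕ ⊝ (Κ (q 16) ⊗ γ ⊗ γ) ⊗ (C ⊗ (γ ⊗ γ) ⊖ κ)) refl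
        identity₂ = solve 2 (λ u γ →
          let a = u ⊗ u ⊕ Κ (q 4) ⊗ u ⊗ γ ⊕ Κ (q 2) ⊗ γ ⊗ γ
              α₂ = ⊝ ((u ⊕ γ) ⊗ (u ⊕ Κ (q 2) ⊗ γ))
              β = a ⊗ a ⊕ Κ (q 4) ⊗ (α₂ ⊕ γ ⊗ (u ⊕ γ)) ⊗ γ ⊗ γ
              κ = Κ (q 2) ⊗ a ⊗ γ ⊗ (u ⊗ α₂) ⊕ γ ⊗ (u ⊕ γ) ⊗ β
              K = u ⊗ ((u ⊕ Κ (q 2) ⊗ γ) ⊗ (u ⊕ Κ (q 2) ⊗ γ))
          in β ⊗ β ⊖ Κ (q 16) ⊗ κ ⊗ γ ⊗ γ ≋ K ⊗ K ⊗ (Κ (q 8) ⊗ γ ⊗ γ ⊕ Κ (q 8) ⊗ γ ⊗ u ⊕ u ⊗ u)) refl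
      from : ∃[ i ] K * i ≡ 1ℚ → ∃[ v ] v * v ≡ q 8 * γ * γ + q 8 * γ * u + u * u
      from (i , Ki≡1) = w * (γ * γ) * i ,
        square-quotient (w * (γ * γ)) i K square Ki≡1

  module Order4 (4g≡e : g₂ ⊞ g₂ ≡ e) where
    -- 2P = (-A₂, A₁A₂ - A₃) has order 2, and its tangent denominator is `A₁ * A₂ - A₃`.
    A₃≡A₁A₂ : A₃ ≡ A₁ * A₂
    A₃≡A₁A₂ = lin₃ (- 1ℚ) (q 2) A₁ (two-torsion 2g≢e 4g≡e) (proj₂ line-2g) (proj₁ line-2g) (identity A₁ A₂ A₃ (X g₂) (Y g₂))
      where
      identity = solve 5 (λ A₁ A₂ A₃ x y → A₃ ⊖ A₁ ⊗ A₂ ≋ ⊝ Κ 1ℚ ⊗ (Κ (q 2) ⊗ y ⊕ A₁ ⊗ x ⊕ A₃ ⊖ Κ 0ℚ) ⊕ Κ (q 2) ⊗ (y ⊖ (A₁ ⊗ A₂ ⊖ A₃)) ⊕ A₁ ⊗ (x ⊖ ⊝ A₂)) refl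

    A₁≢0 : A₁ ≢ 0ℚ
    A₁≢0 h = A₃≢0 (trans A₃≡A₁A₂ (trans (cong (_* A₂) h) (*-zeroˡ A₂)))

    -- The quadratic complementary to the root x(2P) has discriminant `A₁²(A₁² - 16A₂)`, which must
    -- be a square when `τ` is rational.
    four-two : ∀ τ → τ ≢ e → τ ⊞ τ ≡ e → X τ ≢ X g₂ → ∃[ v ] v * v ≡ A₁ * A₁ - q 16 * A₂
    four-two τ τ≢e 2τ≡e Xτ≢ = from (inverse A₁≢0)
      where
      x = X g₂
      S = A₁ * A₁ + q 4 * A₂ + q 4 * x
      w = q 8 * X τ + S
      w² : w * w ≡ S * S - q 16 * (q 2 * (q 2 * 0ℚ + A₁ * A₃) + x * S)
      w² = complementary-root {A₁ * A₁ + q 4 * A₂} {q 2 * 0ℚ + A₁ * A₃} {A₃ * A₃ + q 4 * 0ℚ} {x} {X τ} (ψ₂²-root 2g≢e 4g≡e) (ψ₂²-root τ≢e 2τ≡e) Xτ≢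
      w²′ : w * w ≡ A₁ * A₁ * (A₁ * A₁ - q 16 * A₂)
      w²′ = trans w² (eq (proj₁ line-2g) A₃≡A₁A₂)
        where
        identity = solve 2 (λ A₁ A₂ → let S = A₁ ⊗ A₁ ⊕ Κ (q 4) ⊗ A₂ ⊕ Κ (q 4) ⊗ ⊝ A₂
                   in S ⊗ S ⊖ Κ (q 16) ⊗ (Κ (q 2) ⊗ (Κ (q 2) ⊗ Κ 0ℚ ⊕ A₁ ⊗ (A₁ ⊗ A₂)) ⊕ ⊝ A₂ ⊗ S) ≋ A₁ ⊗ A₁ ⊗ (A₁ ⊗ A₁ ⊖ Κ (q 16) ⊗ A₂)) refl
        eq : ∀ {x a₃} → x ≡ - A₂ → a₃ ≡ A₁ * A₂ → let S = A₁ * A₁ + q 4 * A₂ + q 4 * x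
             in S * S - q 16 * (q 2 * (q 2 * 0ℚ + A₁ * a₃) + x * S) ≡ A₁ * A₁ * (A₁ * A₁ - q 16 * A₂)
        eq refl refl = identity A₁ A₂
      from : ∃[ i ] A₁ * i ≡ 1ℚ → ∃[ v ] v * v ≡ A₁ * A₁ - q 16 * A₂
      from (i , Ai≡1) = w * i , square-quotient w i A₁ w²′ Ai≡1

  module Order3 (3g≡e : g ⊞ g₂ ≡ e) where
    -- As 2P = -P, the abscissae -A₂ of 2P and 0 of P agree.
    A₂≡0 : A₂ ≡ 0ℚ
    A₂≡0 = lin₃ 1ℚ (- 1ℚ) (- 1ℚ) (proj₁ line-2g) (proj₁ (opposites g≢e 2g≢e 3g≡e)) X-g (identity A₂ (X g) (X g₂))
      where
      identity = solve 3 (λ A₂ x x₂ → A₂ ⊖ Κ 0ℚ ≋ Κ 1ℚ ⊗ (x₂ ⊖ ⊝ A₂) ⊕ ⊝ Κ 1ℚ ⊗ (x₂ ⊖ x) ⊕ ⊝ Κ 1ℚ ⊗ (x ⊖ Κ 0ℚ)) refl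

    module WithTwo (τ : Carrier T) (τ≢e : τ ≢ e) (2τ≡e : τ ⊞ τ ≡ e) where
      root : q 4 * X τ * X τ * X τ + (A₁ * X τ + A₃) * (A₁ * X τ + A₃) ≡ 0ℚ
      root = lin₂ 1ℚ (- (q 4 * X τ * X τ)) (ψ₂²-root τ≢e 2τ≡e) A₂≡0 (identity A₁ A₂ A₃ (X τ))
        where
        identity = solve 4 (λ A₁ A₂ A₃ x → Κ (q 4) ⊗ x ⊗ x ⊗ x ⊕ (A₁ ⊗ x ⊕ A₃) ⊗ (A₁ ⊗ x ⊕ A₃) ⊖ Κ 0ℚ ≋
          Κ 1ℚ ⊗ (Κ (q 4) ⊗ x ⊗ x ⊗ x ⊕ (A₁ ⊗ A₁ ⊕ Κ (q 4) ⊗ A₂) ⊗ x ⊗ x ⊕ Κ (q 2) ⊗ (Κ (q 2) ⊗ Κ 0ℚ ⊕ A₁ ⊗ A₃) ⊗ x ⊕ (A₃ ⊗ A₃ ⊕ Κ (q 4) ⊗ Κ 0ℚ) ⊖ Κ 0ℚ) ⊕ ⊝ (Κ (q 4) ⊗ x ⊗ x) ⊗ (A₂ ⊖ Κ 0ℚ)) refl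

      Xτ≢0 : X τ ≢ 0ℚ
      Xτ≢0 h = A₃≢0 (square≡0 (trans (sym (identity A₁ A₃)) (subst (λ x → q 4 * x * x * x + (A₁ * x + A₃) * (A₁ * x + A₃) ≡ 0ℚ) h root)))
        where
        identity = solve 2 (λ A₁ A₃ → Κ (q 4) ⊗ Κ 0ℚ ⊗ Κ 0ℚ ⊗ Κ 0ℚ ⊕ (A₁ ⊗ Κ 0ℚ ⊕ A₃) ⊗ (A₁ ⊗ Κ 0ℚ ⊕ A₃) ≋ A₃ ⊗ A₃) refl

      record Root : Set where
        constructor is-root
        field
          k   : ℚ
          X≡  : X τ ≡ - (k * k)
          A₃≡ : A₃ ≡ k * k * (A₁ + q 2 * k)

      -- `4x³ = - (A₁x + A₃)²` makes -x the square of `k = - (A₁x + A₃)/(2x)`; with this sign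
      -- `A₃ = k²(A₁ + 2k)`.
      square-root : Root
      square-root = from (inverse (*-≢0 {q 2} (λ ()) Xτ≢0))
        where
        from : ∃[ i ] q 2 * X τ * i ≡ 1ℚ → Root
        from (i , h) = is-root k X≡ A₃≡
          where
          x = X τ
          k = - ((A₁ * x + A₃) * i)
          X≡ : x ≡ - (k * k)
          X≡ = lin₂ (i * i) (- (x * (q 2 * x * i + 1ℚ))) root h (identity A₁ A₃ x i)
            where
            identity = solve 4 (λ A₁ A₃ x i → let k = ⊝ ((A₁ ⊗ x ⊕ A₃) ⊗ i) in x ⊖ ⊝ (k ⊗ k) ≋
              i ⊗ i ⊗ (Κ (q 4) ⊗ x ⊗ x ⊗ x ⊕ (A₁ ⊗ x ⊕ A₃) ⊗ (A₁ ⊗ x ⊕ A₃) ⊖ Κ 0ℚ) ⊕ ⊝ (x ⊗ (Κ (q 2) ⊗ x ⊗ i ⊕ Κ 1ℚ)) ⊗ (Κ (q 2) ⊗ x ⊗ i ⊖ Κ 1ℚ)) refl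
          A₃≡ : A₃ ≡ k * k * (A₁ + q 2 * k)
          A₃≡ = lin₂ (- (A₁ * x + A₃)) (- (A₁ + q 2 * k)) h X≡ (identity A₁ A₃ x i)
            where
            identity = solve 4 (λ A₁ A₃ x i → let k = ⊝ ((A₁ ⊗ x ⊕ A₃) ⊗ i) in A₃ ⊖ k ⊗ k ⊗ (A₁ ⊕ Κ (q 2) ⊗ k) ≋
              ⊝ (A₁ ⊗ x ⊕ A₃) ⊗ (Κ (q 2) ⊗ x ⊗ i ⊖ Κ 1ℚ) ⊕ ⊝ (A₁ ⊕ Κ (q 2) ⊗ k) ⊗ (x ⊖ ⊝ (k ⊗ k))) refl

      -- X Q + k² is the square root of the product of differences of the 2-torsion abscissae.
      halved : ∀ (root : Root) → let open Root root in ∀ Q → Q ≢ e → Q ⊞ Q ≡ τ →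
               (X Q + k * k) * (X Q + k * k) ≡ k * k * k * (A₁ + q 3 * k)
      halved (is-root k X≡ A₃≡) Q Q≢e 2Q≡τ = x-y≡0⇒x≡y (square≡0 (trans (sym (identity A₁ k x)) (evaluate A₂≡0 A₃≡)))
        where
        x = X Q
        dup : X τ * ψ₂² W x ≡ φ₂ W x
        dup = subst (λ h → X h * ψ₂² W x ≡ φ₂ W x) 2Q≡τ (duplication Q≢e (λ h → τ≢e (trans (sym 2Q≡τ) h)))
        φ+k²ψ : φ₂ W x + k * k * ψ₂² W x ≡ 0ℚ
        φ+k²ψ = lin₂ (- 1ℚ) (ψ₂² W x) dup X≡ (identity′ (X τ) (ψ₂² W x) (φ₂ W x) k)
          where
          identity′ = solve 4 (λ x₂ ψ φ k → φ ⊕ k ⊗ k ⊗ ψ ⊖ Κ 0ℚ ≋ ⊝ Κ 1ℚ ⊗ (x₂ ⊗ ψ ⊖ φ) ⊕ ψ ⊗ (x₂ ⊖ ⊝ (k ⊗ k))) refl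
        evaluate : A₂ ≡ 0ℚ → A₃ ≡ k * k * (A₁ + q 2 * k) →
                   φ₂ (wm A₁ 0ℚ (k * k * (A₁ + q 2 * k)) 0ℚ 0ℚ) x + k * k * ψ₂² (wm A₁ 0ℚ (k * k * (A₁ + q 2 * k)) 0ℚ 0ℚ) x ≡ 0ℚ
        evaluate h₂ h₃ = subst₂ (λ a₂ a₃ → φ₂ (wm A₁ a₂ a₃ 0ℚ 0ℚ) x + k * k * ψ₂² (wm A₁ a₂ a₃ 0ℚ 0ℚ) x ≡ 0ℚ) h₂ h₃ φ+k²ψ
        -- For roots e, e′, e″ of `ψ₂²`, the quartic φ₂ - e ψ₂² is the square of (x - e)² - (e -
        -- e′)(e - e″). Here e = -k², and the product of differences is `k³(A₁ + 3k)`.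
        identity = solve 3 (λ A₁ k x →
          let A₃ = k ⊗ k ⊗ (A₁ ⊕ Κ (q 2) ⊗ k)
              B₂ = A₁ ⊗ A₁ ⊕ Κ (q 4) ⊗ Κ 0ℚ
              B₄ = Κ (q 2) ⊗ Κ 0ℚ ⊕ A₁ ⊗ A₃
              B₆ = A₃ ⊗ A₃ ⊕ Κ (q 4) ⊗ Κ 0ℚ
              B₈ = A₁ ⊗ A₁ ⊗ Κ 0ℚ ⊕ Κ (q 4) ⊗ Κ 0ℚ ⊗ Κ 0ℚ ⊖ A₁ ⊗ A₃ ⊗ Κ 0ℚ ⊕ Κ 0ℚ ⊗ A₃ ⊗ A₃ ⊖ Κ 0ℚ ⊗ Κ 0ℚ
              d = (x ⊕ k ⊗ k) ⊗ (x ⊕ k ⊗ k) ⊖ k ⊗ k ⊗ k ⊗ (A₁ ⊕ Κ (q 3) ⊗ k)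
          in x ⊗ x ⊗ x ⊗ x ⊖ B₄ ⊗ x ⊗ x ⊖ Κ (q 2) ⊗ B₆ ⊗ x ⊖ B₈ ⊕ k ⊗ k ⊗ (Κ (q 4) ⊗ x ⊗ x ⊗ x ⊕ B₂ ⊗ x ⊗ x ⊕ Κ (q 2) ⊗ B₄ ⊗ x ⊕ B₆) ≋ d ⊗ d) refl

      -- The remaining points of order 2 are rational, with n = A₁/2 + k.
      split : ∀ (root : Root) → let open Root root in ∀ n → A₁ ≡ q 2 * (n - k) →
              ∀ τ′ → τ′ ≢ e → τ′ ⊞ τ′ ≡ e → X τ′ ≢ X τ → ∃[ v ] v * v ≡ n * n - q 4 * n * k
      split (is-root k X≡ A₃≡) n A₁≡ τ′ τ′≢e 2τ′≡e X≢ = from (inverse (*-≢0 {q 4} (λ ()) n≢0))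
        where
        n≢0 : n ≢ 0ℚ
        n≢0 h = A₃≢0 (trans A₃≡ (trans (cong (λ a → k * k * (a + q 2 * k)) (trans A₁≡ (cong (λ n → q 2 * (n - k)) h))) (vanish k)))
          where
          vanish = solve 1 (λ k → k ⊗ k ⊗ (Κ (q 2) ⊗ (Κ 0ℚ ⊖ k) ⊕ Κ (q 2) ⊗ k) ≋ Κ 0ℚ) refl
        x = X τ
        S = A₁ * A₁ + q 4 * A₂ + q 4 * x
        w = q 8 * X τ′ + S
        w² : w * w ≡ S * S - q 16 * (q 2 * (q 2 * 0ℚ + A₁ * A₃) + x * S)
        w² = complementary-root {A₁ * A₁ + q 4 * A₂} {q 2 * 0ℚ + A₁ * A₃} {A₃ * A₃ + q 4 * 0ℚ} {x} {X τ′} (ψ₂²-root τ≢e 2τ≡e) (ψ₂²-root τ′≢e 2τ′≡e) X≢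
        w²′ : w * w ≡ q 4 * n * (q 4 * n) * (n * n - q 4 * n * k)
        w²′ = trans w² (eq A₂≡0 X≡ A₃≡ A₁≡)
          where
          identity = solve 2 (λ n k →
            let A₁ = Κ (q 2) ⊗ (n ⊖ k)
                S = A₁ ⊗ A₁ ⊕ Κ (q 4) ⊗ Κ 0ℚ ⊕ Κ (q 4) ⊗ ⊝ (k ⊗ k)
            in S ⊗ S ⊖ Κ (q 16) ⊗ (Κ (q 2) ⊗ (Κ (q 2) ⊗ Κ 0ℚ ⊕ A₁ ⊗ (k ⊗ k ⊗ (A₁ ⊕ Κ (q 2) ⊗ k))) ⊕ ⊝ (k ⊗ k) ⊗ S) ≋ Κ (q 4) ⊗ n ⊗ (Κ (q 4) ⊗ n) ⊗ (n ⊗ n ⊖ Κ (q 4) ⊗ n ⊗ k)) refl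
          eq : ∀ {a₁ a₂ a₃ x} → a₂ ≡ 0ℚ → x ≡ - (k * k) → a₃ ≡ k * k * (a₁ + q 2 * k) → a₁ ≡ q 2 * (n - k) →
               let S = a₁ * a₁ + q 4 * a₂ + q 4 * x
               in S * S - q 16 * (q 2 * (q 2 * 0ℚ + a₁ * a₃) + x * S) ≡ q 4 * n * (q 4 * n) * (n * n - q 4 * n * k)
          eq refl refl refl refl = identity n k
        from : ∃[ i ] q 4 * n * i ≡ 1ℚ → ∃[ v ] v * v ≡ n * n - q 4 * n * k
        from (i , h) = w * i , square-quotient w i (q 4 * n) w²′ h

-- The primes 2 and 3

-- Conditions on (a₁, a₂, a₃), the first five modulo 2 and the last two modulo 3, invariant under
-- x = x′ + r, y = y′ + s x′ + t. Modulo 2 the reduction is cuspidal (a₁, a₃ even), supersingular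
-- (a₁ even, a₃ odd), or, with the terminology of nodes, split (a₁ odd, a₂ + a₃ even) or nonsplit
-- (a₁ odd, a₂ + a₃ odd).
module Conditions {n : ℕ} where
  supersingular cuspidal-or-nonsplit supersingular-or-nonsplit not-split a₁-even b₂≡0 b₂≡2 : Expr n → Expr n → Expr n → Expr n
  -- Every condition, even a disjunction, is a single polynomial vanishing modulo p, the form of
  -- statement that a `Constraint` expresses.
  supersingular x₁ x₂ x₃             = (con (+ 1) :+ x₁) :* x₃ :+ con (+ 1)
  cuspidal-or-nonsplit x₁ x₂ x₃      = x₁ :+ x₃ :+ x₁ :* x₂
  supersingular-or-nonsplit x₁ x₂ x₃ = con (+ 1) :+ x₃ :+ x₁ :* x₂
  not-split x₁ x₂ x₃                 = x₁ :* (con (+ 1) :+ x₂ :+ x₃)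
  a₁-even x₁ x₂ x₃                   = x₁
  b₂≡0 x₁ x₂ x₃                      = x₁ :* x₁ :+ x₂
  b₂≡2 x₁ x₂ x₃                      = x₁ :* x₁ :+ x₂ :+ con (+ 1)

open Conditions

-- Polymorphic in the number of variables, so one condition can be asserted of (a₁, a₂, a₃), of the
-- translated coefficients and of the parameters of a normal form.
Condition : Set
Condition = ∀ {n} → Expr n → Expr n → Expr n → Expr n

v₀ : ∀ {n} → Expr (1 ℕ.+ n)
v₀ = var zero
v₁ : ∀ {n} → Expr (2 ℕ.+ n)
v₁ = var (suc zero)
v₂ : ∀ {n} → Expr (3 ℕ.+ n)
v₂ = var (suc (suc zero))
v₃ : ∀ {n} → Expr (4 ℕ.+ n)
v₃ = var (suc (suc (suc zero)))
v₄ : ∀ {n} → Expr (5 ℕ.+ n)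
v₄ = var (suc (suc (suc (suc zero))))
v₅ : ∀ {n} → Expr (6 ℕ.+ n)
v₅ = var (suc (suc (suc (suc (suc zero)))))

-- Local arguments common to both primes

module Place (p : ℕ) (p-prime : Prime p) where
  open Residues p p-prime public
  open Integrality p p-prime public

  div-*-div : ∀ i j {x y} → Div i x → Div j y → Div (i ℕ.+ j) (x * y)
  div-*-div i j {x} {y} (div z Iz refl) (div z′ Iz′ refl) = div (z * z′) (Iz *ᴵ Iz′)
    (trans (regroup (ι (pᵏ i)) (ι (pᵏ j)) z z′) (cong (_* (z * z′)) (sym (trans (cong (λ k → ι (+ k)) (ℕₚ.^-distribˡ-+-* p i j))
      (trans (cong ι (Zₚ.pos-* (p ℕ.^ i) (p ℕ.^ j))) (ι-* (pᵏ i) (pᵏ j)))))))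
    where
    regroup = solve 4 (λ a b z z′ → a ⊗ z ⊗ (b ⊗ z′) ≋ a ⊗ b ⊗ (z ⊗ z′)) refl

  MinimalModel : WModel ℤ → Set
  MinimalModel M = ∀ {r s t} → Integral r → Integral s → Integral t →
    let xs = coefficients (toQ M) r s t in
    Div 1 (⟦ c₁ ⟧ xs) → Div 2 (⟦ c₂ ⟧ xs) → Div 3 (⟦ c₃ ⟧ xs) → Div 4 (⟦ c₄ ⟧ xs) → Div 6 (⟦ c₆ ⟧ xs) → ⊥

  Satisfies : Condition → ℚ → ℚ → ℚ → Set
  Satisfies o a₁ a₂ a₃ = Div 1 (⟦ o v₀ v₁ v₂ ⟧ (a₁ ∷ᵛ a₂ ∷ᵛ a₃ ∷ᵛ []ᵛ))

  Satisfied : Condition → WModel ℤ → Set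
  Satisfied o M = Satisfies o (ι (a1 M)) (ι (a2 M)) (ι (a3 M))

  subst₃ : ∀ (o : Condition) {x y z x′ y′ z′} → x ≡ x′ → y ≡ y′ → z ≡ z′ → Satisfies o x y z → Satisfies o x′ y′ z′
  subst₃ o refl refl refl h = h

  module OnMinimal (M : WModel ℤ) {G : TorsionGroup} (emb : Embeds G (toQ M)) where
    N : WModel ℚ
    N = toQ M

    open TateForm {G} {N} emb public

    J₁ : Integral (a1 N)
    J₁ = ι-integral (a1 M)
    J₂ : Integral (a2 N)
    J₂ = ι-integral (a2 M)
    J₃ : Integral (a3 N)
    J₃ = ι-integral (a3 M)
    J₄ : Integral (a4 N)
    J₄ = ι-integral (a4 M)
    J₆ : Integral (a6 N)
    J₆ = ι-integral (a6 M)

    open Model N J₁ J₂ J₃ J₄ J₆ public hiding (J₂; J₄; J₆; c; c′)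

    double : ∀ {h k} → h ≢ e → k ≢ e → h ⊞ h ≡ k → X k * ψ₂² N (X h) ≡ φ₂ N (X h)
    double {h} h≢e k≢e 2h≡k = subst (λ k → X k * ψ₂² N (X h) ≡ φ₂ N (X h)) 2h≡k (duplication h≢e (λ eq → k≢e (trans (sym 2h≡k) eq)))

    negatives : ∀ {h k} → h ≢ e → k ≢ e → h ⊞ k ≡ e → X k ≡ X h
    negatives h≢e k≢e h⊞k≡e = proj₁ (opposites h≢e k≢e h⊞k≡e)

    module IntegralForm (g : Carrier G) (g≢e : g ≢ e) (2g≢e : g ⊞ g ≢ e) (form : Normalised g)
                        (Ir : Integral (X g)) (I2 : Integral (X (g ⊞ g))) where
      open Normalised form public
      module O = Relations embW g X-g Y-g g≢e 2g≢e

      r t : ℚ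
      r = X g
      t = Y g

      Is : Integral s
      Is = slope-integral {r} {r} {X (g ⊞ g)} {s} 2g-x Ir Ir I2

      It : Integral t
      It = y-integral r t (on-curve g≢e) Ir

      IA₁ : Integral A₁
      IA₁ = subst Integral A₁-def (J₁ +ᴵ ι-integral (+ 2) *ᴵ Is)
      IA₂ : Integral A₂
      IA₂ = subst Integral A₂-def (J₂ -ᴵ Is *ᴵ J₁ +ᴵ ι-integral (+ 3) *ᴵ Ir -ᴵ Is *ᴵ Is)
      IA₃ : Integral A₃
      IA₃ = subst Integral A₃-def (J₃ +ᴵ Ir *ᴵ J₁ +ᴵ ι-integral (+ 2) *ᴵ It)

      IX : ∀ {h} → h ≢ e → Integral (X h) → Integral (O.X h)
      IX {h} h≢e I = subst Integral (lin₁ 1ℚ (shift h≢e) (identity (X h) r (O.X h))) (I -ᴵ Ir)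
        where
        identity = solve 3 (λ x r x′ → x ⊖ r ⊖ x′ ≋ Κ 1ℚ ⊗ (x ⊖ (x′ ⊕ r))) refl

      shift₁ shift₂ shift₃ : Expr 6
      shift₁ = v₀ :+ con (+ 2) :* v₄
      shift₂ = v₁ :- v₄ :* v₀ :+ con (+ 3) :* v₃ :- v₄ :* v₄
      shift₃ = v₂ :+ v₃ :* v₀ :+ con (+ 2) :* v₅

      xs : Vec ℚ 6
      xs = ι (a1 M) ∷ᵛ ι (a2 M) ∷ᵛ ι (a3 M) ∷ᵛ r ∷ᵛ s ∷ᵛ t ∷ᵛ []ᵛ

      Shifted : Condition → Set
      Shifted o = Div 1 (⟦ o shift₁ shift₂ shift₃ ⟧ xs)

      -- Invariance under translation is itself an implication between congruences modulo p, so it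
      -- too is verified on residues.
      invariant : (o : Condition) → T (check 1 ((1 ∥ o v₀ v₁ v₂) ∷ []) (1 ∥ o shift₁ shift₂ shift₃)) →
                  Div 1 (⟦ o v₀ v₁ v₂ ⟧ xs) → Shifted o
      invariant o checked d = by-residues 1 ((1 ∥ o v₀ v₁ v₂) ∷ []) (1 ∥ o shift₁ shift₂ shift₃) checked
        (J₁ ∷ᴵ J₂ ∷ᴵ J₃ ∷ᴵ Ir ∷ᴵ Is ∷ᴵ It ∷ᴵ []ᴵ) (d ∷ᵃ []ᵃ)

      Shifted′ : Condition → Set
      Shifted′ o = Satisfies o (a1 N + q 2 * s) (a2 N - s * a1 N + q 3 * r - s * s) (a3 N + r * a1 N + q 2 * t)

      normal-form : (o : Condition) → ∀ {x y z} → A₁ ≡ x → A₂ ≡ y → A₃ ≡ z → Shifted′ o → Satisfies o x y z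
      normal-form o p₁ p₂ p₃ = subst₃ o (trans A₁-def p₁) (trans A₂-def p₂) (trans A₃-def p₃)

      -- The transformed a₄ and a₆ are zero, so these three divisibilities are all that separates
      -- the translated model from one that can be scaled down.
      not-all-divisible : MinimalModel M → Div 1 A₁ → Div 2 A₂ → Div 3 A₃ → ⊥
      not-all-divisible minimal d₁ d₂ d₃ = minimal Ir Is It (subst (Div 1) (sym A₁-def) d₁) (subst (Div 2) (sym A₂-def) d₂) (subst (Div 3) (sym A₃-def) d₃) (div-zero A₄≡0) (div-zero A₆≡0)

      module WithForm₃ (F : O.Form₃) (I₃g : Integral (O.X O.g₃)) where
        open O.Form₃ F

        -- `ε` satisfies the monic equation `ε² + A₁ε = x(3P)`.
        Iε : Integral ε
        Iε = root₂ A₁ (- (O.X O.g₃)) IA₁ (-ᴵ I₃g) (lin₂ ε (- 1ℚ) A₁≡ X₃≡ (identity A₁ u ε (O.X O.g₃)))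
          where
          identity = solve 4 (λ A₁ u ε x → ε ⊗ ε ⊕ A₁ ⊗ ε ⊕ ⊝ x ⊖ Κ 0ℚ ≋ ε ⊗ (A₁ ⊖ (u ⊖ ε)) ⊕ ⊝ Κ 1ℚ ⊗ (x ⊖ u ⊗ ε)) refl

        Iu : Integral u
        Iu = subst Integral (lin₁ 1ℚ A₁≡ (identity A₁ u ε)) (IA₁ +ᴵ Iε)
          where
          identity = solve 3 (λ A₁ u ε → A₁ ⊕ ε ⊖ u ≋ Κ 1ℚ ⊗ (A₁ ⊖ (u ⊖ ε))) refl

      module WithForm₄ (F : O.Form₄) (I₃g : Integral (O.X O.g₃)) where
        open O.Form₄ F

        F₃ : O.Form₃
        F₃ = O.form₃ u ε A₁≡ (trans A₃≡ (cong (u *_) (sym A₂≡))) (trans X₂≡ (cong (λ x → - x) (sym A₂≡))) X₃≡ Y₃≡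

        open WithForm₃ F₃ I₃g public

        normal₄ : (o : Condition) → Shifted′ o → Satisfies o (u - ε) (γ * ε) (u * (γ * ε))
        normal₄ o = normal-form o A₁≡ A₂≡ A₃≡

        condition₄ᵉ : ∀ {n} → Condition → Constraint (3 ℕ.+ n)
        condition₄ᵉ o = 1 ∥ o (v₀ :- v₁) (v₂ :* v₁) (v₀ :* (v₂ :* v₁))

        -- `γ` satisfies the monic equation `γ² + uγ = x(4P)`.
        γ-root : Integral (O.X O.g₄) → Integral γ
        γ-root I₄g = root₂ u (- (O.X O.g₄)) Iu (-ᴵ I₄g) (lin₁ (- 1ℚ) X₄≡ (identity u γ (O.X O.g₄)))
          where
          identity = solve 3 (λ u γ x → γ ⊗ γ ⊕ u ⊗ γ ⊕ ⊝ x ⊖ Κ 0ℚ ≋ ⊝ Κ 1ℚ ⊗ (x ⊖ γ ⊗ (u ⊕ γ))) refl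

        -- `A₁`, `A₂`, `A₃` are homogeneous of degrees 1, 2, 3 in `u`, `ε`, `γ`.
        not-all-divisible₄ : MinimalModel M → Div 1 u → Div 1 ε → Div 1 γ → ⊥
        not-all-divisible₄ minimal du dε dγ = not-all-divisible minimal
          (subst (Div 1) (sym A₁≡) (div-+ du (div-neg dε)))
          (subst (Div 2) (sym A₂≡) (div-*-div 1 1 dγ dε))
          (subst (Div 3) (sym A₃≡) (div-*-div 1 2 du (div-*-div 1 1 dγ dε)))

    module FiveForm (g : Carrier G) (form : Normalised g) (o : Order₅ g) where
      open Order₅ o public

      double₁ : X (2× g) * ψ₂² N (X g) ≡ φ₂ N (X g)
      double₁ = double g≢e 2g≢e refl

      double₂ : X g * ψ₂² N (X (2× g)) ≡ φ₂ N (X (2× g))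
      double₂ = trans (cong (_* ψ₂² N (X (2× g))) (negatives 4g≢e g≢e 4g⊞g≡e)) (double 2g≢e 4g≢e refl)

      module WithIntegral (I₁ : Integral (X g)) (I₂ : Integral (X (2× g))) where
        open IntegralForm g g≢e 2g≢e form I₁ I₂ public
        F = O.Multiples-of-g.to-form₃ 3g≢e g≢2g
        open O.Form₃ F public
        open WithForm₃ F (IX 3g≢e (subst Integral (sym (negatives 2g≢e 3g≢e 2g⊞3g≡e)) I₂)) public

        -- 3P = -2P, so the abscissae `u * ε` and `- A₂` agree.
        A₂≡ : A₂ ≡ - (u * ε)
        A₂≡ = lin₃ 1ℚ 1ℚ (- 1ℚ) X₂≡ (proj₁ (O.opposites 2g≢e 3g≢e 2g⊞3g≡e)) X₃≡ (identity A₂ u ε (O.X O.g₂) (O.X O.g₃))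
          where
          identity = solve 5 (λ A₂ u ε x₂ x₃ → A₂ ⊖ ⊝ (u ⊗ ε) ≋ Κ 1ℚ ⊗ (x₂ ⊖ ⊝ A₂) ⊕ Κ 1ℚ ⊗ (x₃ ⊖ x₂) ⊕ ⊝ Κ 1ℚ ⊗ (x₃ ⊖ u ⊗ ε)) refl

        A₃≡′ : A₃ ≡ u * - (u * ε)
        A₃≡′ = trans A₃≡ (cong (u *_) A₂≡)

        not-all-divisible₅ : MinimalModel M → Div 1 u → Div 1 ε → ⊥
        not-all-divisible₅ minimal du dε = not-all-divisible minimal
            (subst (Div 1) (sym A₁≡) (div-+ du (div-neg dε)))
            (subst (Div 2) (sym A₂≡) (div-neg (div-*-div 1 1 du dε)))
            (subst (Div 3) (sym A₃≡′) (div-*-div 1 2 du (div-neg (div-*-div 1 1 du dε))))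

        normal : (o : Condition) → Shifted′ o → Satisfies o (u - ε) (- (u * ε)) (u * - (u * ε))
        normal o = normal-form o A₁≡ A₂≡ A₃≡′

        conditionᵉ : ∀ {n} → Condition → Constraint (2 ℕ.+ n)
        conditionᵉ o = 1 ∥ o (v₀ :- v₁) (:- (v₀ :* v₁)) (v₀ :* :- (v₀ :* v₁))

    module SevenForm (g : Carrier G) (form : Normalised g) (o : Order₇ g) where
      open Order₇ o public

      double₁ : X (2× g) * ψ₂² N (X g) ≡ φ₂ N (X g)
      double₁ = double g≢e 2g≢e refl

      double₂ : X (4× g) * ψ₂² N (X (2× g)) ≡ φ₂ N (X (2× g))
      double₂ = double 2g≢e 4g≢e 2g⊞2g≡4g

      double₃ : X g * ψ₂² N (X (4× g)) ≡ φ₂ N (X (4× g))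
      double₃ = double 4g≢e g≢e 4g⊞4g≡g

      module WithIntegral (I₁ : Integral (X g)) (I₂ : Integral (X (2× g))) (I₄ : Integral (X (4× g))) where
        open IntegralForm g g≢e 2g≢e form I₁ I₂ public
        F = O.Multiples-of-g.to-form₄ 3g≢e g≢2g 4g≢e g≢3g
        open O.Form₄ F public
        open WithForm₄ F (IX 3g≢e (subst Integral (negatives 3g≢e 4g≢e 3g⊞4g≡e) I₄)) public

        Iγ : Integral γ
        Iγ = γ-root (IX 4g≢e I₄)

        relation : γ * (u + γ) ≡ u * ε
        relation = trans (sym X₄≡) (trans (proj₁ (O.opposites 3g≢e 4g≢e 3g⊞4g≡e)) X₃≡)

        relationᵉ : Constraint 3
        relationᵉ = 1 ∥ v₂ :* (v₀ :+ v₂) :- v₀ :* v₁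

    module EightForm (g : Carrier G) (form : Normalised g) (o : Order₈ g) (I₂ : Integral (X (2× g))) where
      open Order₈ o public

      I₁ : Integral (X g)
      I₁ = half-integral (X g) (Y g) (X (2× g)) (on-curve g≢e) (double g≢e 2g≢e refl) I₂

      -- 6P = -2P, so doubling 3P leads to the abscissa of 2P.
      I₃ : Integral (X (3× g))
      I₃ = half-integral (X (3× g)) (Y (3× g)) (X (2× g)) (on-curve 3g≢e)
             (trans (cong (_* ψ₂² N (X (3× g))) (sym (negatives 2g≢e 6g≢e 2g⊞6g≡e))) (double 3g≢e 6g≢e refl)) I₂

      open IntegralForm g g≢e 2g≢e form I₁ I₂ public
      F = O.Multiples-of-g.to-form₄ 3g≢e g≢2g 4g≢e g≢3g
      open O.Form₄ F public
      open WithForm₄ F (IX 3g≢e I₃) public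
      module A = O.AfterForm₄ F 3g≢e g≢2g

      relation : q 2 * γ * γ + γ * (q 3 * u + ε) + u * u ≡ 0ℚ
      relation = A.eight 4g≢e 4g⊞4g≡e

      relationᵉ : ∀ {n} → Constraint (3 ℕ.+ n)
      relationᵉ = 1 ∥ con (+ 2) :* v₂ :* v₂ :+ v₂ :* (con (+ 3) :* v₀ :+ v₁) :+ v₀ :* v₀

      second-two : ∀ {τ} → Order₂ τ → Apart τ (4× g) → ∃[ v ] v * v ≡ q 8 * γ * γ + q 8 * γ * u + u * u
      second-two {τ} (order₂ τ≢e 2τ≡e) τ-4g = A.eight-two 4g≢e 4g⊞4g≡e τ τ≢e 2τ≡e (O.X-distinct τ≢e 4g≢e τ-4g)

      v-integral : Integral γ → ∀ v → v * v ≡ q 8 * γ * γ + q 8 * γ * u + u * u → Integral v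
      v-integral Iγ v v² = sqrt-integral v² (ι-integral (+ 8) *ᴵ Iγ *ᴵ Iγ +ᴵ ι-integral (+ 8) *ᴵ Iγ *ᴵ Iu +ᴵ Iu *ᴵ Iu)

-- The prime 2

module At2 where
  open Place 2 two-prime public

  parity : ∀ {x} → Integral x → Div 1 x ⊎ Div 1 (x - 1ℚ)
  parity {x} Ix = from (residue 1 Ix)
    where
    from : ∃[ c ] c ℕ.< 2 × Div 1 (x - ι (+ c)) → Div 1 x ⊎ Div 1 (x - 1ℚ)
    from (zero , _ , d)    = inj₁ (subst (Div 1) (minus-0 x) d)
      where
      minus-0 = solve 1 (λ x → x ⊖ Κ 0ℚ ≋ x) refl
    from (suc zero , _ , d) = inj₂ d
    from (suc (suc c) , ℕ.s≤s (ℕ.s≤s ()) , _)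

  module On (M : WModel ℤ) {G : TorsionGroup} (emb : Embeds G (toQ M)) where
    open OnMinimal M emb public
    open Integrality₂ N using (module Model₂)
    open Model₂ J₁ J₂ J₃ J₄ J₆ public using (cyclic-integral; quarter-integral)

    module Two {h : Carrier G} (o : Order₂ h) where
      open Order₂ o renaming (g≢e to h≢e; 2g≡e to 2h≡e)

      -- With a₁ even and a₃ odd, `ψ₂²` is constantly 1 modulo 2 and has no integral root. At a pole
      -- b₂ is even, hence so is `c W`, and `4 + W * c W` is 4 modulo 8.
      avoids : ¬ Satisfied supersingular M
      avoids d = from (pole-or-integral (X h) (Y h) (on-curve h≢e))
        where
        root = ψ₂²-root h≢e 2h≡e
        even-a₁ : Div 1 (a1 N)
        even-a₁ = by-residues 1 ((1 ∥ supersingular v₀ v₁ v₂) ∷ []) (1 ∥ v₀) tt (J₁ ∷ᴵ J₂ ∷ᴵ J₃ ∷ᴵ []ᴵ) (d ∷ᵃ []ᵃ)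
        from : Integral (X h) ⊎ Pole (X h) → ⊥
        from (inj₁ Ix) = ¬div-1 (by-residues 1
          ((1 ∥ supersingular v₀ v₁ v₂) ∷
           (1 ∥ con (+ 4) :* x :* x :* x :+ (v₀ :* v₀ :+ con (+ 4) :* v₁) :* x :* x :+
                con (+ 2) :* (con (+ 2) :* v₃ :+ v₀ :* v₂) :* x :+ (v₂ :* v₂ :+ con (+ 4) :* v₄)) ∷ [])
          (1 ∥ con (+ 1)) tt (J₁ ∷ᴵ J₂ ∷ᴵ J₃ ∷ᴵ J₄ ∷ᴵ J₆ ∷ᴵ Ix ∷ᴵ []ᴵ) (d ∷ᵃ div-zero root ∷ᵃ []ᵃ))
          where
          x : Expr 6
          x = v₅
        from (inj₂ (pole W IW dW xW≡1)) = ¬div-1 (by-residues 3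
          ((2 ∥ v₀) ∷ (1 ∥ v₁) ∷ (3 ∥ con (+ 4) :+ v₀ :* v₁) ∷ []) (1 ∥ con (+ 1)) tt (IW ∷ᴵ Ic ∷ᴵ []ᴵ)
          (dW ∷ᵃ dc ∷ᵃ div-zero (no-root {X h} {W} xW≡1 root) ∷ᵃ []ᵃ))
          where
          module Mod = Model N J₁ J₂ J₃ J₄ J₆
          Ic : Integral (Mod.c W)
          Ic = Mod.c-integral IW
          dc : Div 1 (Mod.c W)
          dc = by-residues 1 ((1 ∥ v₀) ∷ (1 ∥ v₂) ∷ [])
            (1 ∥ (v₀ :* v₀ :+ con (+ 4) :* v₁) :+ con (+ 2) :* v₃ :* v₂ :+ v₄ :* v₂ :* v₂) tt
            (J₁ ∷ᴵ J₂ ∷ᴵ IW ∷ᴵ Mod.J₄ ∷ᴵ Mod.J₆ ∷ᴵ []ᴵ) (even-a₁ ∷ᵃ div-pred dW ∷ᵃ []ᵃ)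

    module Five (g : Carrier G) (form : Normalised g) (o : Order₅ g) where
      open FiveForm g form o
      open WithIntegral
        (cyclic-integral (X g) (Y g) (X (2× g)) (on-curve g≢e) double₁ (via (X g) double₂ []ᵈ))
        (cyclic-integral (X (2× g)) (Y (2× g)) (X g) (on-curve 2g≢e) double₂ (via (X (2× g)) double₁ []ᵈ))

      -- In the parameters the condition reads `u + ε + u * ε` modulo 2, which vanishes only when
      -- both are even.
      avoids : MinimalModel M → ¬ Satisfied cuspidal-or-nonsplit M
      avoids minimal d = not-all-divisible₅ minimal (conclude v₀ tt) (conclude v₁ tt)
        where
        conclude : (x : Expr 2) → T (check 1 (conditionᵉ cuspidal-or-nonsplit ∷ []) (1 ∥ x)) → Div 1 (⟦ x ⟧ (u ∷ᵛ ε ∷ᵛ []ᵛ))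
        conclude x checked = by-residues 1 (conditionᵉ cuspidal-or-nonsplit ∷ []) (1 ∥ x) checked (Iu ∷ᴵ Iε ∷ᴵ []ᴵ)
          (normal cuspidal-or-nonsplit (invariant cuspidal-or-nonsplit tt d) ∷ᵃ []ᵃ)

    module Seven (g : Carrier G) (form : Normalised g) (o : Order₇ g) where
      open SevenForm g form o
      open WithIntegral
        (cyclic-integral (X g) (Y g) (X (2× g)) (on-curve g≢e) double₁ (via (X (4× g)) double₂ (via (X g) double₃ []ᵈ)))
        (cyclic-integral (X (2× g)) (Y (2× g)) (X (4× g)) (on-curve 2g≢e) double₂ (via (X g) double₃ (via (X (2× g)) double₁ []ᵈ)))
        (cyclic-integral (X (4× g)) (Y (4× g)) (X g) (on-curve 4g≢e) double₃ (via (X (2× g)) double₁ (via (X (4× g)) double₂ []ᵈ)))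

      avoids : MinimalModel M → ¬ Satisfied not-split M
      avoids minimal d = not-all-divisible₄ minimal (conclude v₀ tt) (conclude v₁ tt) (conclude v₂ tt)
        where
        hypotheses : List (Constraint 3)
        hypotheses = condition₄ᵉ not-split ∷ relationᵉ ∷ []
        conclude : (x : Expr 3) → T (check 1 hypotheses (1 ∥ x)) → Div 1 (⟦ x ⟧ (u ∷ᵛ ε ∷ᵛ γ ∷ᵛ []ᵛ))
        conclude x checked = by-residues 1 hypotheses (1 ∥ x) checked (Iu ∷ᴵ Iε ∷ᴵ Iγ ∷ᴵ []ᴵ)
          (normal₄ not-split (invariant not-split tt d) ∷ᵃ div-eq relation ∷ᵃ []ᵃ)

    module Nine (g : Carrier G) (form : Normalised g) (o : Order₉ g) where
      open Order₉ o

      2g 3g 4g : Carrier G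
      2g = 2× g
      3g = 3× g
      4g = 4× g

      double₁ = double g≢e 2g≢e refl
      double₂ = double 2g≢e 4g≢e 2g⊞2g≡4g

      double₄ : X g * ψ₂² N (X 4g) ≡ φ₂ N (X 4g)
      double₄ = trans (cong (_* ψ₂² N (X 4g)) (negatives 8g≢e g≢e 8g⊞g≡e)) (double 4g≢e 8g≢e refl)

      double₃ : X 3g * ψ₂² N (X 3g) ≡ φ₂ N (X 3g)
      double₃ = trans (cong (_* ψ₂² N (X 3g)) (negatives 6g≢e 3g≢e 6g⊞3g≡e)) (double 3g≢e 6g≢e refl)

      I₁ : Integral (X g)
      I₁ = cyclic-integral (X g) (Y g) (X 2g) (on-curve g≢e) double₁ (via (X 4g) double₂ (via (X g) double₄ []ᵈ))

      I₂ : Integral (X 2g)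
      I₂ = cyclic-integral (X 2g) (Y 2g) (X 4g) (on-curve 2g≢e) double₂ (via (X g) double₄ (via (X 2g) double₁ []ᵈ))

      I₄ : Integral (X 4g)
      I₄ = cyclic-integral (X 4g) (Y 4g) (X g) (on-curve 4g≢e) double₄ (via (X 2g) double₁ (via (X 4g) double₂ []ᵈ))

      I₃ : Integral (X 3g)
      I₃ = cyclic-integral (X 3g) (Y 3g) (X 3g) (on-curve 3g≢e) double₃ []ᵈ

      open IntegralForm g g≢e 2g≢e form I₁ I₂
      F = O.Multiples-of-g.to-form₄ 3g≢e g≢2g 4g≢e g≢3g
      open O.Form₄ F
      open WithForm₄ F (IX 3g≢e I₃)
      module A = O.AfterForm₄ F 3g≢e g≢2g
      open A.Ninefold (A.nine 4g≢e g≢4g 5g≢e 4g⊞5g≡e)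

      Iγ : Integral γ
      Iγ = γ-root (IX 4g≢e I₄)

      Im : Integral m
      Im = root₂ (γ - (u + γ) - ε) (- (γ * (u + γ))) (Iγ -ᴵ (Iu +ᴵ Iγ) -ᴵ Iε) (-ᴵ (Iγ *ᴵ (Iu +ᴵ Iγ)))
             (lin₁ 1ℚ relation₂ (identity m γ (u + γ) ε))
        where
        identity = solve 4 (λ m γ k ε → m ⊗ m ⊕ (γ ⊖ k ⊖ ε) ⊗ m ⊕ ⊝ (γ ⊗ k) ⊖ Κ 0ℚ ≋ Κ 1ℚ ⊗ (m ⊗ (γ ⊕ m ⊖ k ⊖ ε) ⊖ γ ⊗ k)) refl

      avoids : MinimalModel M → ¬ Satisfied not-split M
      avoids minimal d = not-all-divisible₄ minimal (conclude v₀ tt) (conclude v₁ tt) (conclude v₂ tt)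
        where
        k : Expr 4
        k = v₀ :+ v₂
        hypotheses : List (Constraint 4)
        hypotheses = condition₄ᵉ not-split ∷
          (1 ∥ v₃ :* k :- v₂ :* v₁) ∷ (1 ∥ v₃ :* (v₂ :+ v₃ :- k :- v₁) :- v₂ :* k) ∷ (1 ∥ v₃ :* (k :+ v₁) :- (k :* k :+ k :* v₁ :+ v₁ :* v₁)) ∷ []
        conclude : (x : Expr 4) → T (check 1 hypotheses (1 ∥ x)) → Div 1 (⟦ x ⟧ (u ∷ᵛ ε ∷ᵛ γ ∷ᵛ m ∷ᵛ []ᵛ))
        conclude x checked = by-residues 1 hypotheses (1 ∥ x) checked (Iu ∷ᴵ Iε ∷ᴵ Iγ ∷ᴵ Im ∷ᴵ []ᴵ)
          (normal₄ not-split (invariant not-split tt d) ∷ᵃ div-eq relation₁ ∷ᵃ div-eq relation₂ ∷ᵃ div-eq relation₃ ∷ᵃ []ᵃ)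

    module Eight (g : Carrier G) (form : Normalised g) (o : Order₈ g) where
      private
        I₂g : Integral (X (2× g))
        I₂g = quarter-integral (X (2× g)) (Y (2× g)) (X (4× g)) (on-curve 2g≢e) (double 2g≢e 4g≢e 2g⊞2g≡4g) (ψ₂²-root 4g≢e 4g⊞4g≡e)
          where open Order₈ o
      open EightForm g form o I₂g

      -- γ may have a pole, when 4P reduces to the identity; then w = 1/(2γ).
      module AtPole (w : ℚ) (Iw : Integral w) (γw≡1 : γ * (π * w) ≡ 1ℚ) where
        -- Modulo 2 this says `1 + w * (u + ε) ≡ 0`. Since `ε` is even by `ε≡`, both `w` and `u` are
        -- odd, and `A₁` is odd.
        unit : 1ℚ + w * (q 3 * u + ε) + q 2 * w * w * u * u ≡ 0ℚ
        unit = lin₂ (q 2 * w * w) (- (q 2 * γ * w + 1ℚ + w * (q 3 * u + ε))) relation γw≡1 (identity u ε γ w)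
          where
          identity = solve 4 (λ u ε γ w → Κ 1ℚ ⊕ w ⊗ (Κ (q 3) ⊗ u ⊕ ε) ⊕ Κ (q 2) ⊗ w ⊗ w ⊗ u ⊗ u ⊖ Κ 0ℚ ≋
            Κ (q 2) ⊗ w ⊗ w ⊗ (Κ (q 2) ⊗ γ ⊗ γ ⊕ γ ⊗ (Κ (q 3) ⊗ u ⊕ ε) ⊕ u ⊗ u ⊖ Κ 0ℚ) ⊕ ⊝ (Κ (q 2) ⊗ γ ⊗ w ⊕ Κ 1ℚ ⊕ w ⊗ (Κ (q 3) ⊗ u ⊕ ε)) ⊗ (γ ⊗ (Κ (q 2) ⊗ w) ⊖ Κ 1ℚ)) refl
        ε≡ : ε ≡ q 2 * w * A₂
        ε≡ = lin₂ (- (q 2 * w)) (- ε) A₂≡ γw≡1 (identity ε γ w A₂)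
          where
          identity = solve 4 (λ ε γ w A₂ → ε ⊖ Κ (q 2) ⊗ w ⊗ A₂ ≋ ⊝ (Κ (q 2) ⊗ w) ⊗ (A₂ ⊖ γ ⊗ ε) ⊕ ⊝ ε ⊗ (γ ⊗ (Κ (q 2) ⊗ w) ⊖ Κ 1ℚ)) refl
        A₃≡′ : A₃ ≡ u * A₂
        A₃≡′ = trans A₃≡ (cong (u *_) (sym A₂≡))
        integrals : AllV Integral (u ∷ᵛ ε ∷ᵛ w ∷ᵛ A₂ ∷ᵛ []ᵛ)
        integrals = Iu ∷ᴵ Iε ∷ᴵ Iw ∷ᴵ IA₂ ∷ᴵ []ᴵ
        unitᵉ εᵉ : Constraint 4
        unitᵉ = 1 ∥ con (+ 1) :+ v₂ :* (con (+ 3) :* v₀ :+ v₁) :+ con (+ 2) :* v₂ :* v₂ :* v₀ :* v₀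
        εᵉ = 1 ∥ v₁ :- con (+ 2) :* v₂ :* v₃

      avoids : MinimalModel M → ¬ Satisfied supersingular-or-nonsplit M
      avoids minimal d = by-pole (valuation γ)
        where
        by-pole : Valuation γ → ⊥
        by-pole (integer Iγ) = not-all-divisible₄ minimal (conclude v₀ tt) (conclude v₁ tt) (conclude v₂ tt)
          where
          hypotheses : List (Constraint 3)
          hypotheses = condition₄ᵉ supersingular-or-nonsplit ∷ relationᵉ ∷ []
          conclude : (x : Expr 3) → T (check 1 hypotheses (1 ∥ x)) → Div 1 (⟦ x ⟧ (u ∷ᵛ ε ∷ᵛ γ ∷ᵛ []ᵛ))
          conclude x checked = by-residues 1 hypotheses (1 ∥ x) checked (Iu ∷ᴵ Iε ∷ᴵ Iγ ∷ᴵ []ᴵ)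
            (normal₄ supersingular-or-nonsplit (invariant supersingular-or-nonsplit tt d) ∷ᵃ div-zero relation ∷ᵃ []ᵃ)
        -- At the pole `A₁` and `u` are odd, so `A₃ = u * A₂` is congruent to `A₂`: the reduction
        -- has the split shape.
        by-pole (pole w Iw γw≡1) = ¬div-1 (by-residues 1
          ((1 ∥ supersingular-or-nonsplit (v₀ :- v₁) v₃ (v₀ :* v₃)) ∷ unitᵉ ∷ εᵉ ∷ []) (1 ∥ con (+ 1)) tt integrals
          (normal-form supersingular-or-nonsplit A₁≡ refl A₃≡′ (invariant supersingular-or-nonsplit tt d) ∷ᵃ div-zero unit ∷ᵃ div-eq ε≡ ∷ᵃ []ᵃ))
          where open AtPole w Iw γw≡1

      avoids-even : ∀ {τ} → Order₂ τ → Apart τ (4× g) → MinimalModel M → ¬ Satisfied a₁-even M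
      avoids-even order-τ τ-4g minimal d = by-pole (valuation γ)
        where
        by-pole : Valuation γ → ⊥
        by-pole (pole w Iw γw≡1) = ¬div-1 (by-residues 1
          ((1 ∥ a₁-even (v₀ :- v₁) v₃ (v₀ :* v₃)) ∷ unitᵉ ∷ εᵉ ∷ []) (1 ∥ con (+ 1)) tt integrals
          (normal-form a₁-even A₁≡ refl A₃≡′ (invariant a₁-even tt d) ∷ᵃ div-zero unit ∷ᵃ div-eq ε≡ ∷ᵃ []ᵃ))
          where open AtPole w Iw γw≡1
        by-pole (integer Iγ) = by-root (second-two order-τ τ-4g)
          where
          hypotheses : List (Constraint 3)
          hypotheses = condition₄ᵉ a₁-even ∷ relationᵉ ∷ []
          conclude : (x : Expr 3) → T (check 1 hypotheses (1 ∥ x)) → Div 1 (⟦ x ⟧ (u ∷ᵛ ε ∷ᵛ γ ∷ᵛ []ᵛ))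
          conclude x checked = by-residues 1 hypotheses (1 ∥ x) checked (Iu ∷ᴵ Iε ∷ᴵ Iγ ∷ᴵ []ᴵ) (normal₄ a₁-even (invariant a₁-even tt d) ∷ᵃ div-zero relation ∷ᵃ []ᵃ)
          du : Div 1 u
          du = conclude v₀ tt
          by-root : ∃[ v ] v * v ≡ q 8 * γ * γ + q 8 * γ * u + u * u → ⊥
          by-root (v , v²) = by-parity (parity Iγ)
            where
            Iv : Integral v
            Iv = v-integral Iγ v v²
            by-parity : Div 1 γ ⊎ Div 1 (γ - 1ℚ) → ⊥
            by-parity (inj₁ dγ) = not-all-divisible₄ minimal du (conclude v₁ tt) dγ
            -- With `u` even and `γ` odd, a quarter of `8γ² + 8γu + u²` is 2 or 3 modulo 4, hence no
            -- square.
            by-parity (inj₂ dγ) = ¬div-1 (by-residues 4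
              ((1 ∥ v₀) ∷ (1 ∥ v₁ :- con (+ 1)) ∷ (4 ∥ v₂ :* v₂ :- (con (+ 8) :* v₁ :* v₁ :+ con (+ 8) :* v₁ :* v₀ :+ v₀ :* v₀)) ∷ [])
              (1 ∥ con (+ 1)) tt (Iu ∷ᴵ Iγ ∷ᴵ Iv ∷ᴵ []ᴵ) (du ∷ᵃ dγ ∷ᵃ div-eq v² ∷ᵃ []ᵃ))

    module FourTwo (g : Carrier G) (form : Normalised g) (o : Order₄ g) {τ : Carrier G} (order-τ : Order₂ τ) (τ-2g : Apart τ (2× g)) where
      open Order₄ o
      open Order₂ order-τ renaming (g≢e to τ≢e; 2g≡e to 2τ≡e)

      2g : Carrier G
      2g = 2× g

      I₁ : Integral (X g)
      I₁ = quarter-integral (X g) (Y g) (X 2g) (on-curve g≢e) (double g≢e 2g≢e refl) (ψ₂²-root 2g≢e 4g≡e)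

      open Normalised form
      module O = Relations embW g X-g Y-g g≢e 2g≢e
      module O₄ = O.Order4 4g≡e

      It : Integral (Y g)
      It = y-integral (X g) (Y g) (on-curve g≢e) I₁

      IA₃ : Integral A₃
      IA₃ = subst Integral A₃-def (J₃ +ᴵ I₁ *ᴵ J₁ +ᴵ ι-integral (+ 2) *ᴵ It)

      Xτ≢ : O.X τ ≢ O.X 2g
      Xτ≢ = O.X-distinct τ≢e 2g≢e τ-2g

      avoids : ¬ Satisfied supersingular-or-nonsplit M
      avoids d = by-pole (valuation s)
        where
        by-pole : Valuation s → ⊥
        -- With `A₃ = A₁ * A₂` the condition becomes `1 + 2 * A₁ * A₂`, an odd number.
        by-pole (integer Is) = ¬div-1 (by-residues 1 ((1 ∥ supersingular-or-nonsplit v₀ v₁ (v₀ :* v₁)) ∷ []) (1 ∥ con (+ 1)) tt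
          (IA₁ ∷ᴵ IA₂ ∷ᴵ []ᴵ) (shifted ∷ᵃ []ᵃ))
          where
          I2g : Integral (X 2g)
          I2g = subst Integral (sym 2g-x) (Is *ᴵ Is +ᴵ J₁ *ᴵ Is -ᴵ J₂ -ᴵ I₁ -ᴵ I₁)
          open IntegralForm g g≢e 2g≢e form I₁ I2g using (IA₁; IA₂; normal-form; invariant)
          shifted : Satisfies supersingular-or-nonsplit A₁ A₂ (A₁ * A₂)
          shifted = normal-form supersingular-or-nonsplit refl refl O₄.A₃≡A₁A₂ (invariant supersingular-or-nonsplit tt d)
        -- Here 2P reduces to the identity, and a rational point τ contradicts −1 not being a square modulo 4.
        by-pole (pole l Il sl≡1) = by-root (O₄.four-two τ τ≢e 2τ≡e Xτ≢)
          where
          f α U : ℚ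
          f = a2 N + q 3 * X g
          α = a1 N * l + 1ℚ
          U = 1ℚ + q 2 * l * a1 N - q 4 * l * l * f
          If : Integral f
          If = J₂ +ᴵ ι-integral (+ 3) *ᴵ I₁
          Iα : Integral α
          Iα = J₁ *ᴵ Il +ᴵ 1ᴵ
          IU : Integral U
          IU = 1ᴵ +ᴵ ι-integral (+ 2) *ᴵ Il *ᴵ J₁ -ᴵ ι-integral (+ 4) *ᴵ Il *ᴵ Il *ᴵ If
          A₁l : A₁ * l ≡ α
          A₁l = lin₂ (- l) 1ℚ A₁-def sl≡1 (identity (a1 N) s l A₁)
            where
            identity = solve 4 (λ a₁ s l A₁ → A₁ ⊗ l ⊖ (a₁ ⊗ l ⊕ Κ 1ℚ) ≋ ⊝ l ⊗ (a₁ ⊕ Κ (q 2) ⊗ s ⊖ A₁) ⊕ Κ 1ℚ ⊗ (s ⊗ (Κ (q 2) ⊗ l) ⊖ Κ 1ℚ)) refl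
          A₂l² : q 4 * l * l * A₂ ≡ - U
          A₂l² = lin₂ (- (q 4 * l * l)) (- (q 2 * a1 N * l + q 2 * s * l + 1ℚ)) A₂-def sl≡1 (identity (a1 N) (a2 N) (X g) s l A₂)
            where
            identity = solve 6 (λ a₁ a₂ r s l A₂ → Κ (q 4) ⊗ l ⊗ l ⊗ A₂ ⊖ ⊝ (Κ 1ℚ ⊕ Κ (q 2) ⊗ l ⊗ a₁ ⊖ Κ (q 4) ⊗ l ⊗ l ⊗ (a₂ ⊕ Κ (q 3) ⊗ r)) ≋
              ⊝ (Κ (q 4) ⊗ l ⊗ l) ⊗ (a₂ ⊖ s ⊗ a₁ ⊕ Κ (q 3) ⊗ r ⊖ s ⊗ s ⊖ A₂) ⊕ ⊝ (Κ (q 2) ⊗ a₁ ⊗ l ⊕ Κ (q 2) ⊗ s ⊗ l ⊕ Κ 1ℚ) ⊗ (s ⊗ (Κ (q 2) ⊗ l) ⊖ Κ 1ℚ)) refl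
          A₃l³ : q 4 * l * l * l * A₃ + α * U ≡ 0ℚ
          A₃l³ = lin₃ (q 4 * l * l * l) (q 4 * l * l * A₂) α O₄.A₃≡A₁A₂ A₁l A₂l² (identity l A₁ A₂ A₃ α U)
            where
            identity = solve 6 (λ l A₁ A₂ A₃ α U → Κ (q 4) ⊗ l ⊗ l ⊗ l ⊗ A₃ ⊕ α ⊗ U ⊖ Κ 0ℚ ≋
              Κ (q 4) ⊗ l ⊗ l ⊗ l ⊗ (A₃ ⊖ A₁ ⊗ A₂) ⊕ Κ (q 4) ⊗ l ⊗ l ⊗ A₂ ⊗ (A₁ ⊗ l ⊖ α) ⊕ α ⊗ (Κ (q 4) ⊗ l ⊗ l ⊗ A₂ ⊖ ⊝ U)) refl
          -- `U` is odd and `α * U` is the negative of `4l³A₃`, so 4 divides `α`.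
          dα : Div 2 α
          dα = by-residues 2 ((2 ∥ con (+ 4) :* v₁ :* v₁ :* v₁ :* v₃ :+ αᵉ :* (con (+ 1) :+ con (+ 2) :* v₁ :* v₀ :- con (+ 4) :* v₁ :* v₁ :* v₂)) ∷ [])
                 (2 ∥ αᵉ) tt (J₁ ∷ᴵ Il ∷ᴵ If ∷ᴵ IA₃ ∷ᴵ []ᴵ) (div-zero A₃l³ ∷ᵃ []ᵃ)
            where
            αᵉ : Expr 4
            αᵉ = v₀ :* v₁ :+ con (+ 1)
          by-root : ∃[ v ] v * v ≡ A₁ * A₁ - q 16 * A₂ → ⊥
          -- Since 4 divides `α`, the square of `l * v` is -4 modulo 16.
          by-root (v , v²) = ¬div-1 (by-residues 4 ((2 ∥ v₀) ∷ (4 ∥ v₁ :* v₁ :- squareᵉ) ∷ []) (1 ∥ con (+ 1)) tt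
            (Iα ∷ᴵ Iy ∷ᴵ Il *ᴵ Il *ᴵ If ∷ᴵ []ᴵ) (dα ∷ᵃ div-eq y² ∷ᵃ []ᵃ))
            where
            squareᵉ : Expr 3
            squareᵉ = v₀ :* v₀ :+ con (+ 4) :* (con (+ 2) :* v₀ :- con (+ 1) :- con (+ 4) :* v₂)
            c : ℚ
            c = α * α + q 4 * (q 2 * α - 1ℚ - q 4 * (l * l * f))
            y² : l * v * (l * v) ≡ c
            y² = lin₃ (l * l) (A₁ * l + α) (- q 4) v² A₁l A₂l² (identity (a1 N) l v A₁ A₂ f)
              where
              identity = solve 6 (λ a₁ l v A₁ A₂ f → let α = a₁ ⊗ l ⊕ Κ 1ℚ in
                l ⊗ v ⊗ (l ⊗ v) ⊖ (α ⊗ α ⊕ Κ (q 4) ⊗ (Κ (q 2) ⊗ α ⊖ Κ 1ℚ ⊖ Κ (q 4) ⊗ (l ⊗ l ⊗ f))) ≋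
                l ⊗ l ⊗ (v ⊗ v ⊖ (A₁ ⊗ A₁ ⊖ Κ (q 16) ⊗ A₂)) ⊕ (A₁ ⊗ l ⊕ α) ⊗ (A₁ ⊗ l ⊖ α) ⊕
                ⊝ Κ (q 4) ⊗ (Κ (q 4) ⊗ l ⊗ l ⊗ A₂ ⊖ ⊝ (Κ 1ℚ ⊕ Κ (q 2) ⊗ l ⊗ a₁ ⊖ Κ (q 4) ⊗ l ⊗ l ⊗ f))) refl
            Iy : Integral (l * v)
            Iy = sqrt-integral y² (Iα *ᴵ Iα +ᴵ ι-integral (+ 4) *ᴵ (ι-integral (+ 2) *ᴵ Iα -ᴵ 1ᴵ -ᴵ ι-integral (+ 4) *ᴵ (Il *ᴵ Il *ᴵ If)))

    module ThreeTwo (g : Carrier G) (form : Normalised g) (o : Order₃ g) {τ : Carrier G} (order-τ : Order₂ τ) where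
      open Order₃ o
      open Order₂ order-τ renaming (g≢e to τ≢e; 2g≡e to 2τ≡e)

      2g : Carrier G
      2g = 2× g

      X₂≡X₁ : X 2g ≡ X g
      X₂≡X₁ = negatives g≢e 2g≢e 3g≡e

      I₁ : Integral (X g)
      I₁ = cyclic-integral (X g) (Y g) (X g) (on-curve g≢e) (trans (cong (_* ψ₂² N (X g)) (sym X₂≡X₁)) (double g≢e 2g≢e refl)) []ᵈ

      open IntegralForm g g≢e 2g≢e form I₁ (subst Integral (sym X₂≡X₁) I₁)
      module O₃ = O.Order3 3g≡e
      module Oτ = O₃.WithTwo τ τ≢e 2τ≡e
      open Oτ.Root Oτ.square-root

      module Even (minimal : MinimalModel M) (d : Satisfied a₁-even M) where
        dA₁ : Div 1 A₁
        dA₁ = normal-form a₁-even refl refl refl (invariant a₁-even tt d)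

        module Half (B : ℚ) (IB : Integral B) (A₁≡ : A₁ ≡ q 2 * B) where
          -- A pole `k = 1/(2l)` would turn `A₃ = k²(A₁ + 2k)` into `4l³A₃ = 1 + 2Bl`, an even
          -- number equal to an odd one.
          Ik : Integral k
          Ik = by-pole (valuation k)
            where
            by-pole : Valuation k → Integral k
            by-pole (integer I) = I
            by-pole (pole l Il kl≡1) = ⊥-elim (¬div-1 (by-residues 1
              ((1 ∥ con (+ 1) :+ con (+ 2) :* v₀ :* v₁ :- con (+ 4) :* v₁ :* v₁ :* v₁ :* v₂) ∷ []) (1 ∥ con (+ 1)) tt
              (IB ∷ᴵ Il ∷ᴵ IA₃ ∷ᴵ []ᴵ) (div-eq eq ∷ᵃ []ᵃ)))
              where
              eq : 1ℚ + q 2 * B * l ≡ q 4 * l * l * l * A₃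
              eq = lin₃ (- (q 4 * l * l * l)) (- (q 4 * l * l * l * k * k))
                     (- (1ℚ + q 2 * k * l + q 2 * k * l * (q 2 * k * l) + q 2 * B * l * (1ℚ + q 2 * k * l))) A₃≡ A₁≡ kl≡1 (identity A₁ A₃ B k l)
                where
                identity = solve 5 (λ A₁ A₃ B k l → Κ 1ℚ ⊕ Κ (q 2) ⊗ B ⊗ l ⊖ Κ (q 4) ⊗ l ⊗ l ⊗ l ⊗ A₃ ≋
                  ⊝ (Κ (q 4) ⊗ l ⊗ l ⊗ l) ⊗ (A₃ ⊖ k ⊗ k ⊗ (A₁ ⊕ Κ (q 2) ⊗ k)) ⊕ ⊝ (Κ (q 4) ⊗ l ⊗ l ⊗ l ⊗ k ⊗ k) ⊗ (A₁ ⊖ Κ (q 2) ⊗ B) ⊕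
                  ⊝ (Κ 1ℚ ⊕ Κ (q 2) ⊗ k ⊗ l ⊕ Κ (q 2) ⊗ k ⊗ l ⊗ (Κ (q 2) ⊗ k ⊗ l) ⊕ Κ (q 2) ⊗ B ⊗ l ⊗ (Κ 1ℚ ⊕ Κ (q 2) ⊗ k ⊗ l)) ⊗ (k ⊗ (Κ (q 2) ⊗ l) ⊖ Κ 1ℚ)) refl

          n : ℚ
          n = B + k

          In : Integral n
          In = IB +ᴵ Ik

          A₃≡′ : A₃ ≡ q 2 * (k * k * n)
          A₃≡′ = lin₂ 1ℚ (k * k) A₃≡ A₁≡ (identity A₁ A₃ B k)
            where
            identity = solve 4 (λ A₁ A₃ B k → A₃ ⊖ Κ (q 2) ⊗ (k ⊗ k ⊗ (B ⊕ k)) ≋ Κ 1ℚ ⊗ (A₃ ⊖ k ⊗ k ⊗ (A₁ ⊕ Κ (q 2) ⊗ k)) ⊕ k ⊗ k ⊗ (A₁ ⊖ Κ (q 2) ⊗ B)) refl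

          A₁≡n : A₁ ≡ q 2 * (n - k)
          A₁≡n = trans A₁≡ (identity B k)
            where
            identity = solve 2 (λ B k → Κ (q 2) ⊗ B ≋ Κ (q 2) ⊗ (B ⊕ k ⊖ k)) refl

          -- `A₁` is even and `A₂` is zero, so minimality forbids 8 to divide `A₃ = 2k²n`.
          -- Consequently `k` is odd and 4 does not divide `n`.
          contradiction-from : Div 3 (q 2 * (k * k * n)) → ⊥
          contradiction-from d₃ = not-all-divisible minimal dA₁ (div-zero O₃.A₂≡0) (subst (Div 3) (sym A₃≡′) d₃)

          n-multiple-of-4 : Div 2 n → ⊥
          n-multiple-of-4 dn = contradiction-from (by-residues 3 ((2 ∥ v₁) ∷ []) (3 ∥ con (+ 2) :* (v₀ :* v₀ :* v₁)) tt (Ik ∷ᴵ In ∷ᴵ []ᴵ) (dn ∷ᵃ []ᵃ))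

          dk : Div 1 (k - 1ℚ)
          dk = by-parity (parity Ik)
            where
            by-parity : Div 1 k ⊎ Div 1 (k - 1ℚ) → Div 1 (k - 1ℚ)
            by-parity (inj₂ h) = h
            by-parity (inj₁ h) = ⊥-elim (contradiction-from
              (by-residues 3 ((1 ∥ v₀) ∷ []) (3 ∥ con (+ 2) :* (v₀ :* v₀ :* v₁)) tt (Ik ∷ᴵ In ∷ᴵ []ᴵ) (h ∷ᵃ []ᵃ)))

          -- A second point of order 2, respectively a half of τ, forces 4 ∣ n.
          another-two : ∀ τ′ → τ′ ≢ e → τ′ ⊞ τ′ ≡ e → O.X τ′ ≢ O.X τ → ⊥
          another-two τ′ τ′≢e 2τ′≡e X≢ = by-root (Oτ.split Oτ.square-root n A₁≡n τ′ τ′≢e 2τ′≡e X≢)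
            where
            by-root : ∃[ v ] v * v ≡ n * n - q 4 * n * k → ⊥
            -- For odd `n` the number `n² - 4nk` is 5 modulo 8; for `n = 2m` with `m` odd, a quarter
            -- of it is 3 modulo 4. Neither is a square.
            by-root (v , v²) = n-multiple-of-4 (by-residues 4
              ((1 ∥ v₁ :- con (+ 1)) ∷ (4 ∥ v₂ :* v₂ :- (v₀ :* v₀ :- con (+ 4) :* v₀ :* v₁)) ∷ []) (2 ∥ v₀) tt
              (In ∷ᴵ Ik ∷ᴵ Iv ∷ᴵ []ᴵ) (dk ∷ᵃ div-eq v² ∷ᵃ []ᵃ))
              where
              Iv : Integral v
              Iv = sqrt-integral v² (In *ᴵ In -ᴵ ι-integral (+ 4) *ᴵ In *ᴵ Ik)

          half : ∀ Q → Q ≢ e → Q ⊞ Q ≡ τ → ⊥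
          -- `h² = k⁴ + 2nk³` with `k` and `h` odd: both `h²` and `k⁴` are 1 modulo 8, so 8 divides
          -- `2nk³`.
          half Q Q≢e 2Q≡τ = n-multiple-of-4 (by-residues 3
              ((1 ∥ v₁ :- con (+ 1)) ∷ (3 ∥ v₂ :* v₂ :- v₁ :* v₁ :* v₁ :* (con (+ 2) :* v₀ :+ v₁)) ∷ []) (2 ∥ v₀) tt
              (In ∷ᴵ Ik ∷ᴵ Ih ∷ᴵ []ᴵ) (dk ∷ᵃ div-eq h² ∷ᵃ []ᵃ))
            where
            h : ℚ
            h = O.X Q + k * k
            h² : h * h ≡ k * k * k * (q 2 * n + k)
            h² = lin₂ 1ℚ (k * k * k) (Oτ.halved Oτ.square-root Q Q≢e 2Q≡τ) A₁≡n (identity h n k A₁)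
              where
              identity = solve 4 (λ h n k A₁ → h ⊗ h ⊖ k ⊗ k ⊗ k ⊗ (Κ (q 2) ⊗ n ⊕ k) ≋
                Κ 1ℚ ⊗ (h ⊗ h ⊖ k ⊗ k ⊗ k ⊗ (A₁ ⊕ Κ (q 3) ⊗ k)) ⊕ k ⊗ k ⊗ k ⊗ (A₁ ⊖ Κ (q 2) ⊗ (n ⊖ k))) refl
            Ih : Integral h
            Ih = sqrt-integral h² (Ik *ᴵ Ik *ᴵ Ik *ᴵ (ι-integral (+ 2) *ᴵ In +ᴵ Ik))

        half-of-A₁ : ∃[ B ] Integral B × A₁ ≡ q 2 * B
        half-of-A₁ = div-π dA₁

      avoids-another : ∀ {τ′} → Order₂ τ′ → Apart τ′ τ → MinimalModel M → ¬ Satisfied a₁-even M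
      avoids-another {τ′} (order₂ τ′≢e 2τ′≡e) τ′-τ minimal d = from (Even.half-of-A₁ minimal d)
        where
        from : ∃[ B ] Integral B × A₁ ≡ q 2 * B → ⊥
        from (B , IB , A₁≡) = Even.Half.another-two minimal d B IB A₁≡ τ′ τ′≢e 2τ′≡e (O.X-distinct τ′≢e τ≢e τ′-τ)

      avoids-half : ∀ Q → Q ≢ e → Q ⊞ Q ≡ τ → MinimalModel M → ¬ Satisfied a₁-even M
      avoids-half Q Q≢e 2Q≡τ minimal d = from (Even.half-of-A₁ minimal d)
        where
        from : ∃[ B ] Integral B × A₁ ≡ q 2 * B → ⊥
        from (B , IB , A₁≡) = Even.Half.half minimal d B IB A₁≡ Q Q≢e 2Q≡τ

-- The prime 3

module At3 where
  open Place 3 three-prime public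

  module On (M : WModel ℤ) {G : TorsionGroup} (emb : Embeds G (toQ M)) where
    open OnMinimal M emb public
    open Integrality₃ N using (module Model₃)
    open Model₃ J₁ J₂ J₃ J₄ J₆ public using (root-integral; three-integral; five-integral; seven-integral)

    -- The tangent at a flex gives (2λ + a₁)² = 12x + b₂.
    module Three {g : Carrier G} (o : Order₃ g) where
      open Order₃ o

      X₂≡X₁ : X (g ⊞ g) ≡ X g
      X₂≡X₁ = negatives g≢e 2g≢e 3g≡e

      I₁ : Integral (X g)
      I₁ = three-integral (X g) (Y g) (on-curve g≢e) (trans (cong (_* ψ₂² N (X g)) (sym X₂≡X₁)) (double g≢e 2g≢e refl))

      -- The tangent slope is integral, so b₂ is a square modulo 3, and 2 is not one.
      avoids : ¬ Satisfied b₂≡2 M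
      avoids d = from (tangent-line g≢e 2g≢e)
        where
        from : tangent-den N (X g) (Y g) ≢ 0ℚ × (Σ (Line g g) λ L → Line.slope L * tangent-den N (X g) (Y g) ≡ tangent-num N (X g) (Y g)) → ⊥
        from (_ , line l sx _ , _) = ¬div-1 (by-residues 1
          ((1 ∥ b₂≡2 v₀ v₁ v₁) ∷ (1 ∥ v₂ :- (v₃ :* v₃ :+ v₀ :* v₃ :- v₁ :- v₂ :- v₂)) ∷ []) (1 ∥ con (+ 1)) tt
          (J₁ ∷ᴵ J₂ ∷ᴵ I₁ ∷ᴵ Il ∷ᴵ []ᴵ) (d ∷ᵃ div-eq flex ∷ᵃ []ᵃ))
          where
          flex : X g ≡ third-x N (X g) (X g) l
          flex = trans (sym X₂≡X₁) sx
          Il : Integral l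
          Il = slope-integral {X g} {X g} {X g} {l} flex I₁ I₁ I₁

    module Five (g : Carrier G) (form : Normalised g) (o : Order₅ g) where
      open FiveForm g form o
      open WithIntegral
        (five-integral (X g) (Y g) (X (2× g)) (on-curve g≢e) double₁ double₂)
        (five-integral (X (2× g)) (Y (2× g)) (X g) (on-curve 2g≢e) double₂ double₁)

      -- b₂ is congruent to `u² + ε²`, which is anisotropic modulo 3, so 3 would divide both
      -- parameters.
      avoids : MinimalModel M → ¬ Satisfied b₂≡0 M
      avoids minimal d = not-all-divisible₅ minimal (conclude v₀ tt) (conclude v₁ tt)
        where
        conclude : (x : Expr 2) → T (check 1 (conditionᵉ b₂≡0 ∷ []) (1 ∥ x)) → Div 1 (⟦ x ⟧ (u ∷ᵛ ε ∷ᵛ []ᵛ))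
        conclude x checked = by-residues 1 (conditionᵉ b₂≡0 ∷ []) (1 ∥ x) checked (Iu ∷ᴵ Iε ∷ᴵ []ᴵ) (normal b₂≡0 (invariant b₂≡0 tt d) ∷ᵃ []ᵃ)

      -- b₂ ≡ u² + ε² ≡ 2 would make u and ε units, and then the 2-division polynomial has no root modulo 3.
      module WithTwo {τ : Carrier G} (order-τ : Order₂ τ) where
        open Order₂ order-τ renaming (g≢e to τ≢e; 2g≡e to 2τ≡e)

        Ix : Integral (O.X τ)
        Ix = IX τ≢e (root-integral (X τ) (Y τ) (on-curve τ≢e) (ψ₂²-root τ≢e 2τ≡e))

        root : ψ₂² (wm (u - ε) (- (u * ε)) (u * - (u * ε)) 0ℚ 0ℚ) (O.X τ) ≡ 0ℚ
        root = transport A₁≡ A₂≡ A₃≡′ (O.ψ₂²-root τ≢e 2τ≡e)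
          where
          transport : ∀ {x y z x′ y′ z′} → x ≡ x′ → y ≡ y′ → z ≡ z′ → ψ₂² (wm x y z 0ℚ 0ℚ) (O.X τ) ≡ 0ℚ → ψ₂² (wm x′ y′ z′ 0ℚ 0ℚ) (O.X τ) ≡ 0ℚ
          transport refl refl refl h = h

        avoids-two : ¬ Satisfied b₂≡2 M
        avoids-two d = ¬div-1 (by-residues 1
          (conditionᵉ b₂≡2 ∷
           (1 ∥ con (+ 4) :* v₂ :* v₂ :* v₂ :+ (a₁ :* a₁ :+ con (+ 4) :* a₂) :* v₂ :* v₂ :+
                con (+ 2) :* (con (+ 2) :* con (+ 0) :+ a₁ :* a₃) :* v₂ :+ (a₃ :* a₃ :+ con (+ 4) :* con (+ 0))) ∷ [])
          (1 ∥ con (+ 1)) tt (Iu ∷ᴵ Iε ∷ᴵ Ix ∷ᴵ []ᴵ) (normal b₂≡2 (invariant b₂≡2 tt d) ∷ᵃ div-zero root ∷ᵃ []ᵃ))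
          where
          a₁ a₂ a₃ : Expr 3
          a₁ = v₀ :- v₁
          a₂ = :- (v₀ :* v₁)
          a₃ = v₀ :* :- (v₀ :* v₁)

    module Seven (g : Carrier G) (form : Normalised g) (o : Order₇ g) where
      open SevenForm g form o
      open WithIntegral
        (seven-integral (X g) (Y g) (X (2× g)) (X (4× g)) (on-curve g≢e) double₁ double₂ double₃)
        (seven-integral (X (2× g)) (Y (2× g)) (X (4× g)) (X g) (on-curve 2g≢e) double₂ double₃ double₁)
        (seven-integral (X (4× g)) (Y (4× g)) (X g) (X (2× g)) (on-curve 4g≢e) double₃ double₁ double₂)

      avoids : ¬ Satisfied b₂≡2 M
      avoids d = ¬div-1 (by-residues 1 (condition₄ᵉ b₂≡2 ∷ relationᵉ ∷ []) (1 ∥ con (+ 1)) tt (Iu ∷ᴵ Iε ∷ᴵ Iγ ∷ᴵ []ᴵ)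
        (normal₄ b₂≡2 (invariant b₂≡2 tt d) ∷ᵃ div-eq relation ∷ᵃ []ᵃ))

    module Eight (g : Carrier G) (form : Normalised g) (o : Order₈ g) where
      private
        I₄g : Integral (X (4× g))
        I₄g = root-integral (X (4× g)) (Y (4× g)) (on-curve 4g≢e) (ψ₂²-root 4g≢e 4g⊞4g≡e)
          where open Order₈ o
        I₂g : Integral (X (2× g))
        I₂g = half-integral (X (2× g)) (Y (2× g)) (X (4× g)) (on-curve 2g≢e) (double 2g≢e 4g≢e 2g⊞2g≡4g) I₄g
          where open Order₈ o
      open EightForm g form o I₂g

      Iγ : Integral γ
      Iγ = γ-root (IX 4g≢e I₄g)

      avoids : MinimalModel M → ¬ Satisfied b₂≡0 M
      avoids minimal d = not-all-divisible₄ minimal (conclude v₀ tt) (conclude v₁ tt) (conclude v₂ tt)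
        where
        hypotheses : List (Constraint 3)
        hypotheses = condition₄ᵉ b₂≡0 ∷ relationᵉ ∷ []
        conclude : (x : Expr 3) → T (check 1 hypotheses (1 ∥ x)) → Div 1 (⟦ x ⟧ (u ∷ᵛ ε ∷ᵛ γ ∷ᵛ []ᵛ))
        conclude x checked = by-residues 1 hypotheses (1 ∥ x) checked (Iu ∷ᴵ Iε ∷ᴵ Iγ ∷ᴵ []ᴵ)
          (normal₄ b₂≡0 (invariant b₂≡0 tt d) ∷ᵃ div-zero relation ∷ᵃ []ᵃ)

      avoids-two : ∀ {τ} → Order₂ τ → Apart τ (4× g) → ¬ Satisfied b₂≡2 M
      avoids-two order-τ τ-4g d = by-root (second-two order-τ τ-4g)
        where
        by-root : ∃[ v ] v * v ≡ q 8 * γ * γ + q 8 * γ * u + u * u → ⊥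
        by-root (v , v²) = ¬div-1 (by-residues 1
          (condition₄ᵉ b₂≡2 ∷ relationᵉ ∷ (1 ∥ v₃ :* v₃ :- (con (+ 8) :* v₂ :* v₂ :+ con (+ 8) :* v₂ :* v₀ :+ v₀ :* v₀)) ∷ [])
          (1 ∥ con (+ 1)) tt (Iu ∷ᴵ Iε ∷ᴵ Iγ ∷ᴵ v-integral Iγ v v² ∷ᴵ []ᴵ)
          (normal₄ b₂≡2 (invariant b₂≡2 tt d) ∷ᵃ div-zero relation ∷ᵃ div-eq v² ∷ᵃ []ᵃ))

    module FourTwo (g : Carrier G) (form : Normalised g) (o : Order₄ g) {τ : Carrier G} (order-τ : Order₂ τ) (τ-2g : Apart τ (2× g)) where
      open Order₄ o
      open Order₂ order-τ renaming (g≢e to τ≢e; 2g≡e to 2τ≡e)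

      2g : Carrier G
      2g = 2× g

      I₂ : Integral (X 2g)
      I₂ = root-integral (X 2g) (Y 2g) (on-curve 2g≢e) (ψ₂²-root 2g≢e 4g≡e)

      I₁ : Integral (X g)
      I₁ = half-integral (X g) (Y g) (X 2g) (on-curve g≢e) (double g≢e 2g≢e refl) I₂

      open IntegralForm g g≢e 2g≢e form I₁ I₂
      module O₄ = O.Order4 4g≡e

      Xτ≢ : O.X τ ≢ O.X 2g
      Xτ≢ = O.X-distinct τ≢e 2g≢e τ-2g

      -- From `A₂ ≡ - A₁²` follows `v² ≡ 2A₁²` modulo 3, so 3 divides `A₁` and `v`. Then
      -- `v² = A₁² - 16A₂` shows that 9 divides `A₂`.
      avoids : MinimalModel M → ¬ Satisfied b₂≡0 M
      avoids minimal d = by-root (O₄.four-two τ τ≢e 2τ≡e Xτ≢)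
        where
        by-root : ∃[ v ] v * v ≡ A₁ * A₁ - q 16 * A₂ → ⊥
        by-root (v , v²) = not-all-divisible minimal dA₁ dA₂ (subst (Div 3) (sym O₄.A₃≡A₁A₂) (div-*-div 1 2 dA₁ dA₂))
          where
          Iv : Integral v
          Iv = sqrt-integral v² (IA₁ *ᴵ IA₁ -ᴵ ι-integral (+ 16) *ᴵ IA₂)
          hypotheses : List (Constraint 3)
          hypotheses = (1 ∥ b₂≡0 v₀ v₁ (v₀ :* v₁)) ∷ (2 ∥ v₂ :* v₂ :- (v₀ :* v₀ :- con (+ 16) :* v₁)) ∷ []
          held : All (Holds (A₁ ∷ᵛ A₂ ∷ᵛ v ∷ᵛ []ᵛ)) hypotheses
          held = normal-form b₂≡0 refl refl O₄.A₃≡A₁A₂ (invariant b₂≡0 tt d) ∷ᵃ div-eq v² ∷ᵃ []ᵃ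
          dA₁ : Div 1 A₁
          dA₁ = by-residues 2 hypotheses (1 ∥ v₀) tt (IA₁ ∷ᴵ IA₂ ∷ᴵ Iv ∷ᴵ []ᴵ) held
          dA₂ : Div 2 A₂
          dA₂ = by-residues 2 hypotheses (2 ∥ v₁) tt (IA₁ ∷ᴵ IA₂ ∷ᴵ Iv ∷ᴵ []ᴵ) held

-- Comparison with the table of allowed indices

triple : ℤ × ℤ × ℤ → Vec ℤ 3
triple (x , y , z) = x ∷ᵛ y ∷ᵛ z ∷ᵛ []ᵛ

record Obstruction : Set where
  constructor _∣ᵒ_
  field
    prime : ℕ
    expr  : Expr 3

_Obstructs_ : Obstruction → ℤ × ℤ × ℤ → Set
(p ∣ᵒ e) Obstructs a = + p ∣ eval e (triple a)

obstructs? : ∀ a o → Dec (o Obstructs a)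
obstructs? a (p ∣ᵒ e) = + p ∣? eval e (triple a)

infix 5 _∣ᵒ_

at-2 at-3 : Condition → Obstruction
at-2 o = 2 ∣ᵒ o v₀ v₁ v₂
at-3 o = 3 ∣ᵒ o v₀ v₁ v₂

-- The congruences excluded by the presence of the group. Every index missing from `allowed`
-- satisfies at least one of them, which `settled?` decides.
obstructions : TorsionGroup → List Obstruction
obstructions C1    = []
obstructions C2    = at-2 supersingular ∷ []
obstructions C3    = at-3 b₂≡2 ∷ []
obstructions C4    = at-2 supersingular ∷ []
obstructions C5    = at-2 cuspidal-or-nonsplit ∷ at-3 b₂≡0 ∷ []
obstructions C6    = at-2 supersingular ∷ at-3 b₂≡2 ∷ []
obstructions C7    = at-2 not-split ∷ at-3 b₂≡2 ∷ []
obstructions C8    = at-2 supersingular-or-nonsplit ∷ at-3 b₂≡0 ∷ []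
obstructions C9    = at-2 not-split ∷ at-3 b₂≡2 ∷ []
obstructions C10   = at-2 supersingular ∷ at-2 cuspidal-or-nonsplit ∷ at-3 b₂≡0 ∷ at-3 b₂≡2 ∷ []
obstructions C12   = at-2 a₁-even ∷ at-3 b₂≡2 ∷ []
obstructions C2×C2 = at-2 supersingular ∷ []
obstructions C2×C4 = at-2 supersingular-or-nonsplit ∷ at-3 b₂≡0 ∷ []
obstructions C2×C6 = at-2 a₁-even ∷ at-3 b₂≡2 ∷ []
obstructions C2×C8 = at-2 supersingular-or-nonsplit ∷ at-2 a₁-even ∷ at-3 b₂≡0 ∷ at-3 b₂≡2 ∷ []

indices : List ℕ
indices = 1 ∷ 2 ∷ 3 ∷ 4 ∷ 5 ∷ 6 ∷ 7 ∷ 8 ∷ 9 ∷ 10 ∷ 11 ∷ 12 ∷ []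

Settled : TorsionGroup → ℕ → Set
Settled G i = i ∈ allowed G ⊎ Any (λ o → o Obstructs R i) (obstructions G)

settled? : ∀ G → Dec (All (Settled G) indices)
settled? G = all? (λ i → (i ∈? allowed G) ⊎-dec any? (obstructs? (R i)) (obstructions G)) indices

settled : ∀ G → All (Settled G) indices
settled C1    = from-yes (settled? C1)
settled C2    = from-yes (settled? C2)
settled C3    = from-yes (settled? C3)
settled C4    = from-yes (settled? C4)
settled C5    = from-yes (settled? C5)
settled C6    = from-yes (settled? C6)
settled C7    = from-yes (settled? C7)
settled C8    = from-yes (settled? C8)
settled C9    = from-yes (settled? C9)
settled C10   = from-yes (settled? C10)
settled C12   = from-yes (settled? C12)
settled C2×C2 = from-yes (settled? C2×C2)
settled C2×C4 = from-yes (settled? C2×C4)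
settled C2×C6 = from-yes (settled? C2×C6)
settled C2×C8 = from-yes (settled? C2×C8)

reduced-index : ∀ M → IsReduced M → ∃[ i ] i ∈ indices × coeffs M ≡ R i
reduced-index (wm _ _ _ _ _) (inj₁ refl , inj₂ (inj₁ refl) , inj₁ refl)        = 1 , from-yes (1 ∈? indices) , refl
reduced-index (wm _ _ _ _ _) (inj₁ refl , inj₂ (inj₁ refl) , inj₂ refl)        = 2 , from-yes (2 ∈? indices) , refl
reduced-index (wm _ _ _ _ _) (inj₁ refl , inj₁ refl , inj₁ refl)               = 3 , from-yes (3 ∈? indices) , refl
reduced-index (wm _ _ _ _ _) (inj₁ refl , inj₁ refl , inj₂ refl)               = 4 , from-yes (4 ∈? indices) , refl
reduced-index (wm _ _ _ _ _) (inj₁ refl , inj₂ (inj₂ refl) , inj₁ refl)        = 5 , from-yes (5 ∈? indices) , refl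
reduced-index (wm _ _ _ _ _) (inj₁ refl , inj₂ (inj₂ refl) , inj₂ refl)        = 6 , from-yes (6 ∈? indices) , refl
reduced-index (wm _ _ _ _ _) (inj₂ refl , inj₂ (inj₁ refl) , inj₁ refl)        = 7 , from-yes (7 ∈? indices) , refl
reduced-index (wm _ _ _ _ _) (inj₂ refl , inj₂ (inj₁ refl) , inj₂ refl)        = 8 , from-yes (8 ∈? indices) , refl
reduced-index (wm _ _ _ _ _) (inj₂ refl , inj₁ refl , inj₁ refl)               = 9 , from-yes (9 ∈? indices) , refl
reduced-index (wm _ _ _ _ _) (inj₂ refl , inj₁ refl , inj₂ refl)               = 10 , from-yes (10 ∈? indices) , refl
reduced-index (wm _ _ _ _ _) (inj₂ refl , inj₂ (inj₂ refl) , inj₁ refl)        = 11 , from-yes (11 ∈? indices) , refl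
reduced-index (wm _ _ _ _ _) (inj₂ refl , inj₂ (inj₂ refl) , inj₂ refl)        = 12 , from-yes (12 ∈? indices) , refl

module _ (M : WModel ℤ) (minimal₂ : At2.MinimalModel M) (minimal₃ : At3.MinimalModel M) where

  Avoids : Obstruction → Set
  Avoids o = ¬ o Obstructs coeffs M

  avoids-2 : (o : Condition) → ¬ At2.Satisfied o M → Avoids (at-2 o)
  avoids-2 o avoids h = avoids (subst (At2.Div 1) (ι-eval (o v₀ v₁ v₂) (triple (coeffs M))) (At2.ι-div {1} h))

  avoids-3 : (o : Condition) → ¬ At3.Satisfied o M → Avoids (at-3 o)
  avoids-3 o avoids h = avoids (subst (At3.Div 1) (ι-eval (o v₀ v₁ v₂) (triple (coeffs M))) (At3.ι-div {1} h))

  module Avoided {G : TorsionGroup} (emb : Embeds G (toQ M)) where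
    open Multiples G public

    two : ∀ {τ} → Order₂ τ → Avoids (at-2 supersingular)
    two o = avoids-2 supersingular (At2.On.Two.avoids M emb o)

    three : ∀ {g} → Order₃ g → Avoids (at-3 b₂≡2)
    three o = avoids-3 b₂≡2 (At3.On.Three.avoids M emb o)

    five₂ : ∀ {g} → Order₅ g → Avoids (at-2 cuspidal-or-nonsplit)
    five₂ {g} o = avoids-2 cuspidal-or-nonsplit (At2.On.Five.avoids M emb g (TateForm.normalise emb g (Order₅.g≢e o) (Order₅.2g≢e o)) o minimal₂)

    five₃ : ∀ {g} → Order₅ g → Avoids (at-3 b₂≡0)
    five₃ {g} o = avoids-3 b₂≡0 (At3.On.Five.avoids M emb g (TateForm.normalise emb g (Order₅.g≢e o) (Order₅.2g≢e o)) o minimal₃)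

    ten₃ : ∀ {g τ} → Order₅ g → Order₂ τ → Avoids (at-3 b₂≡2)
    ten₃ {g} o o′ = avoids-3 b₂≡2 (At3.On.Five.WithTwo.avoids-two M emb g (TateForm.normalise emb g (Order₅.g≢e o) (Order₅.2g≢e o)) o o′)

    seven₂ : ∀ {g} → Order₇ g → Avoids (at-2 not-split)
    seven₂ {g} o = avoids-2 not-split (At2.On.Seven.avoids M emb g (TateForm.normalise emb g (Order₇.g≢e o) (Order₇.2g≢e o)) o minimal₂)

    seven₃ : ∀ {g} → Order₇ g → Avoids (at-3 b₂≡2)
    seven₃ {g} o = avoids-3 b₂≡2 (At3.On.Seven.avoids M emb g (TateForm.normalise emb g (Order₇.g≢e o) (Order₇.2g≢e o)) o)

    nine₂ : ∀ {g} → Order₉ g → Avoids (at-2 not-split)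
    nine₂ {g} o = avoids-2 not-split (At2.On.Nine.avoids M emb g (TateForm.normalise emb g (Order₉.g≢e o) (Order₉.2g≢e o)) o minimal₂)

    eight₂ : ∀ {g} → Order₈ g → Avoids (at-2 supersingular-or-nonsplit)
    eight₂ {g} o = avoids-2 supersingular-or-nonsplit (At2.On.Eight.avoids M emb g (TateForm.normalise emb g (Order₈.g≢e o) (Order₈.2g≢e o)) o minimal₂)

    eight₃ : ∀ {g} → Order₈ g → Avoids (at-3 b₂≡0)
    eight₃ {g} o = avoids-3 b₂≡0 (At3.On.Eight.avoids M emb g (TateForm.normalise emb g (Order₈.g≢e o) (Order₈.2g≢e o)) o minimal₃)

    two-eight₂ : ∀ {g τ} → Order₈ g → Order₂ τ → Apart τ (4× g) → Avoids (at-2 a₁-even)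
    two-eight₂ {g} o o′ τ-4g = avoids-2 a₁-even (At2.On.Eight.avoids-even M emb g (TateForm.normalise emb g (Order₈.g≢e o) (Order₈.2g≢e o)) o o′ τ-4g minimal₂)

    two-eight₃ : ∀ {g τ} → Order₈ g → Order₂ τ → Apart τ (4× g) → Avoids (at-3 b₂≡2)
    two-eight₃ {g} o o′ τ-4g = avoids-3 b₂≡2 (At3.On.Eight.avoids-two M emb g (TateForm.normalise emb g (Order₈.g≢e o) (Order₈.2g≢e o)) o o′ τ-4g)

    two-four₂ : ∀ {g τ} → Order₄ g → Order₂ τ → Apart τ (2× g) → Avoids (at-2 supersingular-or-nonsplit)
    two-four₂ {g} o o′ τ-2g = avoids-2 supersingular-or-nonsplit (At2.On.FourTwo.avoids M emb g (TateForm.normalise emb g (Order₄.g≢e o) (Order₄.2g≢e o)) o o′ τ-2g)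

    two-four₃ : ∀ {g τ} → Order₄ g → Order₂ τ → Apart τ (2× g) → Avoids (at-3 b₂≡0)
    two-four₃ {g} o o′ τ-2g = avoids-3 b₂≡0 (At3.On.FourTwo.avoids M emb g (TateForm.normalise emb g (Order₄.g≢e o) (Order₄.2g≢e o)) o o′ τ-2g minimal₃)

    two-six₂ : ∀ {g τ τ′} → Order₃ g → Order₂ τ → Order₂ τ′ → Apart τ′ τ → Avoids (at-2 a₁-even)
    two-six₂ {g} o o′ o″ τ′-τ = avoids-2 a₁-even (At2.On.ThreeTwo.avoids-another M emb g (TateForm.normalise emb g (Order₃.g≢e o) (Order₃.2g≢e o)) o o′ o″ τ′-τ minimal₂)

    twelve₂ : ∀ {g τ} → Order₃ g → Order₂ τ → ∀ Q → Q ≢ e → 2× Q ≡ τ → Avoids (at-2 a₁-even)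
    twelve₂ {g} o o′ Q Q≢e 2Q≡τ = avoids-2 a₁-even (At2.On.ThreeTwo.avoids-half M emb g (TateForm.normalise emb g (Order₃.g≢e o) (Order₃.2g≢e o)) o o′ Q Q≢e 2Q≡τ minimal₂)

  avoided : ∀ G → Embeds G (toQ M) → All Avoids (obstructions G)
  avoided C1 emb = []ᵃ
  avoided C2 emb = two {zero , # 1} (order₂ (λ ()) refl) ∷ᵃ []ᵃ
    where open Avoided {C2} emb
  avoided C3 emb = three {zero , # 1} (order₃ (λ ()) (λ ()) refl) ∷ᵃ []ᵃ
    where open Avoided {C3} emb
  avoided C4 emb = two {zero , # 2} (order₂ (λ ()) refl) ∷ᵃ []ᵃ
    where open Avoided {C4} emb
  avoided C5 emb = five₂ g ∷ᵃ five₃ g ∷ᵃ []ᵃ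
    where
    open Avoided {C5} emb
    g : Order₅ (zero , # 1)
    g = order₅ (λ ()) (λ ()) (λ ()) (λ ()) (λ ()) refl refl
  avoided C6 emb = two {zero , # 3} (order₂ (λ ()) refl) ∷ᵃ three {zero , # 2} (order₃ (λ ()) (λ ()) refl) ∷ᵃ []ᵃ
    where open Avoided {C6} emb
  avoided C7 emb = seven₂ g ∷ᵃ seven₃ g ∷ᵃ []ᵃ
    where
    open Avoided {C7} emb
    g : Order₇ (zero , # 1)
    g = order₇ (λ ()) (λ ()) (λ ()) (λ ()) (λ ()) (λ ()) refl refl refl
  avoided C8 emb = eight₂ g ∷ᵃ eight₃ g ∷ᵃ []ᵃ
    where
    open Avoided {C8} emb
    g : Order₈ (zero , # 1)
    g = order₈ (λ ()) (λ ()) (λ ()) (λ ()) (λ ()) (λ ()) (λ ()) refl refl refl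
  avoided C9 emb = nine₂ g ∷ᵃ three {zero , # 3} (order₃ (λ ()) (λ ()) refl) ∷ᵃ []ᵃ
    where
    open Avoided {C9} emb
    g : Order₉ (zero , # 1)
    g = order₉ (λ ()) (λ ()) (λ ()) (λ ()) (λ ()) (λ ()) (λ ()) (λ ()) (λ ()) (λ ()) refl refl refl refl
  avoided C10 emb = two τ ∷ᵃ five₂ g ∷ᵃ five₃ g ∷ᵃ ten₃ g τ ∷ᵃ []ᵃ
    where
    open Avoided {C10} emb
    g : Order₅ (zero , # 2)
    g = order₅ (λ ()) (λ ()) (λ ()) (λ ()) (λ ()) refl refl
    τ : Order₂ (zero , # 5)
    τ = order₂ (λ ()) refl
  -- The point of order 2 is six times the generator, and its half `Q` is three times the generator.
  avoided C12 emb = twelve₂ g (order₂ (λ ()) refl) (zero , # 3) (λ ()) refl ∷ᵃ three g ∷ᵃ []ᵃ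
    where
    open Avoided {C12} emb
    g : Order₃ (zero , # 4)
    g = order₃ (λ ()) (λ ()) refl
  avoided C2×C2 emb = two {zero , # 1} (order₂ (λ ()) refl) ∷ᵃ []ᵃ
    where open Avoided {C2×C2} emb
  avoided C2×C4 emb = two-four₂ g τ (apart (λ ()) (λ ())) ∷ᵃ two-four₃ g τ (apart (λ ()) (λ ())) ∷ᵃ []ᵃ
    where
    open Avoided {C2×C4} emb
    g : Order₄ (zero , # 1)
    g = order₄ (λ ()) (λ ()) refl
    τ : Order₂ (# 1 , zero)
    τ = order₂ (λ ()) refl
  avoided C2×C6 emb = two-six₂ g τ τ′ (apart (λ ()) (λ ())) ∷ᵃ three g ∷ᵃ []ᵃ
    where
    open Avoided {C2×C6} emb
    g : Order₃ (zero , # 2)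
    g = order₃ (λ ()) (λ ()) refl
    τ : Order₂ (zero , # 3)
    τ = order₂ (λ ()) refl
    τ′ : Order₂ (# 1 , zero)
    τ′ = order₂ (λ ()) refl
  avoided C2×C8 emb = eight₂ g ∷ᵃ two-eight₂ g τ (apart (λ ()) (λ ())) ∷ᵃ eight₃ g ∷ᵃ two-eight₃ g τ (apart (λ ()) (λ ())) ∷ᵃ []ᵃ
    where
    open Avoided {C2×C8} emb
    g : Order₈ (zero , # 1)
    g = order₈ (λ ()) (λ ()) (λ ()) (λ ()) (λ ()) (λ ()) (λ ()) refl refl refl
    τ : Order₂ (# 1 , zero)
    τ = order₂ (λ ()) refl

-- The group is given inside the points of `E`, while the local arguments run on the integral model.
transport : ∀ {E F G} → IsoQ E F → Embeds G E → Embeds G F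
transport {E} {F} {G} iso emb = from (isoQ⇒change E F iso)
  where
  from : ∃[ u ] ∃[ r ] ∃[ s ] ∃[ t ] u ≢ 0ℚ × E ≡ change u r s t F → Embeds G F
  from (u , r , s , t , u≢0 , refl) = by-inverse (inverse u≢0)
    where
    by-inverse : ∃[ v ] u * v ≡ 1ℚ → Embeds G F
    by-inverse (v , uv≡1) = Transport.φ-embeds u v r s t uv≡1 F G emb

theoremA : (E : WModel ℚ) → discQ E ≢ 0ℚ → (T : TorsionGroup) → Embeds T E →
    (M : WModel ℤ) → IsReducedMinimalModel E M →
    ∃[ i ] (i ∈ allowed T × coeffs M ≡ R i)
theoremA E disc≢0 T emb M (minimal , reduced) = from (reduced-index M reduced)
  where
  embM : Embeds T (toQ M)
  embM = transport {E} {toQ M} {T} (proj₁ minimal) emb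
  minimal-at : ∀ p (p-prime : Prime p) → Place.MinimalModel p p-prime M
  minimal-at p p-prime = Minimality.minimal-at-p p p-prime {E} {M} disc≢0 minimal
  from : ∃[ i ] i ∈ indices × coeffs M ≡ R i → ∃[ i ] (i ∈ allowed T × coeffs M ≡ R i)
  from (i , i∈ , M≡Rᵢ) = by-table (lookupAll (settled T) i∈)
    where
    by-table : Settled T i → ∃[ i ] (i ∈ allowed T × coeffs M ≡ R i)
    by-table (inj₁ allowed) = i , allowed , M≡Rᵢ
    by-table (inj₂ obstructed) =
      ⊥-elim (All¬⇒¬Any (avoided M (minimal-at 2 two-prime) (minimal-at 3 three-prime) T embM)
                        (subst (λ a → Any (_Obstructs a) (obstructions T)) (sym M≡Rᵢ) obstructed))
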